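{- Let $n \geq 2$ and $a_n$ be integers. Let $\phi(x)\in \mathbb{Z}[x]$ be a monic polynomial which is irreducible modulo every prime less than $2n$. Suppose that $a_0(x), \dots, a_{n-1}(x)\in \mathbb{Z}[x]$ satisfy: (i) $\deg a_i(x) < \deg \phi(x)$ for $0\leq i\leq n-1$; (ii) the content of the polynomial $a_n a_0(x)$ is not divisible by any prime less than $2n$. Then the polynomial $$f_1(x)= \frac{a_{n}}{u_{2n}}\phi(x)^{2n}+\sum_{j=0}^{n-1}a_j(x)\frac{\phi(x)^{2j}}{u_{2j}}$$ is irreducible over $\mathbb{Q}$.
   Context: For each non-negative integer $j$, $u_j$ denotes the product of the odd positive integers $\leq j$ (so $u_0=u_2=1$, $u_4=3$, $u_6=15$, ...). A polynomial in $\mathbb{Z}[x]$ is irreducible modulo a prime $p$ if its reduction modulo $p$ is irreducible in $(\mathbb{Z}/p\mathbb{Z})[x]$. The content of a polynomial in $\mathbb{Z}[x]$ is the greatest common divisor of its coefficients. -}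

module Defs where

open import Algebra.Bundles using (RawSemiring)
import Algebra.Definitions.RawSemiring as SemiringDefs
open import Data.Fin.Base using (Fin; toℕ)
open import Data.Integer.Base as ℤ using (ℤ; +_; 0ℤ; 1ℤ)
import Data.Integer.Divisibility as ℤ
import Data.Integer.GCD as ℤ
import Data.Integer.Properties as ℤ
open import Data.List.Base using (List; []; _∷_; map; foldr; filter; upTo)
import Data.List.Relation.Unary.All as All
open import Data.List.Relation.Unary.All.Properties using (all-filter)
open import Data.Nat.Base as ℕ using (ℕ; zero; suc; NonZero)
open import Data.Nat.Divisibility as ℕ using (_∣?_)
open import Data.Nat.ListAction using (product)
open import Data.Nat.ListAction.Properties using (product≢0)
open import Data.Product.Base using (∃-syntax; _×_)
open import Data.Rational.Base as ℚ using (ℚ)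
open import Level using (Level)
open import Relation.Binary.PropositionalEquality.Core using (_≡_; refl)
open import Relation.Binary.Construct.Add.Infimum.Strict ℕ._<_ using (_<₋_)
open import Relation.Nullary.Construct.Add.Infimum using (_₋; ⊥₋; [_])
open import Relation.Nullary.Decidable.Core using (yes; no; ¬?)
open import Relation.Nullary.Negation.Core using (¬_; contradiction)

private
  variable
    c ℓ : Level

-- Polynomials are lists of coefficients, constant term first.  Trailing zeros
-- are allowed, so equality is coefficientwise rather than equality of lists.
module Polynomial (R : RawSemiring c ℓ) where

  open RawSemiring R

  Poly : Set c
  Poly = List Carrier

  coeff : Poly → ℕ → Carrier
  coeff []       _       = 0#
  coeff (a ∷ _)  zero    = a
  coeff (_ ∷ as) (suc i) = coeff as i

  infix  4 _≈ₚ_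
  infixl 6 _+ₚ_
  infixl 7 _*ₚ_
  infixr 7 _·_

  _≈ₚ_ : Poly → Poly → Set ℓ
  f ≈ₚ g = ∀ i → coeff f i ≈ coeff g i

  _+ₚ_ : Poly → Poly → Poly
  []       +ₚ g        = g
  (a ∷ as) +ₚ []       = a ∷ as
  (a ∷ as) +ₚ (b ∷ bs) = (a + b) ∷ (as +ₚ bs)

  _·_ : Carrier → Poly → Poly
  a · f = map (a *_) f

  _*ₚ_ : Poly → Poly → Poly
  []       *ₚ g = []
  (a ∷ as) *ₚ g = (a · g) +ₚ (0# ∷ (as *ₚ g))

  polyRawSemiring : RawSemiring c ℓ
  polyRawSemiring = record
    { Carrier = Poly
    ; _≈_     = _≈ₚ_
    ; _+_     = _+ₚ_
    ; _*_     = _*ₚ_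
    ; 0#      = []
    ; 1#      = 1# ∷ []
    }

  open SemiringDefs polyRawSemiring public using (Irreducible; sum; _^_)

-- ℤ/pℤ as the setoid of integers up to congruence modulo p.
ℤ/_ℤ : ℕ → RawSemiring _ _
ℤ/ p ℤ = record
  { Carrier = ℤ
  ; _≈_     = λ a b → + p ℤ.∣ a ℤ.- b
  ; _+_     = ℤ._+_
  ; _*_     = ℤ._*_
  ; 0#      = 0ℤ
  ; 1#      = 1ℤ
  }

module ℤ[x]             = Polynomial ℤ.+-*-rawSemiring
module ℚ[x]             = Polynomial ℚ.+-*-rawSemiring
module ℤ/ℤ[x] (p : ℕ)   = Polynomial (ℤ/ p ℤ)

-- Reduction modulo p keeps the integer coefficients and only coarsens equality.
reduce : (p : ℕ) → ℤ[x].Poly → ℤ/ℤ[x].Poly p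
reduce p f = f

IrreducibleMod : ℕ → ℤ[x].Poly → Set
IrreducibleMod p f = ℤ/ℤ[x].Irreducible p (reduce p f)

-- The zero polynomial has degree ⊥₋, standing for -∞.
deg : ℤ[x].Poly → ℕ ₋
deg []      = ⊥₋
deg (a ∷ f) with deg f
... | [ d ] = [ suc d ]
... | ⊥₋ with a ℤ.≟ 0ℤ
...   | yes _ = ⊥₋
...   | no  _ = [ 0 ]

infix 4 _<deg_
_<deg_ : ℤ[x].Poly → ℤ[x].Poly → Set
f <deg g = deg f <₋ deg g

Monic : ℤ[x].Poly → Set
Monic f = ∃[ d ] deg f ≡ [ d ] × ℤ[x].coeff f d ≡ 1ℤ

content : ℤ[x].Poly → ℤ
content = foldr ℤ.gcd 0ℤ

u : ℕ → ℕ
u j = product (filter (λ k → ¬? (2 ∣? k)) (upTo (suc j)))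

u-nonZero : ∀ j → NonZero (u j)
u-nonZero j =
  product≢0 (All.map odd⇒nonZero (all-filter (λ k → ¬? (2 ∣? k)) (upTo (suc j))))
  where
  odd⇒nonZero : ∀ {k} → ¬ (2 ℕ.∣ k) → NonZero k
  odd⇒nonZero {zero}  2∤0 = contradiction (ℕ.divides 0 refl) 2∤0
  odd⇒nonZero {suc _} _   = _

infixl 7 _/u_
_/u_ : ℤ → ℕ → ℚ
a /u j = ℚ._/_ a (u j) {{u-nonZero j}}

toℚ[x] : ℤ[x].Poly → ℚ[x].Poly
toℚ[x] = map (ℚ._/ 1)

f₁ : (n : ℕ) → ℤ → ℤ[x].Poly → (Fin n → ℤ[x].Poly) → ℚ[x].Poly
f₁ n aₙ φ a =
  (aₙ /u (2 ℕ.* n)) · toℚ[x] φ ^ (2 ℕ.* n)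
  +ₚ sum (λ j → toℚ[x] (a j) *ₚ ((1ℤ /u (2 ℕ.* toℕ j)) · toℚ[x] φ ^ (2 ℕ.* toℕ j)))
  where open ℚ[x]

module Submission where

-- Clearing denominators and applying Gauss's lemma, a factorisation of f₁ gives
-- F = G H in ℤ[x] with F = u_{2n} f₁.  Let d = deg φ and expand G and H in base φ,
-- with top digits at φ^I and φ^J, where deg G ≤ deg H.  Then n ≤ J < 2n and
-- I ≤ 2n - J.
--
-- An odd version of Sylvester's theorem provides a prime p ≥ 2n - J dividing an odd
-- number t with J ≤ t < 2n.  Since φ is irreducible modulo p, any choice of weights
-- for p and φ defines a valuation on ℤ[x].  As v_p(u_{2j}) < 2j / p, the weights
-- 2np + 1 for p and 2n for φ show that the constant digit of G is prime to p.
-- As p divides u_{2n} / u_{2j} for 2j < t, the weights t + 1 for p and 1 for φ then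
-- force all digits of H up to φ^t to be divisible by p, contradicting J ≤ t.
--
-- The odd Sylvester theorem says that l consecutive odd numbers, the first m > 2l,
-- have a prime factor p > 2l.  Otherwise all prime factors are also at most a third of
-- the last number N.  Comparing the number of multiples of each p^e among them and
-- among 1, ..., l bounds their product by the odd part of l! times a product of prime
-- powers at most N, which is too small by the Chebyshev type bounds ∏_{p ≤ y} p ≤ 4^y
-- and 4 (π(x) - 1) ≤ x + 9.  These estimates suffice for l ≥ 4096; smaller l are
-- settled by computation.

-- In terms of Newton polygons for `φ` and `p`, the points of `F` lie on or above a line that falls
-- from height `v_p(u_{2n})` with slope less than `1 / p`. An edge falling by one unit must be
-- longer than `p`, whereas `G` has length `I ≤ 2n - J ≤ p`. Hence the requirement `p ≥ 2n - J`, and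
-- hence the constant digit of `G` is prime to `p`. The valuations are never constructed as
-- functions: a filtration by weight and a leading monomial of each factor suffice, and minimal
-- weights add up because the ideal `(p, φ)` is prime.
--
-- The obstacle in the odd Sylvester theorem is a tie. The least product of `l` terms exceeds the
-- odd part of `l!` by about `16 ^ l`, and `4 ^ (2 l) = 16 ^ l` is also what Chebyshev's bound
-- allows for the primes up to `2 l`. The tie is broken by using only primes up to `N / 3` if
-- `N ≤ 5 l`, and by the excess of `N` over `4 l` otherwise.

module OddPrimes where

  open import Data.Bool.Base using (Bool; true; false; _∧_; if_then_else_; T)
  open import Data.Bool.Properties using (T-∧; T-≡)
  open import Data.Empty using (⊥)
  open import Data.List.Base using (List; []; _∷_; filter; upTo)
  open import Data.List.Properties using (upTo-∷ʳ; filter-++; filter-accept; filter-reject)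
  open import Data.List.Relation.Unary.All as All using (All; []; _∷_)
  open import Data.Nat.Base hiding (parity)
  open import Data.Nat.Combinatorics.Specification using ([n∸k]!k!∣n!)
  open import Data.Nat.Divisibility
  open import Data.Nat.DivMod using (_/_; _%_; m/n*n≤m; m≡m%n+[m/n]*n; m%n<n; m*n/n≡m; /-monoˡ-≤)
  open import Data.Nat.Induction using (<-rec)
  open import Data.Nat.ListAction using (product)
  open import Data.Nat.ListAction.Properties using (product-++)
  open import Data.Nat.Primality using (Prime; prime?; prime[2]; euclidsLemma; prime⇒irreducible; prime⇒nonZero; prime⇒nonTrivial; ¬prime[0])
  open import Data.Nat.Primality.Factorisation using (factorise; module PrimeFactorisation)
  open import Data.Nat.Properties
  open import Data.Nat.Tactic.RingSolver using (solve-∀)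
  open import Data.Product.Base using (_×_; _,_; proj₁; proj₂; ∃-syntax)
  open import Data.Sum.Base using (_⊎_; inj₁; inj₂; [_,_]′)
  open import Data.Unit.Base using (tt)
  open import Defs using (u)
  open import Function.Base using (_∘_)
  open import Function.Bundles using (Equivalence)
  open import Relation.Binary.PropositionalEquality
  open import Relation.Nullary using (¬_; Dec; yes; no; contradiction; _×-dec_; ¬?; toWitness)

  -- Finite sums, products and indicators

  ∑ : (ℕ → ℕ) → ℕ → ℕ
  ∑ f zero    = 0
  ∑ f (suc n) = ∑ f n + f n

  ∏ : (ℕ → ℕ) → ℕ → ℕ
  ∏ f zero    = 1
  ∏ f (suc n) = ∏ f n * f n

  ∑-mono : ∀ {f g} n → (∀ i → i < n → f i ≤ g i) → ∑ f n ≤ ∑ g n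
  ∑-mono zero    _   = z≤n
  ∑-mono (suc n) f≤g = +-mono-≤ (∑-mono n λ i i<n → f≤g i (m<n⇒m<1+n i<n)) (f≤g n ≤-refl)

  ∑-cong : ∀ {f g} n → (∀ i → i < n → f i ≡ g i) → ∑ f n ≡ ∑ g n
  ∑-cong zero    _   = refl
  ∑-cong (suc n) f≡g = cong₂ _+_ (∑-cong n λ i i<n → f≡g i (m<n⇒m<1+n i<n)) (f≡g n ≤-refl)

  ∑-+ : ∀ f g n → ∑ (λ i → f i + g i) n ≡ ∑ f n + ∑ g n
  ∑-+ f g zero    = refl
  ∑-+ f g (suc n) = trans (cong (_+ (f n + g n)) (∑-+ f g n)) (solve (∑ f n) (∑ g n) (f n) (g n))
    where
    solve : ∀ a b c d → a + b + (c + d) ≡ a + c + (b + d)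
    solve = solve-∀

  ∑-zero : ∀ n → ∑ (λ _ → 0) n ≡ 0
  ∑-zero zero    = refl
  ∑-zero (suc n) = trans (+-identityʳ _) (∑-zero n)

  ∑-swap : ∀ (f : ℕ → ℕ → ℕ) m n → ∑ (λ i → ∑ (f i) n) m ≡ ∑ (λ j → ∑ (λ i → f i j) m) n
  ∑-swap f zero    n = sym (∑-zero n)
  ∑-swap f (suc m) n = trans (cong (_+ ∑ (f m) n) (∑-swap f m n)) (sym (∑-+ _ (f m) n))

  ∑-shift : ∀ f n → ∑ f (suc n) ≡ f 0 + ∑ (f ∘ suc) n
  ∑-shift f zero    = +-comm 0 (f 0)
  ∑-shift f (suc n) = trans (cong (_+ f (suc n)) (∑-shift f n)) (+-assoc (f 0) _ _)

  ∏-mono : ∀ {f g} n → (∀ i → i < n → f i ≤ g i) → ∏ f n ≤ ∏ g n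
  ∏-mono zero    _   = ≤-refl
  ∏-mono (suc n) f≤g = *-mono-≤ (∏-mono n λ i i<n → f≤g i (m<n⇒m<1+n i<n)) (f≤g n ≤-refl)

  ∏-cong : ∀ {f g} n → (∀ i → i < n → f i ≡ g i) → ∏ f n ≡ ∏ g n
  ∏-cong zero    _   = refl
  ∏-cong (suc n) f≡g = cong₂ _*_ (∏-cong n λ i i<n → f≡g i (m<n⇒m<1+n i<n)) (f≡g n ≤-refl)

  ∏-* : ∀ f g n → ∏ (λ i → f i * g i) n ≡ ∏ f n * ∏ g n
  ∏-* f g zero    = refl
  ∏-* f g (suc n) =
    trans (cong (_* (f n * g n)) (∏-* f g n)) ([m*n]*[o*p]≡[m*o]*[n*p] (∏ f n) (∏ g n) (f n) (g n))

  ∏-const : ∀ c n → ∏ (λ _ → c) n ≡ c ^ n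
  ∏-const c zero    = refl
  ∏-const c (suc n) = trans (cong (_* c) (∏-const c n)) (*-comm (c ^ n) c)

  ∏-pos : ∀ f n → (∀ i → i < n → 1 ≤ f i) → 1 ≤ ∏ f n
  ∏-pos f zero    _   = ≤-refl
  ∏-pos f (suc n) 1≤f = *-mono-≤ (∏-pos f n λ i i<n → 1≤f i (m<n⇒m<1+n i<n)) (1≤f n ≤-refl)

  ∏-monoˡ : ∀ f {m n} → (∀ i → 1 ≤ f i) → m ≤ n → ∏ f m ≤ ∏ f n
  ∏-monoˡ f {m} {n} 1≤f m≤n = go (≤⇒≤′ m≤n)
    where
    go : ∀ {n} → m ≤′ n → ∏ f m ≤ ∏ f n
    go (≤′-reflexive refl) = ≤-refl
    go {suc n} (≤′-step m≤n) = ≤-trans (go m≤n) (subst (_≤ ∏ f n * f n) (*-identityʳ _) (*-monoʳ-≤ (∏ f n) (1≤f n)))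

  𝟙 : ∀ {p} {P : Set p} → Dec P → ℕ
  𝟙 (yes _) = 1
  𝟙 (no  _) = 0

  𝟙≤1 : ∀ {p} {P : Set p} (d : Dec P) → 𝟙 d ≤ 1
  𝟙≤1 (yes _) = ≤-refl
  𝟙≤1 (no  _) = z≤n

  𝟙-mono : ∀ {p q} {P : Set p} {Q : Set q} (d : Dec P) (e : Dec Q) → (P → Q) → 𝟙 d ≤ 𝟙 e
  𝟙-mono (yes p) (yes _) _ = ≤-refl
  𝟙-mono (yes p) (no ¬q) f = contradiction (f p) ¬q
  𝟙-mono (no _)  _       _ = z≤n

  𝟙-cong : ∀ {p q} {P : Set p} {Q : Set q} (d : Dec P) (e : Dec Q) → (P → Q) → (Q → P) → 𝟙 d ≡ 𝟙 e
  𝟙-cong d e f g = ≤-antisym (𝟙-mono d e f) (𝟙-mono e d g)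

  𝟙-yes : ∀ {p} {P : Set p} (d : Dec P) → P → 𝟙 d ≡ 1
  𝟙-yes (yes _) _ = refl
  𝟙-yes (no ¬p) p = contradiction p ¬p

  𝟙-no : ∀ {p} {P : Set p} (d : Dec P) → ¬ P → 𝟙 d ≡ 0
  𝟙-no (yes p) ¬p = contradiction p ¬p
  𝟙-no (no _)  _  = refl

  -- The p-adic valuation of n, provided that n < 2 ^ E.
  ν : ℕ → ℕ → ℕ → ℕ
  ν E p n = ∑ (λ e → 𝟙 (p ^ suc e ∣? n)) E

  -- Odd primes, products of their powers, and factorisation

  OddPrime : ℕ → Set
  OddPrime p = Prime p × 2 < p

  oddPrime? : ∀ p → Dec (OddPrime p)
  oddPrime? p = prime? p ×-dec 2 <? p

  1<p : ∀ {p} → Prime p → 1 < p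
  1<p pp = nonTrivial⇒n>1 _ {{prime⇒nonTrivial pp}}

  primePower : (ℕ → ℕ) → ℕ → ℕ
  primePower f p with oddPrime? p
  ... | yes _ = p ^ f p
  ... | no  _ = 1

  -- The prime 2 is left out because only odd numbers and odd parts are ever factored.
  ∏ₚ : (ℕ → ℕ) → ℕ → ℕ
  ∏ₚ f y = ∏ (primePower f) (suc y)

  primePower-pos : ∀ f p → 1 ≤ primePower f p
  primePower-pos f p with oddPrime? p
  ... | yes (pp , _) = m^n>0 p {{prime⇒nonZero pp}} (f p)
  ... | no  _ = ≤-refl

  primePower-mono : ∀ {f g} p → (OddPrime p → f p ≤ g p) → primePower f p ≤ primePower g p
  primePower-mono p f≤g with oddPrime? p
  ... | yes op = ^-monoʳ-≤ p {{prime⇒nonZero (proj₁ op)}} (f≤g op)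
  ... | no  _ = ≤-refl

  primePower-+ : ∀ f g p → primePower (λ q → f q + g q) p ≡ primePower f p * primePower g p
  primePower-+ f g p with oddPrime? p
  ... | yes _ = ^-distribˡ-+-* p (f p) (g p)
  ... | no  _ = refl

  ∏ₚ-mono : ∀ {f g} y → (∀ p → OddPrime p → f p ≤ g p) → ∏ₚ f y ≤ ∏ₚ g y
  ∏ₚ-mono y f≤g = ∏-mono (suc y) λ p _ → primePower-mono p (f≤g p)

  ∏ₚ-+ : ∀ f g y → ∏ₚ (λ p → f p + g p) y ≡ ∏ₚ f y * ∏ₚ g y
  ∏ₚ-+ f g y = trans (∏-cong (suc y) λ p _ → primePower-+ f g p) (∏-* _ _ (suc y))

  ∏ₚ-0 : ∀ y → ∏ₚ (λ _ → 0) y ≡ 1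
  ∏ₚ-0 y = trans (∏-cong (suc y) λ p _ → one p) (trans (∏-const 1 (suc y)) (^-zeroˡ (suc y)))
    where
    one : ∀ p → primePower (λ _ → 0) p ≡ 1
    one p with oddPrime? p
    ... | yes _ = refl
    ... | no  _ = refl

  ∏ₚ-∑ : ∀ (f : ℕ → ℕ → ℕ) y l → ∏ (λ i → ∏ₚ (f i) y) l ≡ ∏ₚ (λ p → ∑ (λ i → f i p) l) y
  ∏ₚ-∑ f y zero    = sym (∏ₚ-0 y)
  ∏ₚ-∑ f y (suc l) = trans (cong (_* ∏ₚ (f l) y) (∏ₚ-∑ f y l)) (sym (∏ₚ-+ _ (f l) y))

  prime∣prime : ∀ {p q} → Prime p → Prime q → p ∣ q → p ≡ q
  prime∣prime {p} {q} pp pq p∣q with prime⇒irreducible pq p∣q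
  ... | inj₁ p≡1 = contradiction p≡1 (>⇒≢ (1<p pp))
  ... | inj₂ p≡q = p≡q

  ∣^⇒∣ : ∀ {p} → Prime p → ∀ m e → p ∣ m ^ e → p ∣ m
  ∣^⇒∣ pp m zero    p∣1 = contradiction (∣1⇒≡1 p∣1) (>⇒≢ (1<p pp))
  ∣^⇒∣ pp m (suc e) p∣ with euclidsLemma m (m ^ e) pp p∣
  ... | inj₁ p∣m  = p∣m
  ... | inj₂ p∣m^ = ∣^⇒∣ pp m e p∣m^

  p^e∣m*n⇒p^e∣n : ∀ {p} → Prime p → ∀ m → p ∤ m → ∀ e n → p ^ e ∣ m * n → p ^ e ∣ n
  p^e∣m*n⇒p^e∣n     pp m p∤m zero    n _ = 1∣ n
  p^e∣m*n⇒p^e∣n {p} pp m p∤m (suc e) n p∣mn with euclidsLemma m n pp (∣-trans (m∣m*n (p ^ e)) p∣mn)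
  ... | inj₁ p∣m = contradiction p∣m p∤m
  ... | inj₂ (divides q refl) = subst (p ^ suc e ∣_) (*-comm p q) (*-monoʳ-∣ p (p^e∣m*n⇒p^e∣n pp m p∤m e q p^e∣mq))
    where
    instance _ = prime⇒nonZero pp
    eq : ∀ m q p → m * (q * p) ≡ p * (m * q)
    eq = solve-∀
    p^e∣mq : p ^ e ∣ m * q
    p^e∣mq = *-cancelˡ-∣ p (subst (p ^ suc e ∣_) (eq m q p) p∣mn)

  n<2^n : ∀ n → n < 2 ^ n
  n<2^n zero    = s≤s z≤n
  n<2^n (suc n) = begin-strict
    suc n         <⟨ s<s (n<2^n n) ⟩
    1 + 2 ^ n     ≤⟨ +-monoˡ-≤ (2 ^ n) (m^n>0 2 n) ⟩
    2 ^ n + 2 ^ n ≡⟨ cong (2 ^ n +_) (+-identityʳ _) ⟨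
    2 ^ suc n     ∎
    where open ≤-Reasoning

  -- k bounds the number of divisions by p.
  split-p : ∀ {p} → Prime p → ∀ k n → 1 ≤ n → n < 2 ^ k →
            ∃[ v ] ∃[ w ] n ≡ p ^ v * w × p ∤ w × v ≤ k
  split-p     pp zero    n 1≤n n<1 = contradiction (≤-trans n<1 1≤n) (n≮n n)
  split-p {p} pp (suc k) n 1≤n n<2^ with p ∣? n
  ... | no p∤n = 0 , n , sym (+-identityʳ n) , p∤n , z≤n
  ... | yes (divides q refl) with split-p pp k q 1≤q q<2^k
    where
    1≤q : 1 ≤ q
    1≤q = n≢0⇒n>0 λ { refl → contradiction 1≤n λ () }
    q<2^k : q < 2 ^ k
    q<2^k = *-cancelˡ-< 2 q (2 ^ k) (≤-<-trans (subst (_≤ q * p) (*-comm q 2) (*-monoʳ-≤ q (1<p pp))) n<2^)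
  ...   | v , w , refl , p∤w , v≤k = suc v , w , eq (p ^ v) w p , p∤w , s≤s v≤k
    where
    eq : ∀ a w p → a * w * p ≡ p * a * w
    eq = solve-∀

  ∑-𝟙≤ : ∀ {P : ℕ → Set} (P? : ∀ e → Dec (P e)) v E → v ≤ E →
         (∀ e → e < v → P e) → (∀ e → v ≤ e → ¬ P e) → ∑ (λ e → 𝟙 (P? e)) E ≡ v
  ∑-𝟙≤ P? v zero    z≤n _ _ = refl
  ∑-𝟙≤ P? v (suc E) v≤ below above with m≤n⇒m<n∨m≡n v≤
  ... | inj₁ (s≤s v≤E) = trans (cong₂ _+_ (∑-𝟙≤ P? v E v≤E below above) (𝟙-no (P? E) (above E v≤E))) (+-identityʳ v)
  ... | inj₂ refl = trans (cong₂ _+_ (full E λ e e<E → below e (m<n⇒m<1+n e<E)) (𝟙-yes (P? E) (below E ≤-refl))) (+-comm E 1)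
    where
    full : ∀ E → (∀ e → e < E → _) → ∑ (λ e → 𝟙 (P? e)) E ≡ E
    full zero    _ = refl
    full (suc E) h = trans (cong₂ _+_ (full E λ e e<E → h e (m<n⇒m<1+n e<E)) (𝟙-yes (P? E) (h E ≤-refl))) (+-comm E 1)

  ν-split : ∀ {p} → Prime p → ∀ E v w → p ∤ w → v ≤ E → ν E p (p ^ v * w) ≡ v
  ν-split {p} pp E v w p∤w v≤E = ∑-𝟙≤ (λ e → p ^ suc e ∣? p ^ v * w) v E v≤E below above
    where
    instance
      _ = prime⇒nonZero pp
    below : ∀ e → e < v → p ^ suc e ∣ p ^ v * w
    below e e<v = ∣-trans (m^n∣m^o e<v) (m∣m*n w)
      where
      m^n∣m^o : ∀ {m n} → m ≤ n → p ^ m ∣ p ^ n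
      m^n∣m^o {m} {n} m≤n = divides (p ^ (n ∸ m)) (trans (cong (p ^_) (sym (m∸n+n≡m m≤n))) (^-distribˡ-+-* p (n ∸ m) m))
    above : ∀ e → v ≤ e → p ^ suc e ∤ p ^ v * w
    above e v≤e p∣ = p∤w (∣-trans (m∣m*n (p ^ (e ∸ v))) (*-cancelˡ-∣ (p ^ v) {{m^n≢0 p v}} (subst (_∣ p ^ v * w) eq p∣)))
      where
      eq : p ^ suc e ≡ p ^ v * (p ^ suc (e ∸ v))
      eq = trans (cong (p ^_) (trans (cong suc (sym (m+[n∸m]≡n v≤e))) (sym (+-suc v (e ∸ v))))) (^-distribˡ-+-* p v (suc (e ∸ v)))

  ν-coprime : ∀ {p q} → Prime p → Prime q → q ≢ p → ∀ E v w → ν E q (p ^ v * w) ≡ ν E q w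
  ν-coprime {p} {q} pp pq q≢p E v w = ∑-cong E λ e _ → 𝟙-cong (q ^ suc e ∣? p ^ v * w) (q ^ suc e ∣? w)
    (p^e∣m*n⇒p^e∣n pq (p ^ v) (λ q∣p^v → q≢p (prime∣prime pq pp (∣^⇒∣ pq p v q∣p^v))) (suc e) w)
    (λ q∣w → ∣-trans q∣w (n∣m*n (p ^ v)))

  primeFactor : ∀ n → 1 < n → ∃[ p ] Prime p × p ∣ n
  primeFactor n 1<n with factorise n {{>-nonZero (<-trans z<s 1<n)}}
  ... | record { factors = [] ; isFactorisation = eq } = contradiction eq (>⇒≢ 1<n)
  ... | record { factors = p ∷ ps ; isFactorisation = eq ; factorsPrime = pp ∷ _ } =
    p , pp , divides (product ps) (trans eq (*-comm p _))

  -- Induction on the bound `y` for the prime factors: the full power of `suc y` is split off, and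
  -- the cofactor `w` has only smaller prime factors, with the same valuations there as `n`.
  n≡∏ₚν : ∀ y E n → 1 ≤ n → n < 2 ^ E → 2 ∤ n → (∀ p → Prime p → p ∣ n → p ≤ y) → n ≡ ∏ₚ (λ p → ν E p n) y
  n≡∏ₚν zero E n 1≤n n<2^E 2∤n p≤y with n ≟ 1
  ... | yes refl = sym (∏ₚ-zero (λ p → ν E p 1))
    where
    ∏ₚ-zero : ∀ f → ∏ₚ f 0 ≡ 1
    ∏ₚ-zero f with oddPrime? 0
    ... | yes (pp , _) = contradiction pp ¬prime[0]
    ... | no _ = refl
  ... | no n≢1 = contradiction (p≤y _ (proj₁ (proj₂ pf)) (proj₂ (proj₂ pf))) (<⇒≱ (<-trans z<s (1<p (proj₁ (proj₂ pf)))))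
    where
    pf = primeFactor n (≤∧≢⇒< 1≤n (n≢1 ∘ sym))
  n≡∏ₚν (suc y) E n 1≤n n<2^E 2∤n p≤1+y with oddPrime? (suc y)
  ... | no ¬op = trans (n≡∏ₚν y E n 1≤n n<2^E 2∤n p≤y) (sym (*-identityʳ _))
    where
    p≤y : ∀ p → Prime p → p ∣ n → p ≤ y
    p≤y p pp p∣n with m≤n⇒m<n∨m≡n (p≤1+y p pp p∣n)
    ... | inj₁ (s≤s p≤y) = p≤y
    ... | inj₂ refl = contradiction (pp , ≤∧≢⇒< (1<p pp) λ { refl → 2∤n p∣n }) ¬op
  ... | yes (pp , _) with split-p pp E n 1≤n n<2^E
  ...   | v , w , refl , p∤w , v≤E = begin
    p ^ v * w                                  ≡⟨ *-comm (p ^ v) w ⟩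
    w * p ^ v                                  ≡⟨ cong (_* p ^ v) (n≡∏ₚν y E w 1≤w (≤-<-trans w≤n n<2^E) (λ 2∣w → 2∤n (∣-trans 2∣w (n∣m*n (p ^ v)))) p≤y) ⟩
    ∏ₚ (λ q → ν E q w) y * p ^ v               ≡⟨ cong₂ _*_ (∏-cong (suc y) λ q q<p → same q q<p) (cong (p ^_) (sym (ν-split pp E v w p∤w v≤E))) ⟩
    ∏ₚ (λ q → ν E q (p ^ v * w)) y * p ^ ν E p (p ^ v * w) ∎
    where
    open ≡-Reasoning
    p = suc y
    1≤w : 1 ≤ w
    1≤w = n≢0⇒n>0 λ { refl → p∤w (p ∣0) }
    w≤n : w ≤ p ^ v * w
    w≤n = m≤n*m w (p ^ v) {{m^n≢0 p v}}
    p≤y : ∀ q → Prime q → q ∣ w → q ≤ y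
    p≤y q pq q∣w with m≤n⇒m<n∨m≡n (p≤1+y q pq (∣-trans q∣w (n∣m*n (p ^ v))))
    ... | inj₁ (s≤s q≤y) = q≤y
    ... | inj₂ refl = contradiction q∣w p∤w
    same : ∀ q → q < p → primePower (λ q → ν E q w) q ≡ primePower (λ q → ν E q (p ^ v * w)) q
    same q q<p with oddPrime? q
    ... | yes (pq , _) = cong (q ^_) (sym (ν-coprime pp pq (<⇒≢ q<p) E v w))
    ... | no _ = refl

  -- Odd parts

  -- k bounds the number of halvings.
  oddPartWithin : ℕ → ℕ → ℕ
  oddPartWithin zero    n = n
  oddPartWithin (suc k) n with 2 ∣? n
  ... | yes (divides q _) = oddPartWithin k q
  ... | no _ = n

  oddPart : ℕ → ℕ
  oddPart n = oddPartWithin n n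

  half< : ∀ k q → q * 2 < 2 ^ suc k → q < 2 ^ k
  half< k q h = *-cancelˡ-< 2 q (2 ^ k) (subst (_< 2 ^ suc k) (*-comm q 2) h)

  1≤half : ∀ q → 1 ≤ q * 2 → 1 ≤ q
  1≤half q 1≤ = n≢0⇒n>0 λ { refl → contradiction 1≤ λ () }

  -- A halving uses up one unit of `k` and also halves `n`, so every `k` with `n < 2 ^ k` reaches
  -- the odd part. This matters in `oddPart-even`, where the two sides start from different bounds.
  oddPartWithin-irr : ∀ k k′ n → 1 ≤ n → n < 2 ^ k → n < 2 ^ k′ → oddPartWithin k n ≡ oddPartWithin k′ n
  oddPartWithin-irr zero _ n 1≤n n<1 _ = contradiction (≤-trans n<1 1≤n) (n≮n n)
  oddPartWithin-irr (suc k) zero n 1≤n _ n<1 = contradiction (≤-trans n<1 1≤n) (n≮n n)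
  oddPartWithin-irr (suc k) (suc k′) n 1≤n n<k n<k′ with 2 ∣? n
  ... | yes (divides q refl) = oddPartWithin-irr k k′ q (1≤half q 1≤n) (half< k q n<k) (half< k′ q n<k′)
  ... | no _ = refl

  oddPartWithin-props : ∀ k n → 1 ≤ n → n < 2 ^ k → let w = oddPartWithin k n in
    2 ∤ w × w ≤ n × 1 ≤ w × (∀ {p} → OddPrime p → ∀ e → p ^ e ∣ n → p ^ e ∣ w)
  oddPartWithin-props zero n 1≤n n<1 = contradiction (≤-trans n<1 1≤n) (n≮n n)
  oddPartWithin-props (suc k) n 1≤n n<2^ with 2 ∣? n
  ... | no 2∤n = 2∤n , ≤-refl , 1≤n , λ _ _ p∣n → p∣n
  ... | yes (divides q refl) =
    let 2∤w , w≤q , 1≤w , p∣ = oddPartWithin-props k q (1≤half q 1≤n) (half< k q n<2^)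
    in 2∤w , ≤-trans w≤q (m≤m*n q 2) , 1≤w , λ {p} op e p∣n →
       p∣ op e (odd-cancel op e q (subst (p ^ e ∣_) (*-comm q 2) p∣n))
    where
    odd-cancel : ∀ {p} → OddPrime p → ∀ e q → p ^ e ∣ 2 * q → p ^ e ∣ q
    odd-cancel (pp , 2<p) e q = p^e∣m*n⇒p^e∣n pp 2 (λ p∣2 → <⇒≱ 2<p (∣⇒≤ p∣2)) e q

  module _ n (1≤n : 1 ≤ n) where
    private props = oddPartWithin-props n n 1≤n (n<2^n n)
    oddPart-odd : 2 ∤ oddPart n
    oddPart-odd = proj₁ props
    oddPart-≤ : oddPart n ≤ n
    oddPart-≤ = proj₁ (proj₂ props)
    oddPart-pos : 1 ≤ oddPart n
    oddPart-pos = proj₁ (proj₂ (proj₂ props))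
    ∣oddPart : ∀ {p} → OddPrime p → ∀ e → p ^ e ∣ n → p ^ e ∣ oddPart n
    ∣oddPart = proj₂ (proj₂ (proj₂ props))

  oddPart-even : ∀ n → 1 ≤ n → oddPart (n * 2) ≡ oddPart n
  oddPart-even n@(suc n-1) 1≤n = trans (step (suc (n-1 * 2)) n) (oddPartWithin-irr (suc (n-1 * 2)) n n 1≤n (<-≤-trans (n<2^n n) (^-monoʳ-≤ 2 (s≤s (m≤m*n n-1 2)))) (n<2^n n))
    where
    step : ∀ k q → oddPartWithin (suc k) (q * 2) ≡ oddPartWithin k q
    step k q with 2 ∣? q * 2
    ... | yes (divides r q2≡r2) = cong (oddPartWithin k) (sym (*-cancelʳ-≡ q r 2 q2≡r2))
    ... | no 2∤ = contradiction (n∣m*n q) 2∤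

  oddPart-oddId : ∀ n → 2 ∤ n → oddPart n ≡ n
  oddPart-oddId zero    _ = refl
  oddPart-oddId (suc n) 2∤n with 2 ∣? suc n
  ... | yes 2∣n = contradiction 2∣n 2∤n
  ... | no _ = refl

  -- Prime powers dividing consecutive odd numbers

  term : ℕ → ℕ → ℕ
  term m i = m + 2 * i

  term-suc : ∀ m i → term m (suc i) ≡ term (2 + m) i
  term-suc m i = begin
    m + 2 * suc i     ≡⟨ cong (m +_) (*-suc 2 i) ⟩
    m + (2 + 2 * i)   ≡⟨ +-assoc m 2 (2 * i) ⟨
    m + 2 + 2 * i     ≡⟨ cong (_+ 2 * i) (+-comm m 2) ⟩
    2 + m + 2 * i     ∎
    where open ≡-Reasoning

  -- If the first term is a multiple of `p ^ e`, the term at distance `2 * suc i` is one only when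
  -- `p ^ e` divides `suc i`, because `p` is odd. Otherwise the first term does not count, and the
  -- window starts at the next one.
  count≤ : ∀ {p} → OddPrime p → ∀ e l m →
           ∑ (λ i → 𝟙 (p ^ e ∣? term m i)) l ≤ ∑ (λ j → 𝟙 (p ^ e ∣? suc j)) l + 1
  count≤ op e zero m = z≤n
  count≤ {p} op@(pp , 2<p) e (suc l) m with p ^ e ∣? term m 0 in eq
  ... | yes d∣m = begin
    ∑ (λ i → 𝟙 (p ^ e ∣? term m i)) (suc l)              ≡⟨ ∑-shift (λ i → 𝟙 (p ^ e ∣? term m i)) l ⟩
    𝟙 (p ^ e ∣? term m 0) + ∑ (λ i → 𝟙 (p ^ e ∣? term m (suc i))) l
      ≤⟨ +-mono-≤ (𝟙≤1 (p ^ e ∣? term m 0)) (∑-mono l λ i _ → 𝟙-mono (p ^ e ∣? term m (suc i)) (p ^ e ∣? suc i) (later i)) ⟩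
    1 + ∑ (λ j → 𝟙 (p ^ e ∣? suc j)) l                   ≡⟨ +-comm 1 _ ⟩
    ∑ (λ j → 𝟙 (p ^ e ∣? suc j)) l + 1                   ≤⟨ +-monoˡ-≤ 1 (m≤m+n _ _) ⟩
    ∑ (λ j → 𝟙 (p ^ e ∣? suc j)) (suc l) + 1             ∎
    where
    open ≤-Reasoning
    later : ∀ i → p ^ e ∣ term m (suc i) → p ^ e ∣ suc i
    later i d∣ = p^e∣m*n⇒p^e∣n pp 2 (λ p∣2 → <⇒≱ 2<p (∣⇒≤ p∣2)) e (suc i) (∣m+n∣m⇒∣n d∣ (subst (_ ∣_) (+-identityʳ m) d∣m))
  ... | no d∤m = begin
    ∑ (λ i → 𝟙 (p ^ e ∣? term m i)) (suc l)              ≡⟨ ∑-shift (λ i → 𝟙 (p ^ e ∣? term m i)) l ⟩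
    𝟙 (p ^ e ∣? term m 0) + ∑ (λ i → 𝟙 (p ^ e ∣? term m (suc i))) l
      ≡⟨ cong₂ _+_ (𝟙-no (p ^ e ∣? term m 0) d∤m) (∑-cong l λ i _ → cong (λ t → 𝟙 (p ^ e ∣? t)) (term-suc m i)) ⟩
    ∑ (λ i → 𝟙 (p ^ e ∣? term (2 + m) i)) l              ≤⟨ count≤ op e l (2 + m) ⟩
    ∑ (λ j → 𝟙 (p ^ e ∣? suc j)) l + 1                   ≤⟨ +-monoˡ-≤ 1 (m≤m+n _ _) ⟩
    ∑ (λ j → 𝟙 (p ^ e ∣? suc j)) (suc l) + 1             ∎
    where open ≤-Reasoning

  -- The odd part of `l !`, odd parts being multiplicative; not to be confused with the double
  -- factorial `oddProduct`.
  oddFactorial : ℕ → ℕ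
  oddFactorial = ∏ (oddPart ∘ suc)

  -- The exponent of the largest power of p not exceeding N, if N < 2 ^ E.
  logₚ : ℕ → ℕ → ℕ → ℕ
  logₚ E N p = ∑ (λ e → 𝟙 (p ^ suc e ≤? N)) E

  ^-logₚ : ∀ E N p → Prime p → 1 ≤ N → logₚ E N p ≤ E × p ^ logₚ E N p ≤ N
  ^-logₚ zero N p pp 1≤N = z≤n , 1≤N
  ^-logₚ (suc E) N p pp 1≤N with ^-logₚ E N p pp 1≤N | p ^ suc E ≤? N
  ... | k≤E , p^k≤N | yes p^E≤N =
    ≤-trans (+-monoˡ-≤ 1 k≤E) (≤-reflexive (+-comm E 1)) ,
    ≤-trans (^-monoʳ-≤ p {{prime⇒nonZero pp}} (≤-trans (+-monoˡ-≤ 1 k≤E) (≤-reflexive (+-comm E 1)))) p^E≤N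
  ... | k≤E , p^k≤N | no _ =
    ≤-trans (≤-reflexive (+-identityʳ _)) (m≤n⇒m≤1+n k≤E) , subst (λ k → p ^ k ≤ N) (sym (+-identityʳ (logₚ E N p))) p^k≤N

  logₚ≤ : ∀ E N p e → Prime p → N < p ^ suc e → logₚ E N p ≤ e
  logₚ≤ zero N p e pp N<p^e = z≤n
  logₚ≤ (suc E) N p e pp N<p^e with p ^ suc E ≤? N
  ... | no _ = ≤-trans (≤-reflexive (+-identityʳ _)) (logₚ≤ E N p e pp N<p^e)
  ... | yes p^E≤N = ≤-trans (+-monoˡ-≤ 1 (bound E)) (≤-trans (≤-reflexive (+-comm E 1)) E<e)
    where
    bound : ∀ E → logₚ E N p ≤ E
    bound zero = z≤n
    bound (suc E) = ≤-trans (+-mono-≤ (bound E) (𝟙≤1 (p ^ suc E ≤? N))) (≤-reflexive (+-comm E 1))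
    E<e : E < e
    E<e = ≰⇒> λ e≤E → <⇒≱ N<p^e (≤-trans (^-monoʳ-≤ p {{prime⇒nonZero pp}} (s≤s e≤E)) p^E≤N)

  π′ : ℕ → ℕ
  π′ y = ∑ (𝟙 ∘ oddPrime?) (suc y)

  -- The exponential of Chebyshev's theta function, without the prime 2.
  θ : ℕ → ℕ
  θ = ∏ₚ (λ _ → 1)

  smallCount : ℕ → ℕ → ℕ
  smallCount z y = ∑ (λ q → 𝟙 (oddPrime? q ×-dec q ≤? z)) (suc y)

  smallCount≤π′y : ∀ z y → smallCount z y ≤ π′ y
  smallCount≤π′y z y = ∑-mono (suc y) λ q _ → 𝟙-mono (oddPrime? q ×-dec q ≤? z) (oddPrime? q) proj₁

  π′-mono : ∀ {x y} → x ≤ y → π′ x ≤ π′ y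
  π′-mono {x} x≤y = go (≤⇒≤′ x≤y)
    where
    go : ∀ {y} → x ≤′ y → π′ x ≤ π′ y
    go (≤′-reflexive refl) = ≤-refl
    go (≤′-step x≤y) = ≤-trans (go x≤y) (m≤m+n _ _)

  smallCount≤π′z : ∀ z y → smallCount z y ≤ π′ z
  smallCount≤π′z z y with ≤-total y z
  ... | inj₁ y≤z = ≤-trans (smallCount≤π′y z y) (π′-mono y≤z)
  ... | inj₂ z≤y = go (≤⇒≤′ z≤y)
    where
    go : ∀ {y} → z ≤′ y → smallCount z y ≤ π′ z
    go (≤′-reflexive refl) = smallCount≤π′y z z
    go {suc y} (≤′-step z≤y) = ≤-trans (≤-reflexive (trans (cong (smallCount z y +_) (𝟙-no (oddPrime? (suc y) ×-dec suc y ≤? z) λ (_ , y<z) → <⇒≱ y<z (≤′⇒≤ z≤y))) (+-identityʳ _))) (go z≤y)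

  ∏-^ : ∀ N f n → ∏ (λ i → N ^ f i) n ≡ N ^ ∑ f n
  ∏-^ N f zero = refl
  ∏-^ N f (suc n) = trans (cong (_* N ^ f n) (∏-^ N f n)) (sym (^-distribˡ-+-* N (∑ f n) (f n)))

  ∏ₚ-const : ∀ e y → ∏ₚ (λ _ → e) y ≡ θ y ^ e
  ∏ₚ-const zero y = ∏ₚ-0 y
  ∏ₚ-const (suc e) y = trans (∏ₚ-+ (λ _ → 1) (λ _ → e) y) (cong (θ y *_) (∏ₚ-const e y))

  -- A prime `q ≤ z` contributes at most `N`. A prime `q > z` satisfies `N < q ^ suc e`, so its
  -- exponent is at most `e`, and all of these together contribute at most `θ y ^ e`.
  ∏ₚ-log≤ : ∀ E N z e y → 1 ≤ N → N < suc z ^ suc e → ∏ₚ (logₚ E N) y ≤ N ^ smallCount z y * θ y ^ e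
  ∏ₚ-log≤ E N z e y 1≤N N<z^e = begin
    ∏ₚ (logₚ E N) y ≤⟨ ∏-mono (suc y) (λ q _ → factor q) ⟩
    ∏ (λ q → N ^ small q * primePower (λ _ → e) q) (suc y) ≡⟨ ∏-* _ _ (suc y) ⟩
    ∏ (λ q → N ^ small q) (suc y) * ∏ₚ (λ _ → e) y ≡⟨ cong₂ _*_ (∏-^ N small (suc y)) (∏ₚ-const e y) ⟩
    N ^ smallCount z y * θ y ^ e ∎
    where
    open ≤-Reasoning
    instance _ = >-nonZero 1≤N
    small : ℕ → ℕ
    small q = 𝟙 (oddPrime? q ×-dec q ≤? z)
    factor : ∀ q → primePower (logₚ E N) q ≤ N ^ small q * primePower (λ _ → e) q
    factor q with oddPrime? q | q ≤? z
    ... | no _ | yes _ = s≤s z≤n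
    ... | no _ | no _ = s≤s z≤n
    ... | yes (pp , _) | yes _ = ≤-trans (proj₂ (^-logₚ E N q pp 1≤N)) (≤-trans (≤-reflexive (sym (*-identityʳ N))) (m≤m*n (N * 1) (q ^ e) {{m^n≢0 q e {{prime⇒nonZero pp}}}}))
    ... | yes (pp , _) | no q≰z = ≤-trans (^-monoʳ-≤ q {{prime⇒nonZero pp}} (logₚ≤ E N q e pp (<-≤-trans N<z^e (^-monoˡ-≤ (suc e) (≰⇒> q≰z))))) (≤-reflexive (sym (+-identityʳ _)))

  ∏ₚν≤n : ∀ y E n → 1 ≤ n → n < 2 ^ E → 2 ∤ n → ∏ₚ (λ p → ν E p n) y ≤ n
  ∏ₚν≤n y E n 1≤n n<2^E 2∤n = begin
    ∏ₚ (λ p → ν E p n) y       ≤⟨ ∏-monoˡ _ (primePower-pos (λ p → ν E p n)) (s≤s (m≤m+n y n)) ⟩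
    ∏ₚ (λ p → ν E p n) (y + n) ≡⟨ n≡∏ₚν (y + n) E n 1≤n n<2^E 2∤n (λ p _ p∣n → ≤-trans (∣⇒≤ {{>-nonZero 1≤n}} p∣n) (m≤n+m n y)) ⟨
    n                          ∎
    where open ≤-Reasoning

  ∏-term≤ : ∀ l m N z e y → 2 ∤ m → 1 ≤ N → (∀ i → i < l → term m i ≤ N) →
    (∀ i → i < l → ∀ p → Prime p → p ∣ term m i → p ≤ y) → N < suc z ^ suc e →
    ∏ (term m) l ≤ oddFactorial l * (N ^ smallCount z y * θ y ^ e)
  ∏-term≤ l m N z e y 2∤m 1≤N t≤N smooth N<z^e = begin
    ∏ (term m) l
      ≡⟨ ∏-cong l (λ i i<l → n≡∏ₚν y E (term m i) (1≤t i) (≤-<-trans (t≤N i i<l) N<2^E) (odd i) (smooth i i<l)) ⟩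
    ∏ (λ i → ∏ₚ (λ p → ν E p (term m i)) y) l
      ≡⟨ ∏ₚ-∑ (λ i p → ν E p (term m i)) y l ⟩
    ∏ₚ (λ p → ∑ (λ i → ν E p (term m i)) l) y
      ≤⟨ ∏ₚ-mono y exponents ⟩
    ∏ₚ (λ p → ∑ (λ j → ν E p (oddPart (suc j))) l + logₚ E N p) y
      ≡⟨ ∏ₚ-+ (λ p → ∑ (λ j → ν E p (oddPart (suc j))) l) (logₚ E N) y ⟩
    ∏ₚ (λ p → ∑ (λ j → ν E p (oddPart (suc j))) l) y * ∏ₚ (logₚ E N) y
      ≡⟨ cong (_* ∏ₚ (logₚ E N) y) (∏ₚ-∑ (λ j p → ν E p (oddPart (suc j))) y l) ⟨
    ∏ (λ j → ∏ₚ (λ p → ν E p (oddPart (suc j))) y) l * ∏ₚ (logₚ E N) y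
      ≤⟨ *-mono-≤ (∏-mono l λ j j<l → ∏ₚν≤n y E (oddPart (suc j)) (oddPart-pos (suc j) (s≤s z≤n)) (≤-<-trans (≤-trans (oddPart-≤ (suc j) (s≤s z≤n)) j<l) l<2^E) (oddPart-odd (suc j) (s≤s z≤n)))
                  (∏ₚ-log≤ E N z e y 1≤N N<z^e) ⟩
    oddFactorial l * (N ^ smallCount z y * θ y ^ e) ∎
    where
    open ≤-Reasoning
    -- One bound on exponents serves both sides: `2 ^ E` exceeds every term and every number up to
    -- `l`.
    E = N + l
    N<2^E : N < 2 ^ E
    N<2^E = <-≤-trans (n<2^n N) (^-monoʳ-≤ 2 (m≤m+n N l))
    l<2^E : l < 2 ^ E
    l<2^E = <-≤-trans (n<2^n l) (^-monoʳ-≤ 2 (m≤n+m l N))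
    odd : ∀ i → 2 ∤ term m i
    odd i 2∣t = 2∤m (∣m+n∣m⇒∣n (subst (2 ∣_) (+-comm m (2 * i)) 2∣t) (m∣m*n i))
    1≤t : ∀ i → 1 ≤ term m i
    1≤t i = n≢0⇒n>0 λ t≡0 → odd i (subst (2 ∣_) (sym t≡0) (2 ∣0))
    -- The extra multiple allowed by `count≤` can occur only if `p ^ suc e ≤ N`, since larger powers
    -- divide no term. Summed over `e`, these extras give `logₚ E N p`.
    perPower : ∀ {p} → OddPrime p → ∀ e →
      ∑ (λ i → 𝟙 (p ^ suc e ∣? term m i)) l ≤ ∑ (λ j → 𝟙 (p ^ suc e ∣? oddPart (suc j))) l + 𝟙 (p ^ suc e ≤? N)
    perPower {p} op e with p ^ suc e ≤? N
    ... | yes _ = ≤-trans (count≤ op (suc e) l m) (+-monoˡ-≤ 1 (∑-mono l λ j _ → 𝟙-mono (p ^ suc e ∣? suc j) (p ^ suc e ∣? oddPart (suc j)) (∣oddPart (suc j) (s≤s z≤n) op (suc e))))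
    ... | no p≰N = ≤-trans (≤-reflexive (trans (∑-cong l λ i i<l → 𝟙-no (p ^ suc e ∣? term m i) λ p∣t → p≰N (≤-trans (∣⇒≤ {{>-nonZero (1≤t i)}} p∣t) (t≤N i i<l))) (∑-zero l))) z≤n
    exponents : ∀ p → OddPrime p → ∑ (λ i → ν E p (term m i)) l ≤ ∑ (λ j → ν E p (oddPart (suc j))) l + logₚ E N p
    exponents p op = begin
      ∑ (λ i → ν E p (term m i)) l ≡⟨ ∑-swap (λ i e → 𝟙 (p ^ suc e ∣? term m i)) l E ⟩
      ∑ (λ e → ∑ (λ i → 𝟙 (p ^ suc e ∣? term m i)) l) E ≤⟨ ∑-mono E (λ e _ → perPower op e) ⟩
      ∑ (λ e → ∑ (λ j → 𝟙 (p ^ suc e ∣? oddPart (suc j))) l + 𝟙 (p ^ suc e ≤? N)) E ≡⟨ ∑-+ _ _ E ⟩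
      ∑ (λ e → ∑ (λ j → 𝟙 (p ^ suc e ∣? oddPart (suc j))) l) E + logₚ E N p ≡⟨ cong (_+ logₚ E N p) (∑-swap (λ j e → 𝟙 (p ^ suc e ∣? oddPart (suc j))) l E) ⟨
      ∑ (λ j → ν E p (oddPart (suc j))) l + logₚ E N p ∎

  -- Chebyshev's bound for the product of the primes

  ∑-split : ∀ f m n → ∑ f (m + n) ≡ ∑ f m + ∑ (λ j → f (m + j)) n
  ∑-split f m zero    = trans (cong (∑ f) (+-identityʳ m)) (sym (+-identityʳ _))
  ∑-split f m (suc n) = trans (cong (∑ f) (+-suc m n)) (trans (cong (_+ f (m + n)) (∑-split f m n)) (+-assoc (∑ f m) _ _))

  ∏-split : ∀ f m n → ∏ f (m + n) ≡ ∏ f m * ∏ (λ j → f (m + j)) n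
  ∏-split f m zero    = trans (cong (∏ f) (+-identityʳ m)) (sym (*-identityʳ _))
  ∏-split f m (suc n) = trans (cong (∏ f) (+-suc m n)) (trans (cong (_* f (m + n)) (∏-split f m n)) (*-assoc (∏ f m) _ _))

  prime∣∏ : ∀ {p} → Prime p → ∀ f n → p ∣ ∏ f n → ∃[ i ] i < n × p ∣ f i
  prime∣∏ pp f zero    p∣1 = contradiction (∣1⇒≡1 p∣1) (>⇒≢ (1<p pp))
  prime∣∏ pp f (suc n) p∣ with euclidsLemma (∏ f n) (f n) pp p∣
  ... | inj₂ p∣fn = n , ≤-refl , p∣fn
  ... | inj₁ p∣∏ = let i , i<n , p∣fi = prime∣∏ pp f n p∣∏ in i , m<n⇒m<1+n i<n , p∣fi

  prime∣!⇒≤ : ∀ {p} → Prime p → ∀ n → p ∣ n ! → p ≤ n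
  prime∣!⇒≤ pp zero p∣1 = contradiction (∣1⇒≡1 p∣1) (>⇒≢ (1<p pp))
  prime∣!⇒≤ pp (suc n) p∣ with euclidsLemma (suc n) (n !) pp p∣
  ... | inj₁ p∣n = ∣⇒≤ p∣n
  ... | inj₂ p∣n! = m≤n⇒m≤1+n (prime∣!⇒≤ pp n p∣n!)

  prime∣! : ∀ {p} → Prime p → p ∣ p !
  prime∣! {zero}  pp = contradiction pp ¬prime[0]
  prime∣! {suc n} _  = m∣m*n (n !)

  -- The last prime divides `c` but not the product of the earlier ones, whose prime factors differ
  -- from it; by Euclid's lemma it divides the cofactor `k`.
  ∏-primes∣ : ∀ c a b → (∀ q → OddPrime q → a ≤ q → q < a + b → q ∣ c) → ∏ (λ j → primePower (λ _ → 1) (a + j)) b ∣ c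
  ∏-primes∣ c a zero    _ = 1∣ c
  ∏-primes∣ c a (suc b) q∣c with ∏-primes∣ c a b (λ q op a≤q q<a+b → q∣c q op a≤q (<-trans q<a+b (+-monoʳ-< a ≤-refl))) | oddPrime? (a + b)
  ... | R∣c | no _ = subst (_∣ c) (sym (*-identityʳ _)) R∣c
  ... | divides k refl | yes op@(pq , _) with euclidsLemma k (∏ (λ j → primePower (λ _ → 1) (a + j)) b) pq (q∣c (a + b) op (m≤m+n a b) (+-monoʳ-< a ≤-refl))
  ...   | inj₁ q∣k = subst₂ _∣_ (trans (cong (_* R) (sym (*-identityʳ (a + b)))) (*-comm _ R)) refl (*-monoˡ-∣ R q∣k)
    where R = ∏ (λ j → primePower (λ _ → 1) (a + j)) b
  ...   | inj₂ q∣R = let i , i<b , q∣i = prime∣∏ pq _ b q∣R in contradiction q∣i (distinct i i<b)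
    where
    distinct : ∀ i → i < b → a + b ∤ primePower (λ _ → 1) (a + i)
    distinct i i<b q∣ with oddPrime? (a + i)
    ... | yes (pi , _) = <⇒≢ (+-monoʳ-< a i<b) (sym (prime∣prime pq pi (subst (a + b ∣_) (*-identityʳ (a + i)) q∣)))
    ... | no _ = contradiction (∣1⇒≡1 q∣) (>⇒≢ (1<p pq))

  -- The binomial coefficient of `1 + 2 * n` over `n` is at most `4 ^ n`: passing to `suc n`
  -- multiplies it by `2 (3 + 2 n) / (2 + n)`, which is less than 4.
  central≤ : ∀ n → (1 + 2 * n) ! ≤ 4 ^ n * (n ! * (suc n) !)
  central≤ zero = ≤-refl
  central≤ (suc n) = begin
    (1 + 2 * suc n) !                          ≡⟨ cong (λ k → suc k !) (*-suc 2 n) ⟩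
    (3 + 2 * n) * ((2 + 2 * n) * (1 + 2 * n) !) ≤⟨ *-mono-≤ (n≤1+n (3 + 2 * n)) (*-monoʳ-≤ (2 + 2 * n) (central≤ n)) ⟩
    (4 + 2 * n) * ((2 + 2 * n) * (4 ^ n * (n ! * (suc n) !)))  ≡⟨ eq n (4 ^ n) (n !) (suc n !) ⟩
    4 ^ suc n * ((suc n) ! * (2 + n) !) ∎
    where
    open ≤-Reasoning
    eq : ∀ n a b c → (4 + 2 * n) * ((2 + 2 * n) * (a * (b * c))) ≡ 4 * a * ((1 + n) * b * ((2 + n) * c))
    eq = solve-∀

  halve : ∀ y → (∃[ n ] y ≡ 2 * n) ⊎ (∃[ n ] y ≡ 1 + 2 * n)
  halve zero = inj₁ (0 , refl)
  halve (suc y) with halve y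
  ... | inj₁ (n , refl) = inj₂ (n , refl)
  ... | inj₂ (n , refl) = inj₁ (suc n , sym (*-suc 2 n))

  -- Erdős's argument. For `y = 1 + 2 * k` the primes from `2 + k` to `y` divide the binomial
  -- coefficient `c` of `1 + 2 * k` over `k`, which is at most `4 ^ k`; the primes up to `1 + k` are
  -- left to the induction. An even `y` is no odd prime and can be lowered by one.
  θ≤4^ : ∀ y → θ y ≤ 4 ^ y
  θ≤4^ = <-rec (λ y → θ y ≤ 4 ^ y) step
    where
    open ≤-Reasoning
    evenFactor : ∀ n → primePower (λ _ → 1) (2 * n) ≡ 1
    evenFactor n with oddPrime? (2 * n)
    ... | no _ = refl
    ... | yes (pp , 2<p) = contradiction (prime∣prime prime[2] pp (m∣m*n n)) (<⇒≢ 2<p)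
    step : ∀ y → (∀ {x} → x < y → θ x ≤ 4 ^ x) → θ y ≤ 4 ^ y
    step y rec with halve y
    step .(2 * 0) rec | inj₁ (zero , refl) = ≤-refl
    step .(2 * suc n) rec | inj₁ (suc n , refl) = begin
      θ (2 * suc n)         ≡⟨ cong (θ (n + suc (n + 0)) *_) (evenFactor (suc n)) ⟩
      θ (n + suc (n + 0)) * 1 ≡⟨ *-identityʳ _ ⟩
      θ (n + suc (n + 0))   ≤⟨ rec ≤-refl ⟩
      4 ^ (n + suc (n + 0)) ≤⟨ ^-monoʳ-≤ 4 (n≤1+n (n + suc (n + 0))) ⟩
      4 ^ (2 * suc n)       ∎
    step .(1 + 2 * 0) rec | inj₂ (zero , refl) = s≤s z≤n
    step .(1 + 2 * suc n) rec | inj₂ (suc n , refl) = begin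
      θ (1 + 2 * k)                 ≡⟨ cong θ (eq k) ⟩
      θ (1 + k + k)                 ≡⟨ ∏-split _ (2 + k) k ⟩
      θ (1 + k) * R                 ≤⟨ *-mono-≤ (rec (s≤s k+1≤2k)) R≤4^k ⟩
      4 ^ (1 + k) * 4 ^ k           ≡⟨ ^-distribˡ-+-* 4 (1 + k) k ⟨
      4 ^ (1 + k + k)               ≡⟨ cong (4 ^_) (eq k) ⟨
      4 ^ (1 + 2 * k)               ∎
      where
      k = suc n
      eq : ∀ k → 1 + 2 * k ≡ 1 + k + k
      eq = solve-∀
      k+1≤2k : 1 + k ≤ 2 * k
      k+1≤2k = ≤-trans (≤-reflexive (+-comm 1 k)) (+-monoʳ-≤ k (s≤s z≤n))
      R = ∏ (λ j → primePower (λ _ → 1) (2 + k + j)) k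
      D∣ : k ! * (suc k) ! ∣ (1 + 2 * k) !
      D∣ = subst (_∣ (1 + 2 * k) !) (cong (λ x → x ! * (suc k) !) k≡) ([n∸k]!k!∣n! {1 + 2 * k} {suc k} (s≤s (m≤m+n k _)))
        where
        k≡ : 1 + 2 * k ∸ suc k ≡ k
        k≡ = trans (m+n∸m≡n k (k + 0)) (+-identityʳ k)
      c = quotient D∣
      c-eq : (1 + 2 * k) ! ≡ c * (k ! * (suc k) !)
      c-eq = m∣n⇒n≡quotient*m D∣
      instance _ = k !* suc k !≢0
      c≤ : c ≤ 4 ^ k
      c≤ = *-cancelʳ-≤ c (4 ^ k) (k ! * (suc k) !) (subst (_≤ 4 ^ k * (k ! * (suc k) !)) c-eq (central≤ k))
      c≢0 : NonZero c
      c≢0 = ≢-nonZero λ c≡0 → contradiction (trans c-eq (cong (_* (k ! * (suc k) !)) c≡0)) (≢-nonZero⁻¹ _ {{(1 + 2 * k) !≢0}})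
      q∣c : ∀ q → OddPrime q → 2 + k ≤ q → q < 2 + k + k → q ∣ c
      q∣c q (pq , _) k<q q≤ with euclidsLemma c (k ! * (suc k) !) pq (subst (q ∣_) c-eq (∣-trans (prime∣! pq) (m≤n⇒m!∣n! (subst (q ≤_) (sym (eq k)) (s≤s⁻¹ q≤)))))
      ... | inj₁ q∣c = q∣c
      ... | inj₂ q∣D with euclidsLemma (k !) (suc k !) pq q∣D
      ...   | inj₁ q∣k! = contradiction (prime∣!⇒≤ pq k q∣k!) (<⇒≱ (<-trans (n<1+n k) k<q))
      ...   | inj₂ q∣k! = contradiction (prime∣!⇒≤ pq (suc k) q∣k!) (<⇒≱ k<q)
      R≤4^k : R ≤ 4 ^ k
      R≤4^k = ≤-trans (∣⇒≤ {{c≢0}} (∏-primes∣ c (2 + k) k q∣c)) c≤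

  -- An upper bound for the number of primes

  coprime210? : ∀ q → Dec (2 ∤ q × 3 ∤ q × 5 ∤ q × 7 ∤ q)
  coprime210? q = ¬? (2 ∣? q) ×-dec ¬? (3 ∣? q) ×-dec ¬? (5 ∣? q) ×-dec ¬? (7 ∣? q)

  χ : ℕ → ℕ
  χ q = 𝟙 (coprime210? q)

  χ-periodic : ∀ q → χ (q + 210) ≡ χ q
  χ-periodic q = 𝟙-cong (coprime210? (q + 210)) (coprime210? q)
    (λ (a , b , c , d) → a ∘ up 2 (divides 105 refl) , b ∘ up 3 (divides 70 refl) , c ∘ up 5 (divides 42 refl) , d ∘ up 7 (divides 30 refl))
    (λ (a , b , c , d) → a ∘ down 2 (divides 105 refl) , b ∘ down 3 (divides 70 refl) , c ∘ down 5 (divides 42 refl) , d ∘ down 7 (divides 30 refl))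
    where
    up : ∀ d → d ∣ 210 → d ∣ q → d ∣ q + 210
    up d d∣210 d∣q = ∣m∣n⇒∣m+n d∣q d∣210
    down : ∀ d {M} → d ∣ M → d ∣ q + M → d ∣ q
    down d {M} d∣M d∣ = ∣m+n∣m⇒∣n (subst (d ∣_) (+-comm q M) d∣) d∣M

  -- Moving the window on by one drops the value at `a` and adds the equal value at `a + M`.
  ∑-window : ∀ f M → (∀ q → f (q + M) ≡ f q) → ∀ a → ∑ (λ j → f (a + j)) M ≡ ∑ f M
  ∑-window f M periodic zero = refl
  ∑-window f M periodic (suc a) = trans (+-cancelˡ-≡ (f (a + 0)) _ _ (begin
    f (a + 0) + ∑ (λ j → f (suc a + j)) M   ≡⟨ cong (f (a + 0) +_) (∑-cong M λ j _ → cong f (sym (+-suc a j))) ⟩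
    f (a + 0) + ∑ (λ j → f (a + suc j)) M   ≡⟨ ∑-shift (λ j → f (a + j)) M ⟨
    ∑ (λ j → f (a + j)) M + f (a + M)       ≡⟨ +-comm _ (f (a + M)) ⟩
    f (a + M) + ∑ (λ j → f (a + j)) M       ≡⟨ cong (_+ ∑ (λ j → f (a + j)) M) (trans (periodic a) (cong f (sym (+-identityʳ a)))) ⟩
    f (a + 0) + ∑ (λ j → f (a + j)) M       ∎)) (∑-window f M periodic a)
    where open ≡-Reasoning

  -- Primes above 210 are coprime to 210, and 48 residues modulo 210 are. The modulus 210 is the
  -- first primorial for which the density of such residues is below `1 / 4`; for 30 it is still
  -- `8 / 30`.
  π′-window : ∀ x → 210 ≤ x → π′ (x + 210) ≤ π′ x + 48
  π′-window x 210≤x = begin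
    π′ (x + 210)                                            ≡⟨ ∑-split (𝟙 ∘ oddPrime?) (suc x) 210 ⟩
    π′ x + ∑ (λ j → 𝟙 (oddPrime? (suc x + j))) 210          ≤⟨ +-monoʳ-≤ (π′ x) (∑-mono 210 λ j _ → 𝟙-mono (oddPrime? (suc x + j)) (coprime210? (suc x + j)) (coprime j)) ⟩
    π′ x + ∑ (λ j → χ (suc x + j)) 210                      ≡⟨ cong (π′ x +_) (∑-window χ 210 χ-periodic (suc x)) ⟩
    π′ x + ∑ χ 210                                          ≡⟨⟩
    π′ x + 48                                               ∎
    where
    open ≤-Reasoning
    coprime : ∀ j → OddPrime (suc x + j) → 2 ∤ suc x + j × 3 ∤ suc x + j × 5 ∤ suc x + j × 7 ∤ suc x + j
    coprime j (pq , _) = not 2 (s≤s (s≤s z≤n)) (m≤m+n 2 208) , not 3 (s≤s (s≤s z≤n)) (m≤m+n 3 207) , not 5 (s≤s (s≤s z≤n)) (m≤m+n 5 205) , not 7 (s≤s (s≤s z≤n)) (m≤m+n 7 203)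
      where
      not : ∀ d → 2 ≤ d → d ≤ 210 → d ∤ suc x + j
      not d 2≤d d≤210 d∣q with prime⇒irreducible pq d∣q
      ... | inj₁ refl = contradiction 2≤d λ { (s≤s ()) }
      ... | inj₂ refl = <⇒≱ (s≤s (≤-trans 210≤x (m≤m+n x j))) d≤210

  -- Trial division by a fixed list of primes never rejects a prime.
  passes : List ℕ → ℕ → Bool
  passes []           q = true
  passes (zero  ∷ ds) q = passes ds q
  passes (suc d ∷ ds) q = if q % suc d ≡ᵇ 0 then q ≡ᵇ suc d else passes ds q

  -- With the primes up to 67 the test is exact below `71 * 71`. Beyond that some composite numbers
  -- pass, which is harmless because only an upper bound for the number of primes is wanted.
  trialPrimes : List ℕ
  trialPrimes = 2 ∷ 3 ∷ 5 ∷ 7 ∷ 11 ∷ 13 ∷ 17 ∷ 19 ∷ 23 ∷ 29 ∷ 31 ∷ 37 ∷ 41 ∷ 43 ∷ 47 ∷ 53 ∷ 59 ∷ 61 ∷ 67 ∷ []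

  sieve : ℕ → ℕ
  sieve q = if 2 <ᵇ q then (if passes trialPrimes q then 1 else 0) else 0

  T⇒≡ : ∀ {b} → T b → b ≡ true
  T⇒≡ = Equivalence.to T-≡

  ≡⇒T : ∀ {b} → b ≡ true → T b
  ≡⇒T = Equivalence.from T-≡

  prime-passes : ∀ {q} → Prime q → ∀ ds → All (1 <_) ds → passes ds q ≡ true
  prime-passes pq [] _ = refl
  prime-passes {q} pq (suc d ∷ ds) (1<d ∷ 1<ds) with q % suc d ≡ᵇ 0 in eq
  ... | false = prime-passes pq ds 1<ds
  ... | true with prime⇒irreducible pq (m%n≡0⇒n∣m q (suc d) (≡ᵇ⇒≡ _ 0 (≡⇒T eq)))
  ...   | inj₁ d≡1 = contradiction d≡1 (>⇒≢ 1<d)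
  ...   | inj₂ d≡q = T⇒≡ (≡⇒≡ᵇ q (suc d) (sym d≡q))

  trialPrimes>1 : All (1 <_) trialPrimes
  trialPrimes>1 = toWitness {a? = All.all? (1 <?_) trialPrimes} tt

  oddPrime≤sieve : ∀ q → 𝟙 (oddPrime? q) ≤ sieve q
  oddPrime≤sieve q with oddPrime? q
  ... | no _ = z≤n
  ... | yes (pq , 2<q) rewrite T⇒≡ (<⇒<ᵇ 2<q) | prime-passes pq trialPrimes (trialPrimes>1) = ≤-refl

  sieveCount : ℕ → ℕ
  sieveCount y = ∑ sieve (suc y)

  π′≤sieveCount : ∀ y → π′ y ≤ sieveCount y
  π′≤sieveCount y = ∑-mono (suc y) λ q _ → oddPrime≤sieve q

  private
    densityCheck : ℕ → ℕ → ℕ → Bool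
    densityCheck zero    x c = true
    densityCheck (suc k) x c = (4 * c ≤ᵇ x + 9) ∧ densityCheck k (suc x) (c + sieve (suc x))

    T-∧⁻ : ∀ {a b} → T (a ∧ b) → T a × T b
    T-∧⁻ {a} {b} = Equivalence.to (T-∧ {a} {b})

    densityCheck-sound : ∀ k x → T (densityCheck k x (sieveCount x)) → ∀ i → i < k → 4 * sieveCount (x + i) ≤ x + i + 9
    densityCheck-sound (suc k) x ok zero _ = subst (λ y → 4 * sieveCount y ≤ y + 9) (sym (+-identityʳ x)) (≤ᵇ⇒≤ _ _ (proj₁ (T-∧⁻ ok)))
    densityCheck-sound (suc k) x ok (suc i) (s≤s i<k) = subst (λ y → 4 * sieveCount y ≤ y + 9) (sym (+-suc x i)) (densityCheck-sound k (suc x) (proj₂ (T-∧⁻ {4 * sieveCount x ≤ᵇ x + 9} ok)) i i<k)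

  -- The constant 9 is attained, for instance at `x = 19`, which has the seven odd primes 3, 5, 7,
  -- 11, 13, 17, 19 below or at it.
  4π′≤ : ∀ x → 4 * π′ x ≤ x + 9
  4π′≤ = <-rec (λ x → 4 * π′ x ≤ x + 9) step
    where
    open ≤-Reasoning
    step : ∀ x → (∀ {y} → y < x → 4 * π′ y ≤ y + 9) → 4 * π′ x ≤ x + 9
    -- `π′-window` has to be applied at `x ∸ 210`, which must itself be at least 210; hence the
    -- direct check up to 420. Each later window costs `4 * 48 = 192`, less than 210.
    step x rec with x <? 420
    ... | yes x<420 = ≤-trans (*-monoʳ-≤ 4 (π′≤sieveCount x)) (densityCheck-sound 420 0 tt x x<420)
    ... | no x≮420 = begin
      4 * π′ x                ≡⟨ cong (λ x → 4 * π′ x) (m∸n+n≡m 210≤x) ⟨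
      4 * π′ (y + 210)        ≤⟨ *-monoʳ-≤ 4 (π′-window y 210≤y) ⟩
      4 * (π′ y + 48)         ≡⟨ *-distribˡ-+ 4 (π′ y) 48 ⟩
      4 * π′ y + 192          ≤⟨ +-mono-≤ (rec y<x) (m≤m+n 192 18) ⟩
      y + 9 + 210             ≡⟨ trans (+-assoc y 9 210) (trans (cong (y +_) (+-comm 9 210)) (sym (+-assoc y 210 9))) ⟩
      y + 210 + 9             ≡⟨ cong (_+ 9) (m∸n+n≡m 210≤x) ⟩
      x + 9                   ∎
      where
      420≤x : 420 ≤ x
      420≤x = ≮⇒≥ x≮420
      210≤x : 210 ≤ x
      210≤x = ≤-trans (m≤m+n 210 210) 420≤x
      y = x ∸ 210
      210≤y : 210 ≤ y
      210≤y = ∸-monoˡ-≤ 210 420≤x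
      y<x : y < x
      y<x = ∸-monoʳ-< {x} {210} {0} (s≤s z≤n) 210≤x

  -- Lower bounds for products of consecutive odd numbers

  ∏-shift : ∀ f n → ∏ f (suc n) ≡ f 0 * ∏ (f ∘ suc) n
  ∏-shift f zero    = *-comm 1 (f 0)
  ∏-shift f (suc n) = trans (cong (_* f (suc n)) (∏-shift f n)) (*-assoc (f 0) _ _)

  -- The product of the terms for the least admissible first term `1 + 2 * l`, running up to
  -- `4 * l - 1`.
  minimalProduct : ℕ → ℕ
  minimalProduct l = ∏ (term (1 + 2 * l)) l

  -- Passing from `l` to `suc l` removes the factor `1 + 2 * l` and adds the factors `1 + 4 * l` and
  -- `3 + 4 * l`.
  minimalProduct-suc : ∀ l → minimalProduct (suc l) * (1 + 2 * l) ≡ minimalProduct l * ((1 + 4 * l) * (3 + 4 * l))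
  minimalProduct-suc l = begin
    minimalProduct (suc l) * (1 + 2 * l)               ≡⟨ *-comm (minimalProduct (suc l)) _ ⟩
    (1 + 2 * l) * minimalProduct (suc l)               ≡⟨ cong₂ _*_ (sym (+-identityʳ (1 + 2 * l))) (∏-cong (suc l) λ i _ → trans (cong (λ k → suc k + 2 * i) (*-suc 2 l)) (sym (term-suc (1 + 2 * l) i))) ⟩
    term (1 + 2 * l) 0 * ∏ (term (1 + 2 * l) ∘ suc) (suc l) ≡⟨ ∏-shift (term (1 + 2 * l)) (suc l) ⟨
    minimalProduct l * (1 + 2 * l + 2 * l) * (1 + 2 * l + 2 * suc l) ≡⟨ *-assoc (minimalProduct l) _ _ ⟩
    minimalProduct l * ((1 + 2 * l + 2 * l) * (1 + 2 * l + 2 * suc l)) ≡⟨ cong (minimalProduct l *_) (eq l) ⟩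
    minimalProduct l * ((1 + 4 * l) * (3 + 4 * l)) ∎
    where
    open ≡-Reasoning
    eq : ∀ l → (1 + 2 * l + 2 * l) * (1 + 2 * l + 2 * (1 + l)) ≡ (1 + 4 * l) * (3 + 4 * l)
    eq = solve-∀

  -- Since `minimalProduct l` is the central binomial coefficient of `4 l` over `2 l` times
  -- `l! / 2 ^ l`, this is the bound `4 ^ m / (2 m)` for the central binomial coefficient of `2 m`
  -- over `m`, at `m = 2 l`.
  8^l*l!≤ : ∀ l → 1 ≤ l → 8 ^ l * l ! ≤ 4 * l * minimalProduct l
  8^l*l!≤ 1 _ = m≤m+n 8 4
  8^l*l!≤ (suc l@(suc _)) _ = *-cancelʳ-≤ _ _ (1 + 2 * l) (begin
    8 * 8 ^ l * (suc l * l !) * (1 + 2 * l)    ≡⟨ eq₁ (8 ^ l) (l !) l ⟩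
    8 * (1 + l) * (1 + 2 * l) * (8 ^ l * l !)  ≤⟨ *-monoʳ-≤ (8 * (1 + l) * (1 + 2 * l)) (8^l*l!≤ l (s≤s z≤n)) ⟩
    8 * (1 + l) * (1 + 2 * l) * (4 * l * minimalProduct l) ≡⟨ eq₂ l (minimalProduct l) ⟩
    4 * (1 + l) * (minimalProduct l * (16 * (l * l) + 8 * l)) ≤⟨ *-monoʳ-≤ (4 * (1 + l)) (*-monoʳ-≤ (minimalProduct l) (≤-trans (m≤m+n _ (8 * l + 3)) (≤-reflexive (eq₃ l)))) ⟩
    4 * (1 + l) * (minimalProduct l * ((1 + 4 * l) * (3 + 4 * l))) ≡⟨ cong (4 * (1 + l) *_) (minimalProduct-suc l) ⟨
    4 * (1 + l) * (minimalProduct (suc l) * (1 + 2 * l))   ≡⟨ *-assoc (4 * (1 + l)) (minimalProduct (suc l)) (1 + 2 * l) ⟨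
    4 * suc l * minimalProduct (suc l) * (1 + 2 * l)       ∎)
    where
    open ≤-Reasoning
    eq₁ : ∀ a b l → 8 * a * ((1 + l) * b) * (1 + 2 * l) ≡ 8 * (1 + l) * (1 + 2 * l) * (a * b)
    eq₁ = solve-∀
    eq₂ : ∀ l p → 8 * (1 + l) * (1 + 2 * l) * (4 * l * p) ≡ 4 * (1 + l) * (p * (16 * (l * l) + 8 * l))
    eq₂ = solve-∀
    eq₃ : ∀ l → 16 * (l * l) + 8 * l + (8 * l + 3) ≡ (1 + 4 * l) * (3 + 4 * l)
    eq₃ = solve-∀

  -- The double factorial of `2 k - 1`, which `u≡oddProduct` identifies with `u (2 * k)`.
  oddProduct : ℕ → ℕ
  oddProduct = ∏ (λ j → 1 + 2 * j)

  2∤1+2* : ∀ j → 2 ∤ 1 + 2 * j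
  2∤1+2* j 2∣ = contradiction (∣1⇒≡1 (∣m+n∣m⇒∣n (subst (2 ∣_) (+-comm 1 (2 * j)) 2∣) (m∣m*n j))) λ ()

  oddFactorial-double : ∀ k → oddFactorial (2 * k) ≡ oddProduct k * oddFactorial k
  oddFactorial-double zero    = refl
  oddFactorial-double (suc k) = begin
    oddFactorial (2 * suc k)                                                     ≡⟨ cong oddFactorial (*-suc 2 k) ⟩
    oddFactorial (2 * k) * oddPart (1 + 2 * k) * oddPart (2 + 2 * k)             ≡⟨ cong₂ _*_ (cong₂ _*_ (oddFactorial-double k) (oddPart-oddId (1 + 2 * k) (2∤1+2* k))) (trans (cong oddPart (eq k)) (oddPart-even (suc k) (s≤s z≤n))) ⟩
    oddProduct k * oddFactorial k * (1 + 2 * k) * oddPart (suc k)                ≡⟨ eq′ (oddProduct k) (oddFactorial k) (1 + 2 * k) (oddPart (suc k)) ⟩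
    oddProduct (suc k) * oddFactorial (suc k)                                    ∎
    where
    open ≡-Reasoning
    eq : ∀ k → 2 + 2 * k ≡ (1 + k) * 2
    eq = solve-∀
    eq′ : ∀ a b c d → a * b * c * d ≡ a * c * (b * d)
    eq′ = solve-∀

  !-double : ∀ k → (2 * k) ! ≡ oddProduct k * (2 ^ k * k !)
  !-double zero    = refl
  !-double (suc k) = begin
    (2 * suc k) !                                          ≡⟨ cong _! (*-suc 2 k) ⟩
    (2 + 2 * k) * ((1 + 2 * k) * (2 * k) !)                ≡⟨ cong (λ x → (2 + 2 * k) * ((1 + 2 * k) * x)) (!-double k) ⟩
    (2 + 2 * k) * ((1 + 2 * k) * (oddProduct k * (2 ^ k * k !))) ≡⟨ eq k (oddProduct k) (2 ^ k) (k !) ⟩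
    oddProduct (suc k) * (2 ^ suc k * (suc k) !) ∎
    where
    open ≡-Reasoning
    eq : ∀ k a b c → (2 + 2 * k) * ((1 + 2 * k) * (a * (b * c))) ≡ a * (1 + 2 * k) * (2 * b * ((1 + k) * c))
    eq = solve-∀

  -- Equivalently, 2 occurs in `l !` with exponent at least `l - log₂ (l + 1)`. The even numbers up
  -- to `2 * k` are the doubles of `1, ..., k`, so the bound for `k` yields those for `2 * k` and
  -- `1 + 2 * k`.
  2^l*oddFactorial≤ : ∀ l → 2 ^ l * oddFactorial l ≤ (1 + l) * l !
  2^l*oddFactorial≤ = <-rec (λ l → 2 ^ l * oddFactorial l ≤ (1 + l) * l !) step
    where
    open ≤-Reasoning
    even : ∀ k → 2 ^ k * oddFactorial k ≤ (1 + k) * k ! → 2 ^ (2 * k) * oddFactorial (2 * k) ≤ (1 + k) * (2 * k) !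
    even k h = begin
      2 ^ (2 * k) * oddFactorial (2 * k)                   ≡⟨ cong₂ _*_ (trans (cong (λ x → 2 ^ (k + x)) (+-identityʳ k)) (^-distribˡ-+-* 2 k k)) (oddFactorial-double k) ⟩
      2 ^ k * 2 ^ k * (oddProduct k * oddFactorial k)      ≡⟨ eq₁ (2 ^ k) (oddProduct k) (oddFactorial k) ⟩
      oddProduct k * 2 ^ k * (2 ^ k * oddFactorial k)      ≤⟨ *-monoʳ-≤ (oddProduct k * 2 ^ k) h ⟩
      oddProduct k * 2 ^ k * ((1 + k) * k !)    ≡⟨ eq₂ (oddProduct k) (2 ^ k) (1 + k) (k !) ⟩
      (1 + k) * (oddProduct k * (2 ^ k * k !))  ≡⟨ cong ((1 + k) *_) (!-double k) ⟨
      (1 + k) * (2 * k) !                       ∎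
      where
      eq₁ : ∀ a b c → a * a * (b * c) ≡ b * a * (a * c)
      eq₁ = solve-∀
      eq₂ : ∀ a b c d → a * b * (c * d) ≡ c * (a * (b * d))
      eq₂ = solve-∀
    step : ∀ l → (∀ {k} → k < l → 2 ^ k * oddFactorial k ≤ (1 + k) * k !) → 2 ^ l * oddFactorial l ≤ (1 + l) * l !
    step l rec with halve l
    step .(2 * 0) rec | inj₁ (zero , refl) = ≤-refl
    step .(2 * suc k) rec | inj₁ (suc k , refl) =
      ≤-trans (even (suc k) (rec (m<m*n′ k))) (*-monoˡ-≤ ((2 * suc k) !) (s≤s (m≤m+n (suc k) _)))
      where
      m<m*n′ : ∀ k → suc k < 2 * suc k
      m<m*n′ k = m<m+n (suc k) (s≤s z≤n)
    step .(1 + 2 * k) rec | inj₂ (k , refl) = begin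
      2 * 2 ^ (2 * k) * (oddFactorial (2 * k) * oddPart (1 + 2 * k)) ≡⟨ cong (λ x → 2 * 2 ^ (2 * k) * (oddFactorial (2 * k) * x)) (oddPart-oddId (1 + 2 * k) (2∤1+2* k)) ⟩
      2 * 2 ^ (2 * k) * (oddFactorial (2 * k) * (1 + 2 * k))         ≡⟨ eq₁ (2 ^ (2 * k)) (oddFactorial (2 * k)) k ⟩
      2 * (1 + 2 * k) * (2 ^ (2 * k) * oddFactorial (2 * k))         ≤⟨ *-monoʳ-≤ (2 * (1 + 2 * k)) (even k (rec (s≤s (m≤m+n k _)))) ⟩
      2 * (1 + 2 * k) * ((1 + k) * (2 * k) !)             ≡⟨ eq₂ k ((2 * k) !) ⟩
      (2 + 2 * k) * ((1 + 2 * k) * (2 * k) !)             ∎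
      where
      eq₁ : ∀ a b k → 2 * a * (b * (1 + 2 * k)) ≡ 2 * (1 + 2 * k) * (a * b)
      eq₁ = solve-∀
      eq₂ : ∀ k x → 2 * (1 + 2 * k) * ((1 + k) * x) ≡ (2 + 2 * k) * ((1 + 2 * k) * x)
      eq₂ = solve-∀

  ^-distrib-* : ∀ a b n → (a * b) ^ n ≡ a ^ n * b ^ n
  ^-distrib-* a b zero = refl
  ^-distrib-* a b (suc n) = trans (cong (a * b *_) (^-distrib-* a b n)) ([m*n]*[o*p]≡[m*o]*[n*p] a b (a ^ n) (b ^ n))

  -- The main term of the lower bound: relative to the odd part of `l !`, the least product of terms
  -- has size `16 ^ l` up to a quadratic factor.
  16^l*oddFactorial≤ : ∀ l → 1 ≤ l → 16 ^ l * oddFactorial l ≤ 4 * l * (1 + l) * minimalProduct l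
  16^l*oddFactorial≤ l 1≤l = begin
    16 ^ l * oddFactorial l                      ≡⟨ cong (_* oddFactorial l) (^-distrib-* 8 2 l) ⟩
    8 ^ l * 2 ^ l * oddFactorial l               ≡⟨ *-assoc (8 ^ l) (2 ^ l) (oddFactorial l) ⟩
    8 ^ l * (2 ^ l * oddFactorial l)             ≤⟨ *-monoʳ-≤ (8 ^ l) (2^l*oddFactorial≤ l) ⟩
    8 ^ l * ((1 + l) * l !)           ≡⟨ eq₁ (8 ^ l) (1 + l) (l !) ⟩
    (1 + l) * (8 ^ l * l !)           ≤⟨ *-monoʳ-≤ (1 + l) (8^l*l!≤ l 1≤l) ⟩
    (1 + l) * (4 * l * minimalProduct l)          ≡⟨ eq₂ l (minimalProduct l) ⟩
    4 * l * (1 + l) * minimalProduct l            ∎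
    where
    open ≤-Reasoning
    eq₁ : ∀ a b c → a * (b * c) ≡ b * (a * c)
    eq₁ = solve-∀
    eq₂ : ∀ l p → (1 + l) * (4 * l * p) ≡ 4 * l * (1 + l) * p
    eq₂ = solve-∀

  oddFactorial-pos : ∀ l → 1 ≤ oddFactorial l
  oddFactorial-pos l = ∏-pos _ l λ i _ → oddPart-pos (suc i) (s≤s z≤n)

  -- The ratio of the i-th terms is at least that of the last ones.
  ∏-term-scale : ∀ m₀ m l → m₀ ≤ m → ∏ (term m₀) (suc l) * term m l ^ suc l ≤ ∏ (term m) (suc l) * term m₀ l ^ suc l
  ∏-term-scale m₀ m l m₀≤m = begin
    ∏ (term m₀) (suc l) * term m l ^ suc l           ≡⟨ cong (∏ (term m₀) (suc l) *_) (∏-const (term m l) (suc l)) ⟨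
    ∏ (term m₀) (suc l) * ∏ (λ _ → term m l) (suc l) ≡⟨ ∏-* _ _ (suc l) ⟨
    ∏ (λ i → term m₀ i * term m l) (suc l)           ≤⟨ ∏-mono (suc l) (λ i i<l → ratio i (s≤s⁻¹ i<l)) ⟩
    ∏ (λ i → term m i * term m₀ l) (suc l)           ≡⟨ ∏-* _ _ (suc l) ⟩
    ∏ (term m) (suc l) * ∏ (λ _ → term m₀ l) (suc l) ≡⟨ cong (∏ (term m) (suc l) *_) (∏-const (term m₀ l) (suc l)) ⟩
    ∏ (term m) (suc l) * term m₀ l ^ suc l           ∎
    where
    open ≤-Reasoning
    ratio : ∀ i → i ≤ l → term m₀ i * term m l ≤ term m i * term m₀ l
    ratio i i≤l = begin
      term m₀ i * term m l                   ≡⟨ cong (λ m → term m₀ i * term m l) (m∸n+n≡m m₀≤m) ⟨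
      term m₀ i * term (δ + m₀) l            ≡⟨ eq₁ (term m₀ i) δ m₀ (2 * l) ⟩
      term m₀ i * term m₀ l + term m₀ i * δ  ≤⟨ +-monoʳ-≤ _ (*-monoˡ-≤ δ (+-monoʳ-≤ m₀ (*-monoʳ-≤ 2 i≤l))) ⟩
      term m₀ i * term m₀ l + term m₀ l * δ  ≡⟨ eq₂ (term m₀ l) δ m₀ (2 * i) ⟩
      term (δ + m₀) i * term m₀ l            ≡⟨ cong (λ m → term m i * term m₀ l) (m∸n+n≡m m₀≤m) ⟩
      term m i * term m₀ l                   ∎
      where
      δ = m ∸ m₀
      eq₁ : ∀ t δ m₀ a → t * (δ + m₀ + a) ≡ t * (m₀ + a) + t * δ
      eq₁ = solve-∀
      eq₂ : ∀ N₀ δ m₀ a → (m₀ + a) * N₀ + N₀ * δ ≡ (δ + m₀ + a) * N₀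
      eq₂ = solve-∀

  ∏-term-mono : ∀ m₀ m l → m₀ ≤ m → ∏ (term m₀) l ≤ ∏ (term m) l
  ∏-term-mono m₀ m l m₀≤m = ∏-mono l λ i _ → +-monoˡ-≤ (2 * i) m₀≤m

  module Bounds (l′ m X : ℕ) (m≥ : 1 + 2 * suc l′ ≤ m) (P≤ : ∏ (term m) (suc l′) ≤ oddFactorial (suc l′) * X) where
    private
      l = suc l′
      N = term m l′
      instance _ = >-nonZero (oddFactorial-pos l)

    16^l≤ : 16 ^ l ≤ 4 * l * (1 + l) * X
    16^l≤ = *-cancelʳ-≤ _ _ (oddFactorial l) (begin
      16 ^ l * oddFactorial l                    ≤⟨ 16^l*oddFactorial≤ l (s≤s z≤n) ⟩
      4 * l * (1 + l) * minimalProduct l          ≤⟨ *-monoʳ-≤ (4 * l * (1 + l)) (≤-trans (∏-term-mono _ m l m≥) P≤) ⟩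
      4 * l * (1 + l) * (oddFactorial l * X)     ≡⟨ eq (4 * l * (1 + l)) (oddFactorial l) X ⟩
      4 * l * (1 + l) * X * oddFactorial l       ∎)
      where
      open ≤-Reasoning
      eq : ∀ a b c → a * (b * c) ≡ a * c * b
      eq = solve-∀

    -- By `∏-term-scale` the product of the terms is at least `minimalProduct l` times the `l`-th
    -- power of `N / (4 * l)`; the last term `4 * l - 1` of the extreme case is rounded up to
    -- `4 * l`.
    [4N]^l≤ : (4 * N) ^ l ≤ 4 * l * (1 + l) * X * l ^ l
    [4N]^l≤ = *-cancelʳ-≤ _ _ (4 ^ l * oddFactorial l) {{m*n≢0 (4 ^ l) (oddFactorial l) {{m^n≢0 4 l}}}} (begin
      (4 * N) ^ l * (4 ^ l * oddFactorial l)                ≡⟨ cong (_* (4 ^ l * oddFactorial l)) (^-distrib-* 4 N l) ⟩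
      4 ^ l * N ^ l * (4 ^ l * oddFactorial l)              ≡⟨ eq₁ (4 ^ l) (N ^ l) (oddFactorial l) ⟩
      4 ^ l * 4 ^ l * oddFactorial l * N ^ l                ≡⟨ cong (λ x → x * oddFactorial l * N ^ l) (^-distrib-* 4 4 l) ⟨
      16 ^ l * oddFactorial l * N ^ l                       ≤⟨ *-monoˡ-≤ (N ^ l) (16^l*oddFactorial≤ l (s≤s z≤n)) ⟩
      c * minimalProduct l * N ^ l                           ≡⟨ *-assoc c (minimalProduct l) (N ^ l) ⟩
      c * (minimalProduct l * N ^ l)                         ≤⟨ *-monoʳ-≤ c (∏-term-scale (1 + 2 * l) m l′ m≥) ⟩
      c * (∏ (term m) l * term (1 + 2 * l) l′ ^ l) ≤⟨ *-monoʳ-≤ c (*-mono-≤ P≤ (^-monoˡ-≤ l N₀≤4l)) ⟩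
      c * (oddFactorial l * X * (4 * l) ^ l)                ≡⟨ cong (λ x → c * (oddFactorial l * X * x)) (^-distrib-* 4 l l) ⟩
      c * (oddFactorial l * X * (4 ^ l * l ^ l))            ≡⟨ eq₂ c (oddFactorial l) X (4 ^ l) (l ^ l) ⟩
      c * X * l ^ l * (4 ^ l * oddFactorial l)              ∎)
      where
      open ≤-Reasoning
      c = 4 * l * (1 + l)
      N₀≤4l : term (1 + 2 * l) l′ ≤ 4 * l
      N₀≤4l = ≤-trans (n≤1+n _) (≤-reflexive (eq l′))
        where
        eq : ∀ l′ → 1 + (1 + 2 * (1 + l′) + 2 * l′) ≡ 4 * (1 + l′)
        eq = solve-∀
      eq₁ : ∀ a n o → a * n * (a * o) ≡ a * a * o * n
      eq₁ = solve-∀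
      eq₂ : ∀ c o x a b → c * (o * x * (a * b)) ≡ c * x * b * (a * o)
      eq₂ = solve-∀

  -- The odd Sylvester theorem for large l

  root : ∀ e N → ∃[ z ] z ^ suc e ≤ N × N < suc z ^ suc e
  root e zero = 0 , z≤n , m^n>0 1 (suc e)
  root e (suc N) with root e N
  ... | z , z^≤N , N< with suc N <? suc z ^ suc e
  ...   | yes 1+N< = z , m≤n⇒m≤1+n z^≤N , 1+N<
  ...   | no 1+N≮ = suc z , ≮⇒≥ 1+N≮ , ≤-<-trans N< (^-monoˡ-< (suc e) ≤-refl)

  -- Preserves `(3 + λ′) ^ 3 ≤ l` when `l` reaches `2 ^ λ′` and its binary length grows by one. The
  -- threshold 4096 in `logBound` is both `2 ^ 12` and `(3 + 13) ^ 3`, so the invariant starts with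
  -- equality.
  cube≤2^ : ∀ {λ′} → 13 ≤′ λ′ → (4 + λ′) ^ 3 ≤ 2 ^ λ′
  cube≤2^ (≤′-reflexive refl) = ≤ᵇ⇒≤ (17 ^ 3) (2 ^ 13) _
  cube≤2^ {suc n} (≤′-step 13≤n) = begin
    (5 + n) ^ 3                              ≤⟨ cube-step n (≤-trans (m≤m+n 5 8) (≤′⇒≤ 13≤n)) ⟩
    2 * (4 + n) ^ 3                          ≤⟨ *-monoʳ-≤ 2 (cube≤2^ 13≤n) ⟩
    2 * 2 ^ n                                ∎
    where
    open ≤-Reasoning
    cube-step : ∀ n → 5 ≤ n → (5 + n) ^ 3 ≤ 2 * (4 + n) ^ 3
    cube-step n 5≤n = subst (λ n → (5 + n) ^ 3 ≤ 2 * (4 + n) ^ 3) (m∸n+n≡m 5≤n) (≤-trans (m≤m+n _ _) (≤-reflexive (eq (n ∸ 5))))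
      where
      eq : ∀ j → (5 + (j + 5)) * ((5 + (j + 5)) * ((5 + (j + 5)) * 1)) + (j * (j * j) + 24 * (j * j) + 186 * j + 458) ≡ 2 * ((4 + (j + 5)) * ((4 + (j + 5)) * ((4 + (j + 5)) * 1)))
      eq = solve-∀

  -- λ′ is the binary length of l.
  logBound : ∀ {l} → 4096 ≤′ l → ∃[ λ′ ] 13 ≤ λ′ × (3 + λ′) ^ 3 ≤ l × l < 2 ^ λ′
  logBound (≤′-reflexive refl) = 13 , ≤-refl , ≤ᵇ⇒≤ (16 ^ 3) 4096 _ , <ᵇ⇒< 4096 (2 ^ 13) _
  logBound {suc l} (≤′-step 4096≤l) with logBound 4096≤l
  ... | λ′ , 13≤λ , k³≤l , l< with suc l <? 2 ^ λ′
  ...   | yes 1+l< = λ′ , 13≤λ , m≤n⇒m≤1+n k³≤l , 1+l<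
  ...   | no 1+l≮ = suc λ′ , m≤n⇒m≤1+n 13≤λ , ≤-trans (cube≤2^ (≤⇒≤′ 13≤λ)) (≮⇒≥ 1+l≮) , ≤-<-trans l< (^-monoʳ-< 2 ≤-refl (n<1+n λ′))

  square-cancel-≤ : ∀ a b → a * a ≤ b * b → a ≤ b
  square-cancel-≤ a b a²≤b² = ≮⇒≥ λ b<a → <⇒≱ (*-mono-< b<a b<a) a²≤b²

  cube-cancel-≤ : ∀ a b → a ^ 3 ≤ b ^ 3 → a ≤ b
  cube-cancel-≤ a b a³≤b³ = ≮⇒≥ λ b<a → <⇒≱ (^-monoˡ-< 3 b<a) a³≤b³

  ^-cancelʳ-< : ∀ b m n → b ^ m < b ^ n → 1 ≤ b → m < n
  ^-cancelʳ-< b m n b^m<b^n 1≤b = ≰⇒> λ n≤m → <⇒≱ b^m<b^n (^-monoʳ-≤ b {{>-nonZero 1≤b}} n≤m)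

  module Exponents (l λ′ : ℕ) (13≤λ : 13 ≤ λ′) (k³≤l : (3 + λ′) ^ 3 ≤ l) (l<2^λ : l < 2 ^ λ′) where
    open ≤-Reasoning

    -- All logarithmic quantities are measured by `k`: on the one hand `8 * l ≤ 2 ^ k`, on the other
    -- `k ^ 3 ≤ l`.
    k : ℕ
    k = 3 + λ′

    16≤k : 16 ≤ k
    16≤k = +-monoʳ-≤ 3 13≤λ

    16k²≤l : 16 * (k * k) ≤ l
    16k²≤l = ≤-trans (*-monoˡ-≤ (k * k) 16≤k) (≤-trans (≤-reflexive (cong (λ x → k * (k * x)) (sym (*-identityʳ k)))) k³≤l)

    256k≤l : 256 * k ≤ l
    256k≤l = ≤-trans (≤-reflexive (*-assoc 16 16 k)) (≤-trans (*-monoʳ-≤ 16 (*-monoˡ-≤ k 16≤k)) 16k²≤l)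

    26k≤l : 26 * k ≤ l
    26k≤l = ≤-trans (*-monoˡ-≤ k (m≤m+n 26 230)) 256k≤l

    8+8λ≤8k : 8 + 8 * λ′ ≤ 8 * k
    8+8λ≤8k = ≤-trans (+-monoˡ-≤ (8 * λ′) (m≤m+n 8 16)) (≤-reflexive (sym (*-distribˡ-+ 8 3 λ′)))

    -- The part of the upper bound that has to be shown small against an exponential in `l`: the
    -- quadratic loss of the lower bound and a factor `N` for each of the `s` small primes.
    -- `exponent` bounds its binary logarithm.
    W : ℕ → ℕ → ℕ
    W N s = 4 * l * (1 + l) * N ^ s

    exponent : ℕ → ℕ → ℕ
    exponent ν s = 2 + 2 * λ′ + ν * s

    prefactor< : 4 * l * (1 + l) < 2 ^ (2 + 2 * λ′)
    prefactor< = begin-strict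
      4 * l * (1 + l)          ≤⟨ *-monoʳ-≤ (4 * l) l<2^λ ⟩
      4 * l * 2 ^ λ′           <⟨ *-monoˡ-< (2 ^ λ′) {{m^n≢0 2 λ′}} (*-monoʳ-< 4 l<2^λ) ⟩
      4 * 2 ^ λ′ * 2 ^ λ′      ≡⟨ *-assoc 4 (2 ^ λ′) (2 ^ λ′) ⟩
      4 * (2 ^ λ′ * 2 ^ λ′)    ≡⟨ cong (4 *_) (^-distribˡ-+-* 2 λ′ λ′) ⟨
      4 * 2 ^ (λ′ + λ′)        ≡⟨ cong (λ x → 4 * 2 ^ (λ′ + x)) (+-identityʳ λ′) ⟨
      4 * 2 ^ (2 * λ′)         ≡⟨ ^-distribˡ-+-* 2 2 (2 * λ′) ⟨
      2 ^ (2 + 2 * λ′)         ∎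

    W< : ∀ N ν s → N ≤ 2 ^ ν → W N s < 2 ^ exponent ν s
    W< N ν s N≤ = begin-strict
      4 * l * (1 + l) * N ^ s              ≤⟨ *-monoʳ-≤ (4 * l * (1 + l)) (^-monoˡ-≤ s N≤) ⟩
      4 * l * (1 + l) * (2 ^ ν) ^ s        ≡⟨ cong (4 * l * (1 + l) *_) (^-*-assoc 2 ν s) ⟩
      4 * l * (1 + l) * 2 ^ (ν * s)        <⟨ *-monoˡ-< (2 ^ (ν * s)) {{m^n≢0 2 (ν * s)}} prefactor< ⟩
      2 ^ (2 + 2 * λ′) * 2 ^ (ν * s)       ≡⟨ ^-distribˡ-+-* 2 (2 + 2 * λ′) (ν * s) ⟨
      2 ^ (2 + 2 * λ′ + ν * s)             ∎

    4*exponent≤ : ∀ ν s z → 4 * s ≤ z + 9 → ν ≤ 2 * k → 4 * exponent ν s ≤ l + 2 * (k * z)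
    4*exponent≤ ν s z 4s≤ ν≤2k = begin
      4 * (2 + 2 * λ′ + ν * s)        ≡⟨ eq₁ λ′ ν s ⟩
      8 + 8 * λ′ + ν * (4 * s)        ≤⟨ +-mono-≤ 8+8λ≤8k (*-mono-≤ ν≤2k 4s≤) ⟩
      8 * k + 2 * k * (z + 9)         ≡⟨ eq₂ k z ⟩
      26 * k + 2 * (k * z)            ≤⟨ +-monoˡ-≤ _ 26k≤l ⟩
      l + 2 * (k * z)                 ∎
      where
      eq₁ : ∀ a ν s → 4 * (2 + 2 * a + ν * s) ≡ 8 + 8 * a + ν * (4 * s)
      eq₁ = solve-∀
      eq₂ : ∀ k z → 8 * k + 2 * k * (z + 9) ≡ 26 * k + 2 * (k * z)
      eq₂ = solve-∀

    -- The critical case, in which the estimates leave the least room.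
    4*exponent≤l : ∀ s z → 4 * s ≤ z + 9 → z * z ≤ 8 * l → 4 * exponent k s ≤ l
    4*exponent≤l s z 4s≤ z²≤8l = *-cancelˡ-≤ 4 (begin
      4 * (4 * (2 + 2 * λ′ + k * s))        ≡⟨ eq₁ λ′ k s ⟩
      4 * (8 + 8 * λ′) + 4 * (k * (4 * s))  ≤⟨ +-mono-≤ (*-monoʳ-≤ 4 8+8λ≤8k) (*-monoʳ-≤ 4 (*-monoʳ-≤ k 4s≤)) ⟩
      4 * (8 * k) + 4 * (k * (z + 9))       ≡⟨ eq₂ k z ⟩
      68 * k + 4 * (k * z)                  ≤⟨ +-mono-≤ (≤-trans (*-monoˡ-≤ k (m≤m+n 68 188)) 256k≤l) 4kz≤3l ⟩
      l + 3 * l                             ∎)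
      where
      eq₁ : ∀ a k s → 4 * (4 * (2 + 2 * a + k * s)) ≡ 4 * (8 + 8 * a) + 4 * (k * (4 * s))
      eq₁ = solve-∀
      eq₂ : ∀ k z → 4 * (8 * k) + 4 * (k * (z + 9)) ≡ 68 * k + 4 * (k * z)
      eq₂ = solve-∀
      4kz≤3l : 4 * (k * z) ≤ 3 * l
      4kz≤3l = square-cancel-≤ (4 * (k * z)) (3 * l) (begin
        4 * (k * z) * (4 * (k * z))   ≡⟨ eq₃ k z ⟩
        16 * (k * k) * (z * z)        ≤⟨ *-mono-≤ 16k²≤l z²≤8l ⟩
        l * (8 * l)                   ≤⟨ m≤m+n _ (l * l) ⟩
        l * (8 * l) + l * l           ≡⟨ eq₄ l ⟩
        3 * l * (3 * l)               ∎)
        where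
        eq₃ : ∀ k z → 4 * (k * z) * (4 * (k * z)) ≡ 16 * (k * k) * (z * z)
        eq₃ = solve-∀
        eq₄ : ∀ l → l * (8 * l) + l * l ≡ 3 * l * (3 * l)
        eq₄ = solve-∀

    2kz≤ : ∀ c z → z * z ≤ 4 * (c * c) * l → 2 * (k * z) ≤ c * l
    2kz≤ c z z²≤ = square-cancel-≤ (2 * (k * z)) (c * l) (*-cancelˡ-≤ 4 (begin
      4 * (2 * (k * z) * (2 * (k * z)))  ≡⟨ eq₁ k z ⟩
      16 * (k * k) * (z * z)             ≤⟨ *-mono-≤ 16k²≤l z²≤ ⟩
      l * (4 * (c * c) * l)              ≡⟨ eq₂ c l ⟩
      4 * (c * l * (c * l))              ∎))
      where
      eq₁ : ∀ k z → 4 * (2 * (k * z) * (2 * (k * z))) ≡ 16 * (k * k) * (z * z)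
      eq₁ = solve-∀
      eq₂ : ∀ c l → l * (4 * (c * c) * l) ≡ 4 * (c * l * (c * l))
      eq₂ = solve-∀

    -- This is what the cube in `k ^ 3 ≤ l` is for: `z` will be a cube root of `N`, with `N` as
    -- large as a multiple of `l * l`.
    kz≤-cube : ∀ c z → z ^ 3 ≤ c ^ 3 * (l * l) → k * z ≤ c * l
    kz≤-cube c z z³≤ = cube-cancel-≤ (k * z) (c * l) (begin
      (k * z) ^ 3                ≡⟨ ^-distrib-* k z 3 ⟩
      k ^ 3 * z ^ 3              ≤⟨ *-mono-≤ k³≤l z³≤ ⟩
      l * (c ^ 3 * (l * l))      ≡⟨ eq l (c ^ 3) ⟩
      c ^ 3 * l ^ 3              ≡⟨ ^-distrib-* c l 3 ⟨
      (c * l) ^ 3                ∎)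
      where
      eq : ∀ l a → l * (a * (l * l)) ≡ a * (l * (l * (l * 1)))
      eq = solve-∀

    N≤2^ : ∀ q N → N ≤ 2 ^ q * l → N ≤ 2 ^ (q + λ′)
    N≤2^ q N N≤ = ≤-trans N≤ (≤-trans (*-monoʳ-≤ (2 ^ q) (<⇒≤ l<2^λ)) (≤-reflexive (sym (^-distribˡ-+-* 2 q λ′))))

    1≤l : 1 ≤ l
    1≤l = ≤-trans (s≤s z≤n) (≤-trans 16≤k (≤-trans (m≤n*m k 26) 26k≤l))

    -- Impossibility of (N′/B)^l ≤ W when N′/B ≥ 2^r.
    power-gap : ∀ r B N′ N ν s → 1 ≤ B → 2 ^ r * B ≤ N′ → N′ ^ l ≤ W N s * B ^ l → N ≤ 2 ^ ν → exponent ν s ≤ r * l → ⊥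
    power-gap r B N′ N ν s 1≤B B≤N′ N′^l≤ N≤ E≤ = <⇒≱ W<2^rl (*-cancelʳ-≤ _ _ (B ^ l) {{m^n≢0 B l {{>-nonZero 1≤B}}}} (begin
      2 ^ (r * l) * B ^ l   ≡⟨ cong (_* B ^ l) (^-*-assoc 2 r l) ⟨
      (2 ^ r) ^ l * B ^ l   ≡⟨ ^-distrib-* (2 ^ r) B l ⟨
      (2 ^ r * B) ^ l       ≤⟨ ^-monoˡ-≤ l B≤N′ ⟩
      N′ ^ l                ≤⟨ N′^l≤ ⟩
      W N s * B ^ l         ∎))
      where
      W<2^rl : W N s < 2 ^ (r * l)
      W<2^rl = <-≤-trans (W< N ν s N≤) (^-monoʳ-≤ 2 E≤)

  module Smooth (l′ m : ℕ) (2∤m : 2 ∤ m) (m≥ : 1 + 2 * suc l′ ≤ m)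
                (p≤2l : ∀ i → i < suc l′ → ∀ p → Prime p → p ∣ term m i → p ≤ 2 * suc l′)
                (3p≤N : ∀ i → i < suc l′ → ∀ p → Prime p → p ∣ term m i → 3 * p ≤ term m l′) where
    private
      l : ℕ
      l = suc l′

    N : ℕ
    N = term m l′

    1≤N : 1 ≤ N
    1≤N = ≤-trans (s≤s z≤n) (≤-trans m≥ (m≤m+n m _))

    term≤N : ∀ i → i < l → term m i ≤ N
    term≤N i i<l = +-monoʳ-≤ m (*-monoʳ-≤ 2 (s≤s⁻¹ i<l))

    module Large (4096≤l : 4096 ≤ l) where
      private
        log = logBound (≤⇒≤′ 4096≤l)
        λ′ = proj₁ log
      open Exponents l λ′ (proj₁ (proj₂ log)) (proj₁ (proj₂ (proj₂ log))) (proj₂ (proj₂ (proj₂ log)))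
      open ≤-Reasoning

      bounded : ∀ e y z → (∀ i → i < l → ∀ p → Prime p → p ∣ term m i → p ≤ y) → N < suc z ^ suc e →
                ∏ (term m) l ≤ oddFactorial l * (N ^ smallCount z y * (4 ^ y) ^ e)
      bounded e y z smooth N< = ≤-trans (∏-term≤ l m N z e y 2∤m 1≤N term≤N smooth N<)
        (*-monoʳ-≤ (oddFactorial l) (*-monoʳ-≤ (N ^ smallCount z y) (^-monoˡ-≤ e (θ≤4^ y))))

      4*small≤z : ∀ z y → 4 * smallCount z y ≤ z + 9
      4*small≤z z y = ≤-trans (*-monoʳ-≤ 4 (smallCount≤π′z z y)) (4π′≤ z)

      -- Each unit of `e` costs a factor `16 ^ l` through `θ (2 * l)`, but it replaces one root of
      -- `N` by the next higher one as the bound `z`, and so lowers the number `s` of primes that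
      -- are charged a full factor `N`.
      [4N]^l≤W : ∀ e z → N < suc z ^ suc e → (4 * N) ^ l ≤ W N (smallCount z (2 * l)) * (16 ^ e * l) ^ l
      [4N]^l≤W e z N< = begin
        (4 * N) ^ l                                     ≤⟨ Bounds.[4N]^l≤ l′ m _ m≥ (bounded e (2 * l) z p≤2l N<) ⟩
        4 * l * (1 + l) * (N ^ s * (4 ^ (2 * l)) ^ e) * l ^ l ≡⟨ cong (λ x → 4 * l * (1 + l) * (N ^ s * x) * l ^ l) 4^2l^e ⟩
        4 * l * (1 + l) * (N ^ s * (16 ^ e) ^ l) * l ^ l ≡⟨ eq (4 * l * (1 + l)) (N ^ s) ((16 ^ e) ^ l) (l ^ l) ⟩
        W N s * ((16 ^ e) ^ l * l ^ l)                  ≡⟨ cong (W N s *_) (^-distrib-* (16 ^ e) l l) ⟨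
        W N s * (16 ^ e * l) ^ l                        ∎
        where
        s = smallCount z (2 * l)
        eq : ∀ a b c d → a * (b * c) * d ≡ a * b * (c * d)
        eq = solve-∀
        4^2l^e : (4 ^ (2 * l)) ^ e ≡ (16 ^ e) ^ l
        4^2l^e = trans (cong (_^ e) (sym (^-*-assoc 4 2 l))) (trans (^-*-assoc 16 l e) (trans (cong (16 ^_) (*-comm l e)) (sym (^-*-assoc 16 e l))))

      sqrt : ∃[ z ] z * z ≤ N × N < suc z ^ 2
      sqrt = let z , z²≤N , N< = root 1 N in z , subst (λ x → z * x ≤ N) (*-identityʳ z) z²≤N , N<

      cbrt : ∃[ z ] z ^ 3 ≤ N × N < suc z ^ 3
      cbrt = root 2 N

      -- Here `3 * p ≤ N` is decisive: the primes are at most `5 * l / 3`, so the binary logarithm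
      -- of the upper bound is at most `l / 4 + 10 l / 3`, against `4 l` from below.
      N≤5l⇒⊥ : N ≤ 5 * l → ⊥
      N≤5l⇒⊥ N≤5l = <⇒≱ 4l<E+2y (*-cancelˡ-≤ 12 (begin
        12 * (E + 2 * y)             ≡⟨ eq E y ⟩
        3 * (4 * E) + 8 * (y * 3)    ≤⟨ +-mono-≤ (*-monoʳ-≤ 3 (4*exponent≤l s z (4*small≤z z y) (≤-trans z²≤N N≤8l))) (*-monoʳ-≤ 8 (m/n*n≤m (5 * l) 3)) ⟩
        3 * l + 8 * (5 * l)          ≤⟨ m≤m+n _ (5 * l) ⟩
        3 * l + 8 * (5 * l) + 5 * l  ≡⟨ eq′ l ⟩
        12 * (4 * l)                 ∎))
        where
        y = 5 * l / 3
        z = proj₁ sqrt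
        z²≤N = proj₁ (proj₂ sqrt)
        s = smallCount z y
        E = exponent k s
        N≤8l : N ≤ 8 * l
        N≤8l = ≤-trans N≤5l (*-monoˡ-≤ l (m≤m+n 5 3))
        smooth : ∀ i → i < l → ∀ p → Prime p → p ∣ term m i → p ≤ y
        smooth i i<l p pp p∣ = s≤s⁻¹ (*-cancelˡ-< 3 p (suc y) (begin-strict
          3 * p                      ≤⟨ ≤-trans (3p≤N i i<l p pp p∣) N≤5l ⟩
          5 * l                      ≡⟨ m≡m%n+[m/n]*n (5 * l) 3 ⟩
          5 * l % 3 + y * 3          <⟨ +-monoˡ-< (y * 3) (m%n<n (5 * l) 3) ⟩
          3 + y * 3                  ≡⟨ *-comm (suc y) 3 ⟩
          3 * suc y                  ∎))
          where open import Data.Nat.DivMod using (_%_)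
        eq : ∀ E y → 12 * (E + 2 * y) ≡ 3 * (4 * E) + 8 * (y * 3)
        eq = solve-∀
        eq′ : ∀ l → 3 * l + 8 * (5 * l) + 5 * l ≡ 12 * (4 * l)
        eq′ = solve-∀
        4l<E+2y : 4 * l < E + 2 * y
        4l<E+2y = ^-cancelʳ-< 2 (4 * l) (E + 2 * y) (begin-strict
          2 ^ (4 * l)                               ≡⟨ ^-*-assoc 2 4 l ⟨
          16 ^ l                                    ≤⟨ Bounds.16^l≤ l′ m _ m≥ (bounded 1 y z smooth (proj₂ (proj₂ sqrt))) ⟩
          4 * l * (1 + l) * (N ^ s * (4 ^ y * 1))   ≡⟨ cong (λ x → 4 * l * (1 + l) * (N ^ s * x)) (*-identityʳ (4 ^ y)) ⟩
          4 * l * (1 + l) * (N ^ s * 4 ^ y)         ≡⟨ *-assoc (4 * l * (1 + l)) (N ^ s) (4 ^ y) ⟨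
          W N s * 4 ^ y                             <⟨ *-monoˡ-< (4 ^ y) {{m^n≢0 4 y}} (W< N k s (N≤2^ 3 N N≤8l)) ⟩
          2 ^ E * 4 ^ y                             ≡⟨ cong (2 ^ E *_) (^-*-assoc 2 2 y) ⟩
          2 ^ E * 2 ^ (2 * y)                       ≡⟨ ^-distribˡ-+-* 2 E (2 * y) ⟨
          2 ^ (E + 2 * y)                           ∎) (s≤s z≤n)

      -- The last term now exceeds `4 * l` by a factor `5 / 4`, which is more than `2 ^ (1 / 4)`,
      -- while `W` stays below `2 ^ (l / 4)`.
      5l<N≤8l⇒⊥ : 5 * l < N → N ≤ 8 * l → ⊥
      5l<N≤8l⇒⊥ 5l<N N≤8l = <⇒≱ 9l<4E+8l (begin
        4 * E + 8 * l ≤⟨ +-monoˡ-≤ (8 * l) (4*exponent≤l s z (4*small≤z z (2 * l)) (≤-trans (proj₁ (proj₂ sqrt)) N≤8l)) ⟩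
        9 * l         ∎)
        where
        z = proj₁ sqrt
        s = smallCount z (2 * l)
        E = exponent k s
        5^l≤ : 5 ^ l ≤ W N s * 4 ^ l
        5^l≤ = *-cancelʳ-≤ _ _ ((4 * l) ^ l) {{m^n≢0 (4 * l) l}} (begin
          5 ^ l * (4 * l) ^ l             ≡⟨ ^-distrib-* 5 (4 * l) l ⟨
          (5 * (4 * l)) ^ l               ≤⟨ ^-monoˡ-≤ l (≤-trans (≤-reflexive (eq₁ l)) (*-monoʳ-≤ 4 (<⇒≤ 5l<N))) ⟩
          (4 * N) ^ l                     ≤⟨ [4N]^l≤W 1 z (proj₂ (proj₂ sqrt)) ⟩
          W N s * (16 * l) ^ l            ≡⟨ cong (λ x → W N s * x ^ l) (*-assoc 4 4 l) ⟩
          W N s * (4 * (4 * l)) ^ l       ≡⟨ cong (W N s *_) (^-distrib-* 4 (4 * l) l) ⟩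
          W N s * (4 ^ l * (4 * l) ^ l)   ≡⟨ *-assoc (W N s) (4 ^ l) _ ⟨
          W N s * 4 ^ l * (4 * l) ^ l     ∎)
          where
          eq₁ : ∀ l → 5 * (4 * l) ≡ 4 * (5 * l)
          eq₁ = solve-∀
        -- 2^9 < 5^4
        9l<4E+8l : 9 * l < 4 * E + 8 * l
        9l<4E+8l = ^-cancelʳ-< 2 (9 * l) (4 * E + 8 * l) (begin-strict
          2 ^ (9 * l)                     ≡⟨ ^-*-assoc 2 9 l ⟨
          512 ^ l                         ≤⟨ ^-monoˡ-≤ l (m≤m+n 512 113) ⟩
          625 ^ l                         ≡⟨ trans (^-*-assoc 5 4 l) (trans (cong (5 ^_) (*-comm 4 l)) (sym (^-*-assoc 5 l 4))) ⟩
          (5 ^ l) ^ 4                     ≤⟨ ^-monoˡ-≤ 4 5^l≤ ⟩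
          (W N s * 4 ^ l) ^ 4             ≡⟨ ^-distrib-* (W N s) (4 ^ l) 4 ⟩
          W N s ^ 4 * (4 ^ l) ^ 4         <⟨ *-monoˡ-< ((4 ^ l) ^ 4) {{m^n≢0 (4 ^ l) 4 {{m^n≢0 4 l}}}} (^-monoˡ-< 4 (W< N k s (N≤2^ 3 N N≤8l))) ⟩
          (2 ^ E) ^ 4 * (4 ^ l) ^ 4       ≡⟨ cong₂ _*_ (trans (^-*-assoc 2 E 4) (cong (2 ^_) (*-comm E 4))) (trans (^-*-assoc 4 l 4) (trans (cong (4 ^_) (*-comm l 4)) (trans (^-*-assoc 2 2 (4 * l)) (cong (2 ^_) (sym (*-assoc 2 4 l)))))) ⟩
          2 ^ (4 * E) * 2 ^ (8 * l)       ≡⟨ ^-distribˡ-+-* 2 (4 * E) (8 * l) ⟨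
          2 ^ (4 * E + 8 * l)             ∎) (s≤s z≤n)

      exponent≤ : ∀ c r ν s z → 4 * s ≤ z + 9 → ν ≤ 2 * k → 2 * (k * z) ≤ c * l → 1 + c ≤ 4 * r → exponent ν s ≤ r * l
      exponent≤ c r ν s z 4s≤ ν≤ 2kz≤cl c≤r = *-cancelˡ-≤ 4 (begin
        4 * exponent ν s     ≤⟨ 4*exponent≤ ν s z 4s≤ ν≤ ⟩
        l + 2 * (k * z)      ≤⟨ +-monoʳ-≤ l 2kz≤cl ⟩
        (1 + c) * l          ≤⟨ *-monoˡ-≤ l c≤r ⟩
        4 * r * l            ≡⟨ *-assoc 4 r l ⟩
        4 * (r * l)          ∎)

      ν≤2k : ∀ q → q ≤ 16 → q + λ′ ≤ 2 * k
      ν≤2k q q≤16 = ≤-trans (+-mono-≤ (≤-trans q≤16 16≤k) (m≤n+m λ′ 3)) (≤-reflexive (cong (k +_) (sym (+-identityʳ k))))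

      -- With `e = 1` and `z` the square root of `N`: the terms gain `2 ^ (r l)` over the extreme
      -- case, and `W` is below `2 ^ ((1 + c) l / 4)`, where `c` comes from
      -- `z * z ≤ 4 * (c * c) * l`.
      middle : ∀ r q → 2 ^ r * (4 * l) ≤ N → N ≤ 2 ^ q * l → ∀ c → 2 ^ q ≤ 4 * (c * c) → q ≤ 16 → 1 + c ≤ 4 * r → ⊥
      middle r q ≤N N≤ c q≤c q≤16 c≤r = power-gap r (16 * l) (4 * N) N (q + λ′) s (s≤s z≤n)
        (≤-trans (≤-reflexive (eq (2 ^ r) l)) (*-monoʳ-≤ 4 ≤N)) ([4N]^l≤W 1 z (proj₂ (proj₂ sqrt))) (N≤2^ q N N≤)
        (exponent≤ c r (q + λ′) s z (4*small≤z z (2 * l)) (ν≤2k q q≤16)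
          (2kz≤ c z (≤-trans (proj₁ (proj₂ sqrt)) (≤-trans N≤ (*-monoˡ-≤ l q≤c)))) c≤r)
        where
        z = proj₁ sqrt
        s = smallCount z (2 * l)
        eq : ∀ a l → a * (16 * l) ≡ 4 * (a * (4 * l))
        eq = solve-∀

      -- With `e = 2` and `z` the cube root of `N`. The second factor `16 ^ l` from `θ` explains why
      -- `N` is compared with `64 * l` instead of `4 * l`; `W` is below `2 ^ ((1 + 2 c) l / 4)`.
      high : ∀ r c ν → 2 ^ r * (64 * l) ≤ N → N ≤ c ^ 3 * (l * l) → N ≤ 2 ^ ν → ν ≤ 2 * k → 1 + 2 * c ≤ 4 * r → ⊥
      high r c ν ≤N N≤ N≤2^ν ν≤ c≤r = power-gap r (256 * l) (4 * N) N ν s (s≤s z≤n)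
        (≤-trans (≤-reflexive (eq (2 ^ r) l)) (*-monoʳ-≤ 4 ≤N)) ([4N]^l≤W 2 z (proj₂ (proj₂ cbrt))) N≤2^ν
        (exponent≤ (2 * c) r ν s z (4*small≤z z (2 * l)) ν≤ (≤-trans (*-monoʳ-≤ 2 (kz≤-cube c z (≤-trans (proj₁ (proj₂ cbrt)) N≤))) (≤-reflexive (sym (*-assoc 2 c l)))) c≤r)
        where
        z = proj₁ cbrt
        s = smallCount z (2 * l)
        eq : ∀ a l → a * (256 * l) ≡ 4 * (a * (64 * l))
        eq = solve-∀

      l*l≤ : l * l ≤ 2 ^ (λ′ + λ′)
      l*l≤ = ≤-trans (*-mono-≤ (<⇒≤ l<) (<⇒≤ l<)) (≤-reflexive (sym (^-distribˡ-+-* 2 λ′ λ′)))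
        where l< = proj₂ (proj₂ (proj₂ log))

      -- Here every p^{⌊log_p N⌋} is bounded by N, and there are few odd primes up to 2l.
      64l²≤N⇒⊥ : 64 * (l * l) ≤ N → ⊥
      64l²≤N⇒⊥ 64l²≤N = <⇒≱ 10l< (begin
        (2 + 2 * λ′) + (2 + 2 * λ′) + k * 9    ≤⟨ +-monoˡ-≤ (k * 9) (+-mono-≤ 2+2λ≤2k 2+2λ≤2k) ⟩
        2 * k + 2 * k + k * 9                  ≡⟨ eq₀ k ⟩
        13 * k                                 ≤⟨ ≤-trans (*-monoˡ-≤ k (m≤m+n 13 13)) 26k≤l ⟩
        l                                      ≤⟨ m≤n*m l 10 ⟩
        10 * l                                 ∎)
        where
        eq₀ : ∀ k → 2 * k + 2 * k + k * 9 ≡ 13 * k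
        eq₀ = solve-∀
        2+2λ≤2k : 2 + 2 * λ′ ≤ 2 * k
        2+2λ≤2k = ≤-trans (≤-reflexive (sym (*-distribˡ-+ 2 1 λ′))) (*-monoʳ-≤ 2 (m≤n+m (1 + λ′) 2))
        s = smallCount N (2 * l)
        C = 4 * l * (1 + l)
        4s≤ : 4 * s ≤ 2 * l + 9
        4s≤ = ≤-trans (*-monoʳ-≤ 4 (smallCount≤π′y N (2 * l))) (4π′≤ (2 * l))
        s≤l : s ≤ l
        s≤l = *-cancelˡ-≤ 4 (≤-trans 4s≤ (≤-trans (+-monoʳ-≤ (2 * l) (≤-trans (≤-trans (m≤m+n 9 4087) 4096≤l) (m≤m+n l (l + 0)))) (≤-reflexive (eq l))))
          where
          eq : ∀ l → 2 * l + 2 * l ≡ 4 * l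
          eq = solve-∀
        r = l ∸ s
        s+r≡l : s + r ≡ l
        s+r≡l = m+[n∸m]≡n s≤l
        2l≤4r+9 : 2 * l ≤ 4 * r + 9
        2l≤4r+9 = +-cancelˡ-≤ (2 * l) _ _ (begin
          2 * l + 2 * l         ≡⟨ eq l ⟩
          4 * l                 ≡⟨ cong (4 *_) s+r≡l ⟨
          4 * (s + r)           ≡⟨ *-distribˡ-+ 4 s r ⟩
          4 * s + 4 * r         ≤⟨ +-monoˡ-≤ (4 * r) 4s≤ ⟩
          2 * l + 9 + 4 * r     ≡⟨ eq′ l r ⟩
          2 * l + (4 * r + 9)   ∎)
          where
          eq : ∀ l → 2 * l + 2 * l ≡ 4 * l
          eq = solve-∀
          eq′ : ∀ l r → 2 * l + 9 + 4 * r ≡ 2 * l + (4 * r + 9)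
          eq′ = solve-∀
        4^lN^r≤ : 4 ^ l * N ^ r ≤ C * l ^ l
        4^lN^r≤ = *-cancelʳ-≤ _ _ (N ^ s) {{m^n≢0 N s {{>-nonZero 1≤N}}}} (begin
          4 ^ l * N ^ r * N ^ s           ≡⟨ *-assoc (4 ^ l) (N ^ r) (N ^ s) ⟩
          4 ^ l * (N ^ r * N ^ s)         ≡⟨ cong (4 ^ l *_) (^-distribˡ-+-* N r s) ⟨
          4 ^ l * N ^ (r + s)             ≡⟨ cong (λ x → 4 ^ l * N ^ x) (trans (+-comm r s) s+r≡l) ⟩
          4 ^ l * N ^ l                   ≡⟨ ^-distrib-* 4 N l ⟨
          (4 * N) ^ l                     ≤⟨ [4N]^l≤W 0 N (≤-reflexive (sym (*-identityʳ (suc N)))) ⟩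
          W N s * (1 * l) ^ l             ≡⟨ cong (λ x → W N s * x ^ l) (*-identityˡ l) ⟩
          C * N ^ s * l ^ l               ≡⟨ eq C (N ^ s) (l ^ l) ⟩
          C * l ^ l * N ^ s               ∎)
          where
          eq : ∀ a b c → a * b * c ≡ a * c * b
          eq = solve-∀
        -- The square root of the lower bound for `N`. Since `4 * r` is at least `2 * l - 9`, the
        -- square of `N ^ r` is at least `L ^ (2 * l)` up to the factor `L ^ 9`.
        L = 8 * l
        L^2l≤ : L ^ (2 * l) ≤ N ^ r * N ^ r * L ^ 9
        L^2l≤ = begin
          L ^ (2 * l)                     ≤⟨ ^-monoʳ-≤ L 2l≤4r+9 ⟩
          L ^ (4 * r + 9)                 ≡⟨ ^-distribˡ-+-* L (4 * r) 9 ⟩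
          L ^ (4 * r) * L ^ 9             ≡⟨ cong (_* L ^ 9) L^4r ⟩
          (L * L) ^ r * (L * L) ^ r * L ^ 9 ≤⟨ *-monoˡ-≤ (L ^ 9) (*-mono-≤ (^-monoˡ-≤ r L²≤N) (^-monoˡ-≤ r L²≤N)) ⟩
          N ^ r * N ^ r * L ^ 9           ∎
          where
          L²≤N : L * L ≤ N
          L²≤N = ≤-trans (≤-reflexive (eq l)) 64l²≤N
            where
            eq : ∀ l → 8 * l * (8 * l) ≡ 64 * (l * l)
            eq = solve-∀
          L^4r : L ^ (4 * r) ≡ (L * L) ^ r * (L * L) ^ r
          L^4r = trans (cong (L ^_) (eq r)) (trans (^-distribˡ-+-* L (2 * r) (2 * r)) (cong₂ _*_ L^2r L^2r))
            where
            eq : ∀ r → 4 * r ≡ 2 * r + 2 * r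
            eq = solve-∀
            L^2r : L ^ (2 * r) ≡ (L * L) ^ r
            L^2r = trans (sym (^-*-assoc L 2 r)) (cong (λ x → (L * x) ^ r) (*-identityʳ L))
        10l< : 10 * l < (2 + 2 * λ′) + (2 + 2 * λ′) + k * 9
        10l< = ^-cancelʳ-< 2 (10 * l) _ (*-cancelʳ-< (l ^ l * l ^ l) _ _ (begin-strict
          2 ^ (10 * l) * (l ^ l * l ^ l)          ≡⟨ cong (_* (l ^ l * l ^ l)) 2^10l ⟩
          4 ^ l * 4 ^ l * (8 ^ l * 8 ^ l) * (l ^ l * l ^ l) ≡⟨ eq₁ (4 ^ l) (8 ^ l) (l ^ l) ⟩
          4 ^ l * 4 ^ l * (8 ^ l * l ^ l * (8 ^ l * l ^ l)) ≡⟨ cong (λ x → 4 ^ l * 4 ^ l * (x * x)) (^-distrib-* 8 l l) ⟨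
          4 ^ l * 4 ^ l * (L ^ l * L ^ l)         ≡⟨ cong (4 ^ l * 4 ^ l *_) (trans (sym (^-distribˡ-+-* L l l)) (cong (λ x → L ^ (l + x)) (sym (+-identityʳ l)))) ⟩
          4 ^ l * 4 ^ l * L ^ (2 * l)             ≤⟨ *-monoʳ-≤ (4 ^ l * 4 ^ l) L^2l≤ ⟩
          4 ^ l * 4 ^ l * (N ^ r * N ^ r * L ^ 9) ≡⟨ eq₂ (4 ^ l) (N ^ r) (L ^ 9) ⟩
          4 ^ l * N ^ r * (4 ^ l * N ^ r) * L ^ 9 ≤⟨ *-monoˡ-≤ (L ^ 9) (*-mono-≤ 4^lN^r≤ 4^lN^r≤) ⟩
          C * l ^ l * (C * l ^ l) * L ^ 9         ≡⟨ eq₃ C (l ^ l) (L ^ 9) ⟩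
          C * C * L ^ 9 * (l ^ l * l ^ l)         <⟨ *-monoˡ-< (l ^ l * l ^ l) {{m*n≢0 (l ^ l) (l ^ l) {{m^n≢0 l l}} {{m^n≢0 l l}}}} CCL< ⟩
          2 ^ ((2 + 2 * λ′) + (2 + 2 * λ′) + k * 9) * (l ^ l * l ^ l) ∎)) (s≤s z≤n)
          where
          eq₁ : ∀ a b c → a * a * (b * b) * (c * c) ≡ a * a * (b * c * (b * c))
          eq₁ = solve-∀
          eq₂ : ∀ a b c → a * a * (b * b * c) ≡ a * b * (a * b) * c
          eq₂ = solve-∀
          eq₃ : ∀ a b c → a * b * (a * b) * c ≡ a * a * c * (b * b)
          eq₃ = solve-∀
          2^10l : 2 ^ (10 * l) ≡ 4 ^ l * 4 ^ l * (8 ^ l * 8 ^ l)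
          2^10l = trans (sym (^-*-assoc 2 10 l)) (trans (^-distrib-* 16 64 l) (cong₂ _*_ (^-distrib-* 4 4 l) (^-distrib-* 8 8 l)))
          CCL< : C * C * L ^ 9 < 2 ^ ((2 + 2 * λ′) + (2 + 2 * λ′) + k * 9)
          CCL< = begin-strict
            C * C * L ^ 9 <⟨ *-monoˡ-< (L ^ 9) {{m^n≢0 L 9}} (*-mono-< prefactor< prefactor<) ⟩
            2 ^ (2 + 2 * λ′) * 2 ^ (2 + 2 * λ′) * L ^ 9 ≤⟨ *-monoʳ-≤ (2 ^ (2 + 2 * λ′) * 2 ^ (2 + 2 * λ′)) (^-monoˡ-≤ 9 (N≤2^ 3 L ≤-refl)) ⟩
            2 ^ (2 + 2 * λ′) * 2 ^ (2 + 2 * λ′) * (2 ^ k) ^ 9 ≡⟨ cong₂ _*_ (sym (^-distribˡ-+-* 2 (2 + 2 * λ′) (2 + 2 * λ′))) (^-*-assoc 2 k 9) ⟩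
            2 ^ ((2 + 2 * λ′) + (2 + 2 * λ′)) * 2 ^ (k * 9) ≡⟨ ^-distribˡ-+-* 2 ((2 + 2 * λ′) + (2 + 2 * λ′)) (k * 9) ⟨
            2 ^ ((2 + 2 * λ′) + (2 + 2 * λ′) + k * 9) ∎

      6+λ+λ≤2k : 6 + (λ′ + λ′) ≤ 2 * k
      6+λ+λ≤2k = ≤-reflexive (eq λ′)
        where
        eq : ∀ a → 6 + (a + a) ≡ 2 * (3 + a)
        eq = solve-∀

      -- In the ranges between `8 * l` and `64 * (l * l)` the thresholds are set so that the gain
      -- from the lower end pays for the loss from the upper end: `1 + c ≤ 4 * r` in `middle` and
      -- `1 + 2 * c ≤ 4 * r` in `high`. In the last of them `4096 ≤ l` turns `l * l ≤ N` into the
      -- gain `2 ^ 6` over `64 * l`.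
      absurd : ⊥
      absurd with ≤-<-connex N (5 * l)
      ... | inj₁ N≤5l = N≤5l⇒⊥ N≤5l
      ... | inj₂ 5l<N with ≤-total N (8 * l)
      ...   | inj₁ N≤8l = 5l<N≤8l⇒⊥ 5l<N N≤8l
      ...   | inj₂ 8l≤N with ≤-total N (32 * l)
      ...     | inj₁ N≤32l = middle 1 5 (≤-trans (≤-reflexive (sym (*-assoc 2 4 l))) 8l≤N) N≤32l 3 (m≤m+n 32 4) (m≤m+n 5 11) ≤-refl
      ...     | inj₂ 32l≤N with ≤-total N (256 * l)
      ...       | inj₁ N≤256l = middle 3 8 (≤-trans (≤-reflexive (sym (*-assoc 8 4 l))) 32l≤N) N≤256l 8 ≤-refl (m≤m+n 8 8) (m≤m+n 9 3)
      ...       | inj₂ 256l≤N with ≤-total N (l * l)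
      ...         | inj₁ N≤l² = high 2 1 (λ′ + λ′) (≤-trans (≤-reflexive (sym (*-assoc 4 64 l))) 256l≤N)
                                  (≤-trans N≤l² (≤-reflexive (sym (*-identityˡ (l * l))))) (≤-trans N≤l² l*l≤) (≤-trans (m≤n+m (λ′ + λ′) 6) 6+λ+λ≤2k) (m≤m+n 3 5)
      ...         | inj₂ l²≤N with ≤-total (64 * (l * l)) N
      ...           | inj₁ 64l²≤N = 64l²≤N⇒⊥ 64l²≤N
      ...           | inj₂ N≤64l² = high 6 4 (6 + (λ′ + λ′)) (≤-trans (≤-reflexive (sym (*-assoc 64 64 l))) (≤-trans (*-monoˡ-≤ l 4096≤l) l²≤N))
                                  N≤64l² (≤-trans N≤64l² (≤-trans (*-monoʳ-≤ 64 l*l≤) (≤-reflexive (sym (^-distribˡ-+-* 2 6 (λ′ + λ′)))))) 6+λ+λ≤2k (m≤m+n 9 15)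

  -- The odd Sylvester theorem for small l by computation

  exceeds : ℕ → ℕ → ℕ → ℕ → ℕ → Bool
  exceeds l o N₀ c p = (c ≤ᵇ l) ∧ (o * N₀ ^ c <ᵇ p)

  exceeds-sound : ∀ l o N₀ c p → T (exceeds l o N₀ c p) → c ≤ l × o * N₀ ^ c < p
  exceeds-sound l o N₀ c p ok = let c≤l , < = T-∧⁻ {c ≤ᵇ l} ok in ≤ᵇ⇒≤ c l c≤l , <ᵇ⇒< (o * N₀ ^ c) p <

  -- The accumulators o, p and c carry oddFactorial l, minimalProduct l and
  -- sieveCount (2 * l), for k consecutive values of l.
  denseCheck : ℕ → ℕ → ℕ → ℕ → ℕ → Bool
  denseCheck zero    l o p c = true
  denseCheck (suc k) l o p c =
    exceeds l o (4 * l ∸ 1) c p ∧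
    denseCheck k (suc l) (o * oddPart (suc l)) (p * ((1 + 4 * l) * (3 + 4 * l)) / (1 + 2 * l))
               (c + sieve (1 + 2 * l) + sieve (2 + 2 * l))

  denseCheck-sound : ∀ k l → T (denseCheck k l (oddFactorial l) (minimalProduct l) (sieveCount (2 * l))) → ∀ i → i < k →
                     T (exceeds (l + i) (oddFactorial (l + i)) (4 * (l + i) ∸ 1) (sieveCount (2 * (l + i))) (minimalProduct (l + i)))
  denseCheck-sound (suc k) l ok zero _ = subst (λ l → T (exceeds l (oddFactorial l) (4 * l ∸ 1) (sieveCount (2 * l)) (minimalProduct l))) (sym (+-identityʳ l)) (proj₁ (T-∧⁻ {exceeds l (oddFactorial l) (4 * l ∸ 1) (sieveCount (2 * l)) (minimalProduct l)} ok))
  denseCheck-sound (suc k) l ok (suc i) (s≤s i<k) = subst (λ l → T (exceeds l (oddFactorial l) (4 * l ∸ 1) (sieveCount (2 * l)) (minimalProduct l))) (sym (+-suc l i))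
    (denseCheck-sound k (suc l) (subst₂ (λ p y → T (denseCheck k (suc l) (oddFactorial (suc l)) p y)) minimalProduct≡ count≡ (proj₂ (T-∧⁻ {exceeds l (oddFactorial l) (4 * l ∸ 1) (sieveCount (2 * l)) (minimalProduct l)} ok))) i i<k)
    where
    minimalProduct≡ : minimalProduct l * ((1 + 4 * l) * (3 + 4 * l)) / (1 + 2 * l) ≡ minimalProduct (suc l)
    minimalProduct≡ = trans (cong (_/ (1 + 2 * l)) (sym (minimalProduct-suc l))) (m*n/n≡m (minimalProduct (suc l)) (1 + 2 * l))
    count≡ : sieveCount (2 * l) + sieve (1 + 2 * l) + sieve (2 + 2 * l) ≡ sieveCount (2 * suc l)
    count≡ = cong sieveCount (sym (*-suc 2 l))

  -- At the least first term, admitting all primes up to `2 * l` is too generous for some small `l`,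
  -- for instance `l = 7`. So the first test covers `N ≤ 5 * l` with the primes up to `5 * l / 3`,
  -- and the second covers `N > 5 * l`, where the first term is at least `3 + 3 * l`, with the
  -- primes up to `2 * l`.
  smallCheck : ℕ → Bool
  smallCheck zero    = true
  smallCheck (suc k) = let l = suc k in
    (exceeds l (oddFactorial l) (4 * l ∸ 1) (sieveCount (5 * l / 3)) (minimalProduct l) ∧
     exceeds l (oddFactorial l) (term (3 + 3 * l) k) (sieveCount (2 * l)) (∏ (term (3 + 3 * l)) l)) ∧
    smallCheck k

  smallCheck-sound : ∀ k → T (smallCheck k) → ∀ l′ → l′ < k → let l = suc l′ in
    T (exceeds l (oddFactorial l) (4 * l ∸ 1) (sieveCount (5 * l / 3)) (minimalProduct l)) ×
    T (exceeds l (oddFactorial l) (term (3 + 3 * l) l′) (sieveCount (2 * l)) (∏ (term (3 + 3 * l)) l))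
  smallCheck-sound (suc k) ok l′ l′<k with m≤n⇒m<n∨m≡n (s≤s⁻¹ l′<k)
  ... | inj₁ l′<k = smallCheck-sound k (proj₂ (T-∧⁻ {A ∧ B} ok)) l′ l′<k
    where
    A = exceeds (suc k) (oddFactorial (suc k)) (4 * suc k ∸ 1) (sieveCount (5 * suc k / 3)) (minimalProduct (suc k))
    B = exceeds (suc k) (oddFactorial (suc k)) (term (3 + 3 * suc k) k) (sieveCount (2 * suc k)) (∏ (term (3 + 3 * suc k)) (suc k))
  ... | inj₂ refl = T-∧⁻ {A} (proj₁ (T-∧⁻ {A ∧ B} ok))
    where
    A = exceeds (suc k) (oddFactorial (suc k)) (4 * suc k ∸ 1) (sieveCount (5 * suc k / 3)) (minimalProduct (suc k))
    B = exceeds (suc k) (oddFactorial (suc k)) (term (3 + 3 * suc k) k) (sieveCount (2 * suc k)) (∏ (term (3 + 3 * suc k)) (suc k))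

  module SmoothSmall (l′ m : ℕ) (2∤m : 2 ∤ m) (m≥ : 1 + 2 * suc l′ ≤ m)
                (p≤2l : ∀ i → i < suc l′ → ∀ p → Prime p → p ∣ term m i → p ≤ 2 * suc l′)
                (3p≤N : ∀ i → i < suc l′ → ∀ p → Prime p → p ∣ term m i → 3 * p ≤ term m l′) where
    private
      l : ℕ
      l = suc l′
    open Smooth l′ m 2∤m m≥ p≤2l 3p≤N
    open ≤-Reasoning

    -- The product of the terms over N^c increases with m as long as c ≤ l.
    criterion : ∀ m₀ y c → 1 ≤ m₀ → m₀ ≤ m → (∀ i → i < l → ∀ p → Prime p → p ∣ term m i → p ≤ y) →
                π′ y ≤ c → c ≤ l → ∏ (term m₀) l ≤ oddFactorial l * term m₀ l′ ^ c
    criterion m₀ y c 1≤m₀ m₀≤m smooth π≤c c≤l = *-cancelʳ-≤ _ _ (N ^ l) {{m^n≢0 N l {{>-nonZero 1≤N}}}} (begin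
      ∏ (term m₀) l * N ^ l                  ≤⟨ ∏-term-scale m₀ m l′ m₀≤m ⟩
      ∏ (term m) l * N₀ ^ l                  ≤⟨ *-monoˡ-≤ (N₀ ^ l) (∏-term≤ l m N N 0 y 2∤m 1≤N term≤N smooth (≤-reflexive (sym (*-identityʳ (suc N))))) ⟩
      oddFactorial l * (N ^ s * 1) * N₀ ^ l             ≡⟨ cong (λ x → oddFactorial l * x * N₀ ^ l) (*-identityʳ (N ^ s)) ⟩
      oddFactorial l * N ^ s * N₀ ^ l                   ≤⟨ *-monoˡ-≤ (N₀ ^ l) (*-monoʳ-≤ (oddFactorial l) (^-monoʳ-≤ N {{>-nonZero 1≤N}} (≤-trans (smallCount≤π′y N y) π≤c))) ⟩
      oddFactorial l * N ^ c * N₀ ^ l                   ≡⟨ cong (λ x → oddFactorial l * N ^ c * N₀ ^ x) (m+[n∸m]≡n c≤l) ⟨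
      oddFactorial l * N ^ c * N₀ ^ (c + r)             ≡⟨ cong (oddFactorial l * N ^ c *_) (^-distribˡ-+-* N₀ c r) ⟩
      oddFactorial l * N ^ c * (N₀ ^ c * N₀ ^ r)        ≤⟨ *-monoʳ-≤ (oddFactorial l * N ^ c) (*-monoʳ-≤ (N₀ ^ c) (^-monoˡ-≤ r (+-monoˡ-≤ (2 * l′) m₀≤m))) ⟩
      oddFactorial l * N ^ c * (N₀ ^ c * N ^ r)         ≡⟨ eq (oddFactorial l) (N ^ c) (N₀ ^ c) (N ^ r) ⟩
      oddFactorial l * N₀ ^ c * (N ^ c * N ^ r)         ≡⟨ cong (oddFactorial l * N₀ ^ c *_) (trans (sym (^-distribˡ-+-* N c r)) (cong (N ^_) (m+[n∸m]≡n c≤l))) ⟩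
      oddFactorial l * N₀ ^ c * N ^ l                   ∎)
      where
      N₀ = term m₀ l′
      r = l ∸ c
      s = smallCount N y
      eq : ∀ a b c d → a * b * (c * d) ≡ a * c * (b * d)
      eq = solve-∀

    N₀≡ : 4 * l ∸ 1 ≡ term (1 + 2 * l) l′
    N₀≡ = cong (_∸ 1) (eq l′)
      where
      eq : ∀ l′ → 4 * (1 + l′) ≡ 1 + (1 + 2 * (1 + l′) + 2 * l′)
      eq = solve-∀

    criterion-min : ∀ y → (∀ i → i < l → ∀ p → Prime p → p ∣ term m i → p ≤ y) →
                    T (exceeds l (oddFactorial l) (4 * l ∸ 1) (sieveCount y) (minimalProduct l)) → ⊥
    criterion-min y smooth ok =
      let c≤l , lt = exceeds-sound l (oddFactorial l) (4 * l ∸ 1) (sieveCount y) (minimalProduct l) ok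
      in <⇒≱ (subst (λ N₀ → oddFactorial l * N₀ ^ sieveCount y < minimalProduct l) N₀≡ lt)
             (criterion (1 + 2 * l) y (sieveCount y) (s≤s z≤n) m≥ smooth (π′≤sieveCount y) c≤l)

    small : T (exceeds l (oddFactorial l) (4 * l ∸ 1) (sieveCount (5 * l / 3)) (minimalProduct l)) →
            T (exceeds l (oddFactorial l) (term (3 + 3 * l) l′) (sieveCount (2 * l)) (∏ (term (3 + 3 * l)) l)) → ⊥
    small okA okB with ≤-<-connex N (5 * l)
    ... | inj₁ N≤5l = criterion-min (5 * l / 3) (λ i i<l p pp p∣ → m*3≤⇒ p (≤-trans (3p≤N i i<l p pp p∣) N≤5l)) okA
      where
      m*3≤⇒ : ∀ p → 3 * p ≤ 5 * l → p ≤ 5 * l / 3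
      m*3≤⇒ p h = subst (_≤ 5 * l / 3) (trans (cong (_/ 3) (*-comm 3 p)) (m*n/n≡m p 3)) (/-monoˡ-≤ 3 h)
    ... | inj₂ 5l<N =
      let c≤l , lt = exceeds-sound l (oddFactorial l) (term (3 + 3 * l) l′) (sieveCount (2 * l)) _ okB
      in <⇒≱ lt (criterion (3 + 3 * l) (2 * l) (sieveCount (2 * l)) (s≤s z≤n) m₀≤m p≤2l (π′≤sieveCount (2 * l)) c≤l)
      where
      m₀≤m : 3 + 3 * l ≤ m
      m₀≤m = +-cancelʳ-≤ (2 * l′) _ _ (≤-trans (≤-reflexive (eq l′)) 5l<N)
        where
        eq : ∀ l′ → 3 + 3 * (1 + l′) + 2 * l′ ≡ 1 + 5 * (1 + l′)
        eq = solve-∀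

    absurd : ⊥
    absurd with l <? 60
    ... | yes l<60 = let okA , okB = smallCheck-sound 60 tt l′ (<-trans (n<1+n l′) l<60) in small okA okB
    ... | no l≮60 with l <? 4096
    ...   | no l≮4096 = Large.absurd (≮⇒≥ l≮4096)
    ...   | yes l<4096 = criterion-min (2 * l) p≤2l
      (subst (λ l → T (exceeds l (oddFactorial l) (4 * l ∸ 1) (sieveCount (2 * l)) (minimalProduct l))) (m+[n∸m]≡n (≮⇒≥ l≮60))
        (denseCheck-sound 4036 60 tt (l ∸ 60) (∸-monoˡ-< l<4096 (≮⇒≥ l≮60))))

  -- The bound `p < suc (term m i)` makes the existence statement a finite search; if the search
  -- fails, its negation supplies the hypotheses of `SmoothSmall`.
  oddSylvester : ∀ l m → 1 ≤ l → 2 ∤ m → 1 + 2 * l ≤ m →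
                 ∃[ i ] i < l × ∃[ p ] p < suc (term m i) × Prime p × 2 * l < p × p ∣ term m i
  oddSylvester l@(suc l′) m 1≤l 2∤m m≥ with anyUpTo? (λ i → anyUpTo? (λ p → prime? p ×-dec 2 * l <? p ×-dec p ∣? term m i) (suc (term m i))) l
  ... | yes found = found
  ... | no none = contradiction (SmoothSmall.absurd l′ m 2∤m m≥ p≤2l 3p≤N) λ ()
    where
    odd : ∀ i → 2 ∤ term m i
    odd i 2∣t = 2∤m (∣m+n∣m⇒∣n (subst (2 ∣_) (+-comm m (2 * i)) 2∣t) (m∣m*n i))
    p≤2l : ∀ i → i < l → ∀ p → Prime p → p ∣ term m i → p ≤ 2 * l
    p≤2l i i<l p pp p∣t = ≮⇒≥ λ 2l<p → none (i , i<l , p , s≤s (∣⇒≤ {{>-nonZero (n≢0⇒n>0 λ t≡0 → odd i (subst (2 ∣_) (sym t≡0) (2 ∣0)))}} p∣t) , pp , 2l<p , p∣t)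
    -- The cofactor of `p` in the term is odd, as the term is, and is not 1 because `p ≤ 2 * l < m`;
    -- so it is at least 3.
    3p≤N : ∀ i → i < l → ∀ p → Prime p → p ∣ term m i → 3 * p ≤ term m l′
    3p≤N i i<l p pp p∣t@(divides q t≡qp) = ≤-trans (*-monoˡ-≤ p (3≤q q t≡qp)) (≤-trans (≤-reflexive (sym t≡qp)) (+-monoʳ-≤ m (*-monoʳ-≤ 2 (s≤s⁻¹ i<l))))
      where
      p<t : p < term m i
      p<t = <-≤-trans (s≤s (p≤2l i i<l p pp p∣t)) (≤-trans m≥ (m≤m+n m _))
      3≤q : ∀ q → term m i ≡ q * p → 3 ≤ q
      3≤q 0 t≡ = contradiction (subst (p <_) t≡ p<t) λ ()
      3≤q 1 t≡ = contradiction (subst (p <_) (trans t≡ (+-identityʳ p)) p<t) (n≮n p)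
      3≤q 2 t≡ = contradiction (subst (2 ∣_) (sym t≡) (m∣m*n p)) (odd i)
      3≤q (suc (suc (suc _))) _ = s≤s (s≤s (s≤s z≤n))

  -- Valuations of u and the choice of the prime

  u-suc : ∀ j → u (suc j) ≡ u j * product (filter (λ k → ¬? (2 ∣? k)) (suc j ∷ []))
  u-suc j = trans (cong (λ ks → product (filter (λ k → ¬? (2 ∣? k)) ks)) (sym (upTo-∷ʳ (suc j))))
    (trans (cong product (filter-++ (λ k → ¬? (2 ∣? k)) (upTo (suc j)) (suc j ∷ [])))
      (product-++ (filter (λ k → ¬? (2 ∣? k)) (upTo (suc j))) _))

  u≡oddProduct : ∀ j → u (2 * j) ≡ oddProduct j
  u≡oddProduct zero    = refl
  u≡oddProduct (suc j) = begin
    u (2 * suc j)                   ≡⟨ cong u (*-suc 2 j) ⟩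
    u (2 + 2 * j)                   ≡⟨ u-suc (1 + 2 * j) ⟩
    u (1 + 2 * j) * product (filter odd? (2 + 2 * j ∷ [])) ≡⟨ cong (λ ks → u (1 + 2 * j) * product ks) (filter-reject odd? (λ 2∤ → 2∤ (∣m∣n⇒∣m+n ∣-refl (m∣m*n j)))) ⟩
    u (1 + 2 * j) * 1               ≡⟨ *-identityʳ _ ⟩
    u (1 + 2 * j)                   ≡⟨ u-suc (2 * j) ⟩
    u (2 * j) * product (filter odd? (1 + 2 * j ∷ [])) ≡⟨ cong₂ _*_ (u≡oddProduct j) (trans (cong product (filter-accept odd? (2∤1+2* j))) (*-identityʳ _)) ⟩
    oddProduct j * (1 + 2 * j)      ∎
    where
    open ≡-Reasoning
    odd? = λ k → ¬? (2 ∣? k)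

  -- j′ counts the odd multiples of p below 2 j.
  oddMultiples : ∀ {p} → OddPrime p → ∀ j → ∃[ j′ ] ∃[ w ]
    oddProduct j ≡ p ^ j′ * oddProduct j′ * w × p ∤ w ×
    2 * j′ * p < 2 * j + p × 2 * j ≤ (1 + 2 * j′) * p
  oddMultiples {p} (pp , 2<p) zero = 0 , 1 , refl , (λ p∣1 → contradiction (∣1⇒≡1 p∣1) (>⇒≢ (1<p pp))) , <-trans z<s 2<p , z≤n
  oddMultiples {p} op@(pp , 2<p) (suc j) with oddMultiples op j | p ∣? 1 + 2 * j
  ... | j′ , w , eq , p∤w , lo , hi | no p∤ =
    j′ , w * (1 + 2 * j) , trans (cong (_* (1 + 2 * j)) eq) (*-assoc (p ^ j′ * oddProduct j′) w (1 + 2 * j)) , p∤w* , <-≤-trans lo (+-monoˡ-≤ p (*-monoʳ-≤ 2 (n≤1+n j))) , hi′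
    where
    p∤w* : p ∤ w * (1 + 2 * j)
    p∤w* p∣ with euclidsLemma w (1 + 2 * j) pp p∣
    ... | inj₁ p∣w = p∤w p∣w
    ... | inj₂ p∣t = p∤ p∣t
    odd*odd : ∀ a b → (1 + 2 * a) * (1 + 2 * b) ≡ 1 + 2 * (a + b + 2 * (a * b))
    odd*odd = solve-∀
    even≢odd′ : ∀ a b → 2 * a ≢ 1 + 2 * b
    even≢odd′ a b e = 2∤1+2* b (divides a (trans (sym e) (*-comm 2 a)))
    2j≢ : 2 * j ≢ (1 + 2 * j′) * p
    2j≢ e with halve p
    ... | inj₂ (b , refl) = even≢odd′ j (j′ + b + 2 * (j′ * b)) (trans e (odd*odd j′ b))
    ... | inj₁ (b , refl) = <⇒≢ 2<p (prime∣prime prime[2] pp (m∣m*n b))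
    -- The bound `(1 + 2 * j′) * p` is odd and so differs from `2 * j`; it also differs from
    -- `1 + 2 * j`, which is prime to `p` here. Two units can therefore be gained.
    hi′ : 2 * suc j ≤ (1 + 2 * j′) * p
    hi′ = subst (_≤ (1 + 2 * j′) * p) (sym (*-suc 2 j)) (≤∧≢⇒< (≤∧≢⇒< hi 2j≢) λ e → p∤ (divides (1 + 2 * j′) e))
  ... | j′ , w , eq , p∤w , lo , hi | yes (divides q 1+2j≡qp) with halve q
  ...   | inj₁ (a , refl) = contradiction (divides (a * p) (trans 1+2j≡qp (trans (*-assoc 2 a p) (*-comm 2 (a * p))))) (2∤1+2* j)
  ...   | inj₂ (a , refl) =
    suc j′ , w ,
    (begin
      oddProduct j * (1 + 2 * j)                              ≡⟨ cong₂ _*_ eq (trans 1+2j≡qp (cong (λ a → (1 + 2 * a) * p) a≡j′)) ⟩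
      p ^ j′ * oddProduct j′ * w * ((1 + 2 * j′) * p)         ≡⟨ eq₁ (p ^ j′) (oddProduct j′) w (1 + 2 * j′) p ⟩
      p * p ^ j′ * (oddProduct j′ * (1 + 2 * j′)) * w         ∎) ,
    p∤w ,
    ≤-reflexive (trans (eq₂ j′ p) (trans (cong (λ x → 1 + x + p) (sym 1+2j≡)) (cong (_+ p) (sym (*-suc 2 j))))) ,
    ≤-trans (≤-reflexive (trans (*-suc 2 j) (cong suc 1+2j≡))) (≤-trans (+-monoˡ-≤ _ (<⇒≤ (1<p pp))) (≤-trans (m≤n+m (p + (1 + 2 * j′) * p) p) (≤-reflexive (eq₃ j′ p))))
    where
    open ≡-Reasoning
    eq₁ : ∀ a b c d e → a * b * c * (d * e) ≡ e * a * (b * d) * c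
    eq₁ = solve-∀
    eq₂ : ∀ j p → 1 + 2 * (1 + j) * p ≡ 1 + (1 + 2 * j) * p + p
    eq₂ = solve-∀
    eq₃ : ∀ j p → p + (p + (1 + 2 * j) * p) ≡ (1 + 2 * (1 + j)) * p
    eq₃ = solve-∀
    -- The two inductive bounds leave `(1 + 2 * j′) * p` as the only odd multiple of `p` that
    -- `1 + 2 * j` can be.
    a<1+j′ : a < suc j′
    a<1+j′ = ≰⇒> λ j′<a → <⇒≱
      (≤-trans (≤-reflexive (+-comm 2 X)) (≤-trans (+-monoʳ-≤ X (≤-trans (1<p pp) (m≤m+n p p))) (≤-reflexive (eq₄ j′ p))))
      (≤-trans (*-monoˡ-≤ p (s≤s (*-monoʳ-≤ 2 j′<a))) (≤-trans (≤-reflexive (sym 1+2j≡qp)) (s≤s hi)))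
      where
      X = (1 + 2 * j′) * p
      eq₄ : ∀ j p → (1 + 2 * j) * p + (p + p) ≡ (1 + 2 * (1 + j)) * p
      eq₄ = solve-∀
    j′<1+a : j′ < suc a
    j′<1+a = *-cancelˡ-< 2 j′ (suc a) (*-cancelʳ-< p (2 * j′) (2 * suc a) (<-≤-trans lo (≤-trans (+-monoˡ-≤ p (≤-trans (n≤1+n (2 * j)) (≤-reflexive 1+2j≡qp))) (≤-reflexive (eq₅ a p)))))
      where
      eq₅ : ∀ a p → (1 + 2 * a) * p + p ≡ 2 * (1 + a) * p
      eq₅ = solve-∀
    a≡j′ : a ≡ j′
    a≡j′ = ≤-antisym (s≤s⁻¹ a<1+j′) (s≤s⁻¹ j′<1+a)
    1+2j≡ : 1 + 2 * j ≡ (1 + 2 * j′) * p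
    1+2j≡ = trans 1+2j≡qp (cong (λ a → (1 + 2 * a) * p) a≡j′)

  -- Legendre's recursion: by `oddMultiples` the valuation at `j` is `j′` plus the valuation at
  -- `j′`, and `j′` is about `j / p`. For positive `j` the bound says `p * v < 2 * j`; the truncated
  -- difference lets it include `j = 0`.
  oddProduct-valuation : ∀ {p} → OddPrime p → ∀ j → ∃[ v ] ∃[ w ] oddProduct j ≡ p ^ v * w × p ∤ w × p * v ≤ 2 * j ∸ 1
  oddProduct-valuation {p} op@(pp , 2<p) = <-rec (λ j → ∃[ v ] ∃[ w ] oddProduct j ≡ p ^ v * w × p ∤ w × p * v ≤ 2 * j ∸ 1) step
    where
    step : ∀ j → (∀ {i} → i < j → ∃[ v ] ∃[ w ] oddProduct i ≡ p ^ v * w × p ∤ w × p * v ≤ 2 * i ∸ 1) →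
           ∃[ v ] ∃[ w ] oddProduct j ≡ p ^ v * w × p ∤ w × p * v ≤ 2 * j ∸ 1
    step zero rec = 0 , 1 , refl , (λ p∣1 → contradiction (∣1⇒≡1 p∣1) (>⇒≢ (1<p pp))) , ≤-reflexive (*-zeroʳ p)
    step j@(suc i) rec with oddMultiples op j
    ... | zero , w , eq , p∤w , lo , hi = 0 , w , eq , p∤w , ≤-trans (≤-reflexive (*-zeroʳ p)) z≤n
    ... | j′@(suc x) , w , eq , p∤w , lo , hi with rec {j′} j′<j
      where
      j′<j : j′ < j
      j′<j = ≰⇒> λ j≤j′ → <⇒≱ lo (≤-trans (≤-trans (≤-reflexive (cong (λ p → 2 * j + p) (sym (m+[n∸m]≡n 2<p)))) (≤-trans (m≤m+n _ _) (≤-reflexive (trans (eq₁ i (p ∸ 3)) (cong (2 * j *_) (m+[n∸m]≡n 2<p)))))) (*-monoˡ-≤ p (*-monoʳ-≤ 2 j≤j′)))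
        where
        eq₁ : ∀ i y → 2 * (1 + i) + (3 + y) + (4 * i + 2 * i * y + 1 + y) ≡ 2 * (1 + i) * (3 + y)
        eq₁ = solve-∀
    ...   | v , w′ , eq′ , p∤w′ , pv≤ = j′ + v , w′ * w , valuation , p∤w′w , s≤s⁻¹ bound
      where
      valuation : oddProduct j ≡ p ^ (j′ + v) * (w′ * w)
      valuation = trans eq (trans (cong (λ x → p ^ j′ * x * w) eq′) (trans (eq₂ (p ^ j′) (p ^ v) w′ w) (cong (_* (w′ * w)) (sym (^-distribˡ-+-* p j′ v)))))
        where
        eq₂ : ∀ a b c d → a * (b * c) * d ≡ a * b * (c * d)
        eq₂ = solve-∀
      p∤w′w : p ∤ w′ * w
      p∤w′w p∣ with euclidsLemma w′ w pp p∣
      ... | inj₁ p∣w′ = p∤w′ p∣w′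
      ... | inj₂ p∣w = p∤w p∣w
      bound : p * (j′ + v) < 2 * j
      bound = +-cancelʳ-< p _ _ (≤-<-trans (core v x pv≤) lo)
        where
        -- The claim amounts to `p * v ≤ (j′ - 1) * p`. For `j′ ≥ 2` it follows from
        -- `2 j′ - 1 ≤ 3 (j′ - 1)` and `p ≥ 3`; for `j′ = 1` the hypothesis forces `v = 0`.
        core : ∀ v x → p * v ≤ 2 * suc x ∸ 1 → p * (suc x + v) + p ≤ 2 * suc x * p
        core zero zero pv≤1 = ≤-reflexive (eq₃ p)
          where
          eq₃ : ∀ p → p * 1 + p ≡ 2 * 1 * p
          eq₃ = solve-∀
        core (suc v) zero pv≤1 = contradiction (≤-trans (m≤m*n p (suc v)) pv≤1) (<⇒≱ (1<p pp))
        core v (suc x) pv≤ = ≤-trans (≤-reflexive (eq₄ p (2 + x) v)) (≤-trans (+-monoʳ-≤ _ (≤-trans pv≤ (≤-reflexive (cong (_∸ 1) (eq₅ x)))))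
          (subst (λ p → p * (2 + x) + p + (3 + 2 * x) ≤ 2 * (2 + x) * p) (m+[n∸m]≡n 2<p) (≤-trans (m≤m+n _ _) (≤-reflexive (eq₆ x (p ∸ 3))))))
          where
          eq₄ : ∀ p a v → p * (a + v) + p ≡ p * a + p + p * v
          eq₄ = solve-∀
          eq₅ : ∀ x → 2 * (2 + x) ≡ 1 + (3 + 2 * x)
          eq₅ = solve-∀
          eq₆ : ∀ x y → (3 + y) * (2 + x) + (3 + y) + (3 + 2 * x) + (x * y + x + y) ≡ 2 * (2 + x) * (3 + y)
          eq₆ = solve-∀

  -- Sylvester's theorem is applied to the last `l` odd numbers below `2 * n`, where `l` is half of
  -- `k = 2 * n ∸ J`, rounded down. From `n ≤ J` comes `2 * l ≤ n`, so the first of them exceeds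
  -- `2 * l`; and `p > 2 * l` gives `p ≥ k`, whatever the parity of `k`.
  primeNearTop : ∀ n J → 2 ≤ n → n ≤ J → J < 2 * n →
    ∃[ p ] ∃[ τ ] OddPrime p × 2 * n ≤ p + J × J ≤ 1 + 2 * τ × τ < n × p ∣ 1 + 2 * τ
  primeNearTop n@(suc n-1) J 2≤n n≤J J<2n = main ⌊ k /2⌋ 2l≤k k≤1+2l
    where
    k = 2 * n ∸ J
    k+J≡2n : k + J ≡ 2 * n
    k+J≡2n = m∸n+n≡m (<⇒≤ J<2n)
    k≡ : k ≡ 2 * ⌊ k /2⌋ ⊎ k ≡ 1 + 2 * ⌊ k /2⌋
    k≡ with halve k
    ... | inj₁ (l , k≡) = inj₁ (trans k≡ (cong (2 *_) (sym (trans (cong ⌊_/2⌋ (trans k≡ (*-comm 2 l))) (⌊n*2/2⌋ l)))))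
      where
      ⌊n*2/2⌋ : ∀ l → ⌊ l * 2 /2⌋ ≡ l
      ⌊n*2/2⌋ zero = refl
      ⌊n*2/2⌋ (suc l) = cong suc (⌊n*2/2⌋ l)
    ... | inj₂ (l , k≡) = inj₂ (trans k≡ (cong (λ l → 1 + 2 * l) (sym (trans (cong ⌊_/2⌋ (trans k≡ (cong suc (*-comm 2 l)))) (⌊1+n*2/2⌋ l)))))
      where
      ⌊1+n*2/2⌋ : ∀ l → ⌊ 1 + l * 2 /2⌋ ≡ l
      ⌊1+n*2/2⌋ zero = refl
      ⌊1+n*2/2⌋ (suc l) = cong suc (⌊1+n*2/2⌋ l)
    2l≤k : 2 * ⌊ k /2⌋ ≤ k
    2l≤k = [ (λ e → ≤-reflexive (sym e)) , (λ e → ≤-trans (n≤1+n _) (≤-reflexive (sym e))) ]′ k≡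
    k≤1+2l : k ≤ 1 + 2 * ⌊ k /2⌋
    k≤1+2l = [ (λ e → ≤-trans (≤-reflexive e) (n≤1+n _)) , ≤-reflexive ]′ k≡
    oddPrime : ∀ p τ → Prime p → p ∣ 1 + 2 * τ → OddPrime p
    oddPrime p τ pp p∣ = pp , ≤∧≢⇒< (1<p pp) λ { refl → 2∤1+2* τ p∣ }
    near : ∀ p → k ≤ p → 2 * n ≤ p + J
    near p k≤p = ≤-trans (≤-reflexive (sym k+J≡2n)) (+-monoˡ-≤ J k≤p)
    main : ∀ l → 2 * l ≤ k → k ≤ 1 + 2 * l →
      ∃[ p ] ∃[ τ ] OddPrime p × 2 * n ≤ p + J × J ≤ 1 + 2 * τ × τ < n × p ∣ 1 + 2 * τ
    -- Now `k ≤ 1`, so any prime factor of `2 n - 1` is large enough; one exists because `2 ≤ n`.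
    main zero _ k≤1 = let p , pp , p∣ = primeFactor (1 + 2 * n-1) (s≤s (≤-trans (s≤s⁻¹ 2≤n) (m≤m+n n-1 _))) in
      p , n-1 , oddPrime p n-1 pp p∣ , near p (≤-trans k≤1 (<⇒≤ (1<p pp))) ,
      s≤s⁻¹ (≤-trans J<2n (≤-trans (≤-reflexive (*-suc 2 n-1)) ≤-refl)) , ≤-refl , p∣
    main l@(suc _) 2l≤k k≤1+2l = let i , i<l , p , _ , pp , 2l<p , p∣t = oddSylvester l (1 + 2 * r) (s≤s z≤n) (2∤1+2* r) (s≤s (*-monoʳ-≤ 2 l≤r)) in
      p , r + i , oddPrime p (r + i) pp (subst (p ∣_) (t≡ i) p∣t) , near p (≤-trans k≤1+2l 2l<p) ,
      ≤-trans J≤ (s≤s (*-monoʳ-≤ 2 (m≤m+n r i))) , <-≤-trans (+-monoʳ-< r i<l) (≤-reflexive r+l≡n) , subst (p ∣_) (t≡ i) p∣t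
      where
      2l≤n : 2 * l ≤ n
      2l≤n = ≤-trans 2l≤k (+-cancelʳ-≤ J _ _ (≤-trans (≤-reflexive (trans k+J≡2n (cong (n +_) (+-identityʳ n)))) (+-monoʳ-≤ n n≤J)))
      l≤n : l ≤ n
      l≤n = ≤-trans (m≤m+n l _) 2l≤n
      r = n ∸ l
      r+l≡n : r + l ≡ n
      r+l≡n = m∸n+n≡m l≤n
      l≤r : l ≤ r
      l≤r = +-cancelʳ-≤ l l r (≤-trans (≤-trans (≤-reflexive (cong (l +_) (sym (+-identityʳ l)))) 2l≤n) (≤-reflexive (sym r+l≡n)))
      t≡ : ∀ i → term (1 + 2 * r) i ≡ 1 + 2 * (r + i)
      t≡ i = cong suc (sym (*-distribˡ-+ 2 r i))
      J≤ : J ≤ 1 + 2 * r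
      J≤ = ≤-trans (+-cancelˡ-≤ (2 * l) J (2 * r) (begin
        2 * l + J       ≤⟨ +-monoˡ-≤ J 2l≤k ⟩
        k + J           ≡⟨ k+J≡2n ⟩
        2 * n           ≡⟨ cong (2 *_) (trans (sym r+l≡n) (+-comm r l)) ⟩
        2 * (l + r)     ≡⟨ *-distribˡ-+ 2 l r ⟩
        2 * l + 2 * r   ∎)) (n≤1+n _)
        where open ≤-Reasoning

-- The commutative ring of polynomials over a commutative ring

open import Defs using (module Polynomial)
open import Algebra.Bundles using (CommutativeRing; Semiring)
open import Data.List.Base using (List; []; _∷_; map)
open import Data.Nat.Base as ℕ using (ℕ; zero; suc)
open import Data.Product.Base using (_,_)
open import Level using (Level)
open import Relation.Binary.PropositionalEquality.Core as ≡ using (_≡_)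
import Relation.Binary.Reasoning.Setoid as SetoidReasoning

module PolynomialRing {c ℓ : Level} (R : CommutativeRing c ℓ) where

  open CommutativeRing R
  open Polynomial (Semiring.rawSemiring semiring) public
  open import Algebra.Solver.Ring.NaturalCoefficients.Default commutativeSemiring using (solve; _:+_; _:*_; _:=_)
  open SetoidReasoning setoid
  open import Algebra.Properties.Ring ring using (-0#≈0#)

  coeff-+ : ∀ f g i → coeff (f +ₚ g) i ≈ coeff f i + coeff g i
  coeff-+ []      g       i       = sym (+-identityˡ _)
  coeff-+ (a ∷ f) []      i       = sym (+-identityʳ _)
  coeff-+ (a ∷ f) (b ∷ g) zero    = refl
  coeff-+ (a ∷ f) (b ∷ g) (suc i) = coeff-+ f g i

  coeff-· : ∀ a f i → coeff (a · f) i ≈ a * coeff f i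
  coeff-· a []      i       = sym (zeroʳ a)
  coeff-· a (b ∷ f) zero    = refl
  coeff-· a (b ∷ f) (suc i) = coeff-· a f i

  -- Unlike _≈ₚ_ itself, the wrapper determines the two polynomials.
  infix 4 _≋_
  record _≋_ (f g : Poly) : Set ℓ where
    constructor mk
    field at : f ≈ₚ g
  open _≋_ public

  ≋-refl : ∀ {f} → f ≋ f
  ≋-refl .at i = refl

  ≋-sym : ∀ {f g} → f ≋ g → g ≋ f
  ≋-sym f≈g .at i = sym (at f≈g i)

  ≋-trans : ∀ {f g h} → f ≋ g → g ≋ h → f ≋ h
  ≋-trans f≈g g≈h .at i = trans (at f≈g i) (at g≈h i)

  +ₚ-cong : ∀ {f f′ g g′} → f ≋ f′ → g ≋ g′ → f +ₚ g ≋ f′ +ₚ g′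
  +ₚ-cong {f} {f′} {g} {g′} f≈ g≈ .at i = trans (coeff-+ f g i) (trans (+-cong (at f≈ i) (at g≈ i)) (sym (coeff-+ f′ g′ i)))

  ·-cong : ∀ {a b f g} → a ≈ b → f ≋ g → a · f ≋ b · g
  ·-cong {a} {b} {f} {g} a≈ f≈ .at i = trans (coeff-· a f i) (trans (*-cong a≈ (at f≈ i)) (sym (coeff-· b g i)))

  ∷-cong : ∀ {a b f g} → a ≈ b → f ≋ g → (a ∷ f) ≋ (b ∷ g)
  ∷-cong a≈b f≈g .at zero    = a≈b
  ∷-cong a≈b f≈g .at (suc i) = at f≈g i

  0∷[]≈[] : ∀ {f} → f ≋ [] → (0# ∷ f) ≋ []
  0∷[]≈[] f≈ .at zero    = refl
  0∷[]≈[] f≈ .at (suc i) = at f≈ i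

  +ₚ-assoc : ∀ f g h → (f +ₚ g) +ₚ h ≋ f +ₚ (g +ₚ h)
  +ₚ-assoc f g h .at i = begin
    coeff ((f +ₚ g) +ₚ h) i                 ≈⟨ coeff-+ (f +ₚ g) h i ⟩
    coeff (f +ₚ g) i + coeff h i            ≈⟨ +-congʳ (coeff-+ f g i) ⟩
    (coeff f i + coeff g i) + coeff h i     ≈⟨ +-assoc _ _ _ ⟩
    coeff f i + (coeff g i + coeff h i)     ≈⟨ +-congˡ (coeff-+ g h i) ⟨
    coeff f i + coeff (g +ₚ h) i            ≈⟨ coeff-+ f (g +ₚ h) i ⟨
    coeff (f +ₚ (g +ₚ h)) i                 ∎

  +ₚ-comm : ∀ f g → f +ₚ g ≋ g +ₚ f
  +ₚ-comm f g .at i = trans (coeff-+ f g i) (trans (+-comm _ _) (sym (coeff-+ g f i)))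

  -ₚ_ : Poly → Poly
  -ₚ f = map -_ f

  coeff-neg : ∀ f i → coeff (-ₚ f) i ≈ - coeff f i
  coeff-neg []      i       = sym -0#≈0#
  coeff-neg (a ∷ f) zero    = refl
  coeff-neg (a ∷ f) (suc i) = coeff-neg f i

  -ₚ-inverseˡ : ∀ f → (-ₚ f) +ₚ f ≋ []
  -ₚ-inverseˡ f .at i = trans (coeff-+ (-ₚ f) f i) (trans (+-congʳ (coeff-neg f i)) (-‿inverseˡ _))

  -ₚ-cong : ∀ {f g} → f ≋ g → -ₚ f ≋ -ₚ g
  -ₚ-cong {f} {g} f≈g .at i = trans (coeff-neg f i) (trans (-‿cong (at f≈g i)) (sym (coeff-neg g i)))

  +ₚ-identityʳ : ∀ f → f +ₚ [] ≋ f
  +ₚ-identityʳ f .at i = trans (coeff-+ f [] i) (+-identityʳ _)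

  *ₚ-zeroʳ : ∀ f → f *ₚ [] ≋ []
  *ₚ-zeroʳ []      = ≋-refl
  *ₚ-zeroʳ (a ∷ f) = 0∷[]≈[] (*ₚ-zeroʳ f)

  -- Multiplication is defined by recursion on the left factor; this is the matching recursion on
  -- the right factor, from which commutativity follows.
  *ₚ-∷ : ∀ f b g → f *ₚ (b ∷ g) ≋ (b · f) +ₚ (0# ∷ (f *ₚ g))
  *ₚ-∷ []      b g       = ≋-sym (0∷[]≈[] ≋-refl)
  *ₚ-∷ (a ∷ f) b g .at zero  = +-congʳ (*-comm a b)
  *ₚ-∷ (a ∷ f) b g .at (suc i) = begin
    coeff ((a · g) +ₚ (f *ₚ (b ∷ g))) i                    ≈⟨ coeff-+ (a · g) _ i ⟩
    coeff (a · g) i + coeff (f *ₚ (b ∷ g)) i               ≈⟨ +-congˡ (at (*ₚ-∷ f b g) i) ⟩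
    coeff (a · g) i + coeff ((b · f) +ₚ (0# ∷ (f *ₚ g))) i ≈⟨ +-congˡ (coeff-+ (b · f) _ i) ⟩
    coeff (a · g) i + (coeff (b · f) i + coeff (0# ∷ (f *ₚ g)) i) ≈⟨ solve 3 (λ x y z → x :+ (y :+ z) := y :+ (x :+ z)) refl _ _ _ ⟩
    coeff (b · f) i + (coeff (a · g) i + coeff (0# ∷ (f *ₚ g)) i) ≈⟨ +-congˡ (coeff-+ (a · g) _ i) ⟨
    coeff (b · f) i + coeff ((a · g) +ₚ (0# ∷ (f *ₚ g))) i ≈⟨ coeff-+ (b · f) _ i ⟨
    coeff ((b · f) +ₚ ((a · g) +ₚ (0# ∷ (f *ₚ g)))) i      ∎

  *ₚ-comm : ∀ f g → f *ₚ g ≋ g *ₚ f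
  *ₚ-comm []      g = ≋-sym (*ₚ-zeroʳ g)
  *ₚ-comm (a ∷ f) g = ≋-trans (+ₚ-cong {a · g} ≋-refl (∷-cong refl (*ₚ-comm f g))) (≋-sym (*ₚ-∷ g a f))

  *ₚ-congˡ : ∀ f {g g′} → g ≋ g′ → f *ₚ g ≋ f *ₚ g′
  *ₚ-congˡ []      g≈ = ≋-refl
  *ₚ-congˡ (a ∷ f) g≈ = +ₚ-cong (·-cong refl g≈) (∷-cong refl (*ₚ-congˡ f g≈))

  *ₚ-cong : ∀ {f f′ g g′} → f ≋ f′ → g ≋ g′ → f *ₚ g ≋ f′ *ₚ g′
  *ₚ-cong {f} {f′} {g} {g′} f≈ g≈ =
    ≋-trans (*ₚ-congˡ f g≈) (≋-trans (*ₚ-comm f g′) (≋-trans (*ₚ-congˡ g′ f≈) (*ₚ-comm g′ f′)))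

  *ₚ-distribʳ : ∀ h f g → (f +ₚ g) *ₚ h ≋ (f *ₚ h) +ₚ (g *ₚ h)
  *ₚ-distribʳ h []      g       = ≋-refl
  *ₚ-distribʳ h (a ∷ f) []      = ≋-sym (+ₚ-identityʳ ((a ∷ f) *ₚ h))
  *ₚ-distribʳ h (a ∷ f) (b ∷ g) .at i = begin
    coeff (((a + b) · h) +ₚ (0# ∷ ((f +ₚ g) *ₚ h))) i                    ≈⟨ coeff-+ ((a + b) · h) _ i ⟩
    coeff ((a + b) · h) i + coeff (0# ∷ ((f +ₚ g) *ₚ h)) i               ≈⟨ +-cong (coeff-· (a + b) h i) (tail i) ⟩
    (a + b) * coeff h i + (coeff (0# ∷ (f *ₚ h)) i + coeff (0# ∷ (g *ₚ h)) i) ≈⟨ solve 5 (λ a b x y z → (a :+ b) :* x :+ (y :+ z) := (a :* x :+ y) :+ (b :* x :+ z)) refl a b (coeff h i) _ _ ⟩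
    (a * coeff h i + coeff (0# ∷ (f *ₚ h)) i) + (b * coeff h i + coeff (0# ∷ (g *ₚ h)) i) ≈⟨ +-cong (+-congʳ (coeff-· a h i)) (+-congʳ (coeff-· b h i)) ⟨
    (coeff (a · h) i + coeff (0# ∷ (f *ₚ h)) i) + (coeff (b · h) i + coeff (0# ∷ (g *ₚ h)) i) ≈⟨ +-cong (coeff-+ (a · h) _ i) (coeff-+ (b · h) _ i) ⟨
    coeff ((a ∷ f) *ₚ h) i + coeff ((b ∷ g) *ₚ h) i                       ≈⟨ coeff-+ ((a ∷ f) *ₚ h) _ i ⟨
    coeff (((a ∷ f) *ₚ h) +ₚ ((b ∷ g) *ₚ h)) i                            ∎
    where
    tail : ∀ i → coeff (0# ∷ ((f +ₚ g) *ₚ h)) i ≈ coeff (0# ∷ (f *ₚ h)) i + coeff (0# ∷ (g *ₚ h)) i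
    tail zero    = sym (+-identityˡ 0#)
    tail (suc i) = trans (at (*ₚ-distribʳ h f g) i) (coeff-+ (f *ₚ h) (g *ₚ h) i)

  ·-*ₚ : ∀ a f g → (a · f) *ₚ g ≋ a · (f *ₚ g)
  ·-*ₚ a []      g = ≋-refl
  ·-*ₚ a (b ∷ f) g .at i = begin
    coeff (((a * b) · g) +ₚ (0# ∷ ((a · f) *ₚ g))) i          ≈⟨ coeff-+ ((a * b) · g) _ i ⟩
    coeff ((a * b) · g) i + coeff (0# ∷ ((a · f) *ₚ g)) i     ≈⟨ +-cong (coeff-· (a * b) g i) (tail i) ⟩
    a * b * coeff g i + a * coeff (0# ∷ (f *ₚ g)) i           ≈⟨ solve 4 (λ a b x y → a :* b :* x :+ a :* y := a :* (b :* x :+ y)) refl a b (coeff g i) _ ⟩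
    a * (b * coeff g i + coeff (0# ∷ (f *ₚ g)) i)             ≈⟨ *-congˡ (+-congʳ (coeff-· b g i)) ⟨
    a * (coeff (b · g) i + coeff (0# ∷ (f *ₚ g)) i)           ≈⟨ *-congˡ (coeff-+ (b · g) _ i) ⟨
    a * coeff ((b ∷ f) *ₚ g) i                                ≈⟨ coeff-· a ((b ∷ f) *ₚ g) i ⟨
    coeff (a · ((b ∷ f) *ₚ g)) i                              ∎
    where
    tail : ∀ i → coeff (0# ∷ ((a · f) *ₚ g)) i ≈ a * coeff (0# ∷ (f *ₚ g)) i
    tail zero    = sym (zeroʳ a)
    tail (suc i) = trans (at (·-*ₚ a f g) i) (coeff-· a (f *ₚ g) i)

  ·-assoc : ∀ a b f → (a * b) · f ≋ a · (b · f)
  ·-assoc a b f .at i = trans (coeff-· (a * b) f i) (trans (*-assoc a b _) (trans (*-congˡ (sym (coeff-· b f i))) (sym (coeff-· a (b · f) i))))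

  ·-distribˡ : ∀ a f g → a · (f +ₚ g) ≋ a · f +ₚ a · g
  ·-distribˡ a f g .at i = begin
    coeff (a · (f +ₚ g)) i                ≈⟨ coeff-· a (f +ₚ g) i ⟩
    a * coeff (f +ₚ g) i                  ≈⟨ *-congˡ (coeff-+ f g i) ⟩
    a * (coeff f i + coeff g i)           ≈⟨ distribˡ a _ _ ⟩
    a * coeff f i + a * coeff g i         ≈⟨ +-cong (coeff-· a f i) (coeff-· a g i) ⟨
    coeff (a · f) i + coeff (a · g) i     ≈⟨ coeff-+ (a · f) (a · g) i ⟨
    coeff (a · f +ₚ a · g) i              ∎

  *ₚ-· : ∀ f a g → f *ₚ (a · g) ≋ a · (f *ₚ g)
  *ₚ-· f a g = ≋-trans (*ₚ-comm f (a · g)) (≋-trans (·-*ₚ a g f) (·-cong refl (*ₚ-comm g f)))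

  0·≈[] : ∀ f → 0# · f ≋ []
  0·≈[] f .at i = trans (coeff-· 0# f i) (zeroˡ _)

  0∷-*ₚ : ∀ f g → (0# ∷ f) *ₚ g ≋ (0# ∷ (f *ₚ g))
  0∷-*ₚ f g = ≋-trans (+ₚ-cong (0·≈[] g) ≋-refl) ≋-refl

  const-* : ∀ a f → (a ∷ []) *ₚ f ≋ a · f
  const-* a f = ≋-trans (+ₚ-cong {a · f} ≋-refl (0∷[]≈[] ≋-refl)) (+ₚ-identityʳ (a · f))

  *ₚ-assoc : ∀ f g h → (f *ₚ g) *ₚ h ≋ f *ₚ (g *ₚ h)
  *ₚ-assoc []      g h = ≋-refl
  *ₚ-assoc (a ∷ f) g h = ≋-trans (*ₚ-distribʳ h (a · g) (0# ∷ (f *ₚ g)))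
    (+ₚ-cong (·-*ₚ a g h) (≋-trans (0∷-*ₚ (f *ₚ g) h) (∷-cong refl (*ₚ-assoc f g h))))

  *ₚ-identityˡ : ∀ f → (1# ∷ []) *ₚ f ≋ f
  *ₚ-identityˡ f = ≋-trans (+ₚ-cong {1# · f} {f} (mk λ i → trans (coeff-· 1# f i) (*-identityˡ _)) (0∷[]≈[] ≋-refl)) (+ₚ-identityʳ f)

  polyCommutativeRing : CommutativeRing c ℓ
  polyCommutativeRing = record
    { Carrier = Poly
    ; _≈_ = _≋_
    ; _+_ = _+ₚ_
    ; _*_ = _*ₚ_
    ; -_ = -ₚ_
    ; 0# = []
    ; 1# = 1# ∷ []
    ; isCommutativeRing = record
      { isRing = record
        { +-isAbelianGroup = record
          { isGroup = record
            { isMonoid = record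
              { isSemigroup = record
                { isMagma = record
                  { isEquivalence = record { refl = ≋-refl ; sym = ≋-sym ; trans = ≋-trans }
                  ; ∙-cong = +ₚ-cong
                  }
                ; assoc = +ₚ-assoc
                }
              ; identity = (λ f → ≋-refl) , +ₚ-identityʳ
              }
            ; inverse = -ₚ-inverseˡ , (λ f → ≋-trans (+ₚ-comm f (-ₚ f)) (-ₚ-inverseˡ f))
            ; ⁻¹-cong = -ₚ-cong
            }
          ; comm = +ₚ-comm
          }
        ; *-cong = *ₚ-cong
        ; *-assoc = *ₚ-assoc
        ; *-identity = *ₚ-identityˡ , (λ f → ≋-trans (*ₚ-comm f (1# ∷ [])) (*ₚ-identityˡ f))
        ; distrib = (λ f g h → ≋-trans (*ₚ-comm f (g +ₚ h)) (≋-trans (*ₚ-distribʳ f g h) (+ₚ-cong (*ₚ-comm g f) (*ₚ-comm h f)))) , *ₚ-distribʳ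
        }
      ; *-comm = *ₚ-comm
      }
    }

-- Weighted valuations attached to a prime and a key polynomial

module NewtonPolygon where

  open import Algebra.Bundles using (CommutativeRing)
  open import Data.List.Base using (List; []; _∷_)
  open import Data.Nat.Base as ℕ using (ℕ; zero; suc; _≤_; _<_; z≤n)
  import Data.Nat.Properties as ℕ
  open import Data.Nat.Tactic.RingSolver using (solve-∀)
  open import Data.Product.Base using (∃; ∃₂; _×_; _,_; proj₁; proj₂)
  open import Data.Sum.Base using (_⊎_; inj₁; inj₂; [_,_]′)
  open import Level using (Level; _⊔_)
  open import Relation.Binary.PropositionalEquality.Core as ≡ using (_≡_)
  import Relation.Binary.Reasoning.Setoid as SetoidReasoning
  open import Relation.Nullary using (¬_; contradiction)

  module Newton {c ℓ : Level} (R : CommutativeRing c ℓ) (π φ : CommutativeRing.Carrier R) where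

    open CommutativeRing R
    open import Algebra.Properties.Semiring.Exp semiring public using (_^_; ^-homo-*)
    open import Algebra.Properties.Ring ring using (-1*x≈-x)
    open import Algebra.Solver.Ring.NaturalCoefficients.Default commutativeSemiring using (solve; _:+_; _:*_; _:=_)
    open SetoidReasoning setoid

    -- The ideal generated by `π` and `φ`. In the application `π` is `p`, and the quotient by `I` is
    -- the residue field of `(ℤ/pℤ)[x]` at `φ`.
    I : Carrier → Set (c ⊔ ℓ)
    I x = ∃₂ λ Y X → x ≈ π * Y + φ * X

    -- Subtraction is written as multiplication by this element, so that differences remain
    -- expressions of a commutative semiring.
    minus1 : Carrier
    minus1 = - 1#

    add-sub : ∀ x y → x + y + minus1 * y ≈ x
    add-sub x y = begin
      x + y + minus1 * y   ≈⟨ +-assoc x y (minus1 * y) ⟩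
      x + (y + minus1 * y) ≈⟨ +-congˡ (+-congˡ (-1*x≈-x y)) ⟩
      x + (y + - y)   ≈⟨ +-congˡ (-‿inverseʳ y) ⟩
      x + 0#          ≈⟨ +-identityʳ x ⟩
      x               ∎

    sub : ∀ {x y z} → x ≈ y + z → x + minus1 * z ≈ y
    sub {x} {y} {z} x≈ = trans (+-congʳ x≈) (add-sub y z)

    minus1-involutive : ∀ x → minus1 * (minus1 * x) ≈ x
    minus1-involutive x = begin
      minus1 * (minus1 * x)             ≈⟨ +-identityˡ _ ⟨
      0# + minus1 * (minus1 * x)        ≈⟨ +-congʳ (trans (+-congˡ (-1*x≈-x x)) (-‿inverseʳ x)) ⟨
      x + minus1 * x + minus1 * (minus1 * x) ≈⟨ add-sub x (minus1 * x) ⟩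
      x                       ∎

    I-resp : ∀ {x y} → x ≈ y → I x → I y
    I-resp x≈y (Y , X , x≈) = Y , X , trans (sym x≈y) x≈

    I-+ : ∀ {x y} → I x → I y → I (x + y)
    I-+ (Y , X , x≈) (Y′ , X′ , y≈) = Y + Y′ , X + X′ ,
      trans (+-cong x≈ y≈) (solve 6 (λ p f a b c d → p :* a :+ f :* b :+ (p :* c :+ f :* d) := p :* (a :+ c) :+ f :* (b :+ d)) refl π φ Y X Y′ X′)

    I-* : ∀ r {x} → I x → I (r * x)
    I-* r (Y , X , x≈) = r * Y , r * X , trans (*-congˡ x≈) (solve 5 (λ p f a b r → r :* (p :* a :+ f :* b) := p :* (r :* a) :+ f :* (r :* b)) refl π φ Y X r)

    I-π : ∀ x → I (π * x)
    I-π x = x , 0# , sym (trans (+-congˡ (zeroʳ φ)) (+-identityʳ _))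

    I-φ : ∀ x → I (φ * x)
    I-φ x = 0# , x , sym (trans (+-congʳ (zeroʳ π)) (+-identityˡ _))

    -- Invertibility modulo `I`, in contrast to `UnitMod`, which is invertibility modulo `π` alone.
    Invertible : Carrier → Set (c ⊔ ℓ)
    Invertible γ = ∃₂ λ μ e → I e × γ * μ ≈ 1# + e

    UnitMod : Carrier → Set (c ⊔ ℓ)
    UnitMod x = ∃₂ λ μ w → μ * x ≈ 1# + π * w

    invertible : ∀ {γ} ν i e → I i → I e → γ * ν + i ≈ 1# + e → Invertible γ
    invertible {γ} ν i e i∈I e∈I h = ν , e + minus1 * i , I-+ e∈I (I-* minus1 i∈I) , (begin
      γ * ν                   ≈⟨ add-sub (γ * ν) i ⟨
      γ * ν + i + minus1 * i       ≈⟨ +-congʳ h ⟩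
      1# + e + minus1 * i          ≈⟨ +-assoc 1# e (minus1 * i) ⟩
      1# + (e + minus1 * i)        ∎)

    invertible-factor : ∀ {γ M} C i → I i → M ≈ C * γ + i → Invertible M → Invertible γ
    invertible-factor {γ} {M} C i i∈I M≈ (μ , e , e∈I , Mμ≈) = invertible (C * μ) (μ * i) e (I-* μ i∈I) e∈I (begin
      γ * (C * μ) + μ * i     ≈⟨ solve 4 (λ g c u i → g :* (c :* u) :+ u :* i := (c :* g :+ i) :* u) refl γ C μ i ⟩
      (C * γ + i) * μ         ≈⟨ *-congʳ M≈ ⟨
      M * μ                   ≈⟨ Mμ≈ ⟩
      1# + e                  ∎)

    invertible-shift : ∀ {γ γ′} i → I i → γ ≈ γ′ + i → Invertible γ′ → Invertible γ
    invertible-shift {γ} {γ′} i i∈I γ≈ (μ , e , e∈I , γ′μ≈) = μ , e + μ * i , I-+ e∈I (I-* μ i∈I) , (begin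
      γ * μ                   ≈⟨ *-congʳ γ≈ ⟩
      (γ′ + i) * μ            ≈⟨ solve 3 (λ g i u → (g :+ i) :* u := g :* u :+ u :* i) refl γ′ i μ ⟩
      γ′ * μ + μ * i          ≈⟨ +-congʳ γ′μ≈ ⟩
      1# + e + μ * i          ≈⟨ +-assoc 1# e (μ * i) ⟩
      1# + (e + μ * i)        ∎)

    unitMod⇒invertible : ∀ {x} → UnitMod x → Invertible x
    unitMod⇒invertible {x} (μ , w , μx≈) = μ , π * w , I-π w , trans (*-comm x μ) μx≈

    -- Modulo `I` the division reads `- q * M = r`, so an inverse of `r` yields one of `M`.
    invertible-remainder : ∀ {q M r} → φ ≈ q * M + r → Invertible r → Invertible M
    invertible-remainder {q} {M} {r} φ≈ (μ , e , e∈I , rμ≈) = invertible (minus1 * (q * μ)) (φ * μ) e (I-φ μ) e∈I (begin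
      M * (minus1 * (q * μ)) + φ * μ   ≈⟨ solve 5 (λ M n q u f → M :* (n :* (q :* u)) :+ f :* u := f :* u :+ n :* (M :* (q :* u))) refl M minus1 q μ φ ⟩
      φ * μ + minus1 * (M * (q * μ))   ≈⟨ sub (begin
        φ * μ                       ≈⟨ *-congʳ φ≈ ⟩
        (q * M + r) * μ             ≈⟨ solve 4 (λ q M r u → (q :* M :+ r) :* u := r :* u :+ M :* (q :* u)) refl q M r μ ⟩
        r * μ + M * (q * μ)         ≈⟨ +-congʳ rμ≈ ⟩
        1# + e + M * (q * μ)        ∎) ⟩
      1# + e                      ∎)

    unitMod-cofactor : ∀ {q M r} → φ ≈ q * M + r → I r → UnitMod q → I M
    unitMod-cofactor {q} {M} {r} φ≈ r∈I (μ , v , μq≈) =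
      I-resp (sub (begin
        φ * μ                             ≈⟨ *-congʳ φ≈ ⟩
        (q * M + r) * μ                   ≈⟨ solve 4 (λ q M r u → (q :* M :+ r) :* u := u :* q :* M :+ u :* r) refl q M r μ ⟩
        μ * q * M + μ * r                 ≈⟨ +-congʳ (*-congʳ μq≈) ⟩
        (1# + π * v) * M + μ * r          ≈⟨ solve 5 (λ o p v M r → (o :+ p :* v) :* M :+ r := o :* M :+ (p :* (v :* M) :+ r)) refl 1# π v M (μ * r) ⟩
        1# * M + (π * (v * M) + μ * r)    ≈⟨ +-congʳ (*-identityˡ M) ⟩
        M + (π * (v * M) + μ * r)         ∎))
        (I-+ (I-φ μ) (I-* minus1 (I-+ (I-π (v * M)) (I-* μ r∈I))))

    invertible-cancel : ∀ {γ η} → Invertible γ → I (γ * η) → I η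
    invertible-cancel {γ} {η} (μ , e , e∈I , γμ≈) γη∈I = I-resp (sub (begin
      μ * (γ * η)             ≈⟨ solve 3 (λ u g h → u :* (g :* h) := g :* u :* h) refl μ γ η ⟩
      γ * μ * η               ≈⟨ *-congʳ γμ≈ ⟩
      (1# + e) * η            ≈⟨ solve 3 (λ o e h → (o :+ e) :* h := o :* h :+ h :* e) refl 1# e η ⟩
      1# * η + η * e          ≈⟨ +-congʳ (*-identityˡ η) ⟩
      η + η * e               ∎)) (I-+ (I-* μ γη∈I) (I-* minus1 (I-* η e∈I)))

    I-cofactor : ∀ {γ Y X} → γ ≈ π * Y + φ * X → X * φ + minus1 * γ ≈ π * (minus1 * Y)
    I-cofactor {γ} {Y} {X} γ≈ = begin
      X * φ + minus1 * γ               ≈⟨ +-cong (*-comm X φ) (*-congˡ γ≈) ⟩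
      φ * X + minus1 * (π * Y + φ * X) ≈⟨ solve 5 (λ p f y x n → f :* x :+ n :* (p :* y :+ f :* x) := p :* (n :* y) :+ f :* x :+ n :* (f :* x)) refl π φ Y X minus1 ⟩
      π * (minus1 * Y) + φ * X + minus1 * (φ * X) ≈⟨ add-sub (π * (minus1 * Y)) (φ * X) ⟩
      π * (minus1 * Y)                 ∎

    modφ-product : ∀ {F g g′ h h′ r X} → F ≈ (g + φ * g′) * (h + φ * h′) → F ≈ r + φ * X →
                   ∃ λ Z → Z * φ + r ≈ g * h
    modφ-product {F} {g} {g′} {h} {h′} {r} {X} F≈gh F≈r = X + minus1 * Y , (begin
      (X + minus1 * Y) * φ + r       ≈⟨ solve 5 (λ x n y f r → (x :+ n :* y) :* f :+ r := r :+ f :* x :+ n :* (f :* y)) refl X minus1 Y φ r ⟩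
      r + φ * X + minus1 * (φ * Y)   ≈⟨ +-congʳ F≈r ⟨
      F + minus1 * (φ * Y)           ≈⟨ sub (trans F≈gh (solve 5 (λ g f g′ h h′ → (g :+ f :* g′) :* (h :+ f :* h′) := g :* h :+ f :* (g′ :* h :+ g :* h′ :+ f :* g′ :* h′)) refl g φ g′ h h′)) ⟩
      g * h                     ∎)
      where Y = g′ * h + g * h′ + φ * g′ * h′

    π^-* : ∀ a b {g h x y} → g ≈ π ^ a * x → h ≈ π ^ b * y → g * h ≈ π ^ (a ℕ.+ b) * (x * y)
    π^-* a b {x = x} {y} g≈ h≈ = trans (*-cong g≈ h≈) (trans (solve 4 (λ p q x y → p :* x :* (q :* y) := p :* q :* (x :* y)) refl (π ^ a) (π ^ b) x y) (*-congʳ (sym (^-homo-* π a b))))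

    φ-swap : ∀ x y → x * (φ * y) ≈ φ * (x * y)
    φ-swap x y = solve 3 (λ f x y → x :* (f :* y) := f :* (x :* y)) refl φ x y

    1+sub : ∀ y → 1# + (y + minus1 * 1#) ≈ y
    1+sub y = trans (solve 3 (λ y a o → o :+ (y :+ a) := y :+ o :+ a) refl y (minus1 * 1#) 1#) (add-sub y 1#)

    π^-suc : ∀ {g} B h′ {h} → g ≈ π ^ B * h → h ≈ π * h′ → g ≈ π ^ suc B * h′
    π^-suc B h′ g≈ h≈ = trans g≈ (trans (*-congˡ h≈) (solve 3 (λ p b h → b :* (p :* h) := p :* b :* h) refl π (π ^ B) h′))

    -- The assumptions say that powers of `π` cancel, that `φ` is regular modulo each of them, and
    -- that `I` is prime. Together they make minimal weights additive, for every choice of weights.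
    module Valuation
      (cancel-π : ∀ a {x y} → π ^ a * x ≈ π ^ a * y → x ≈ y)
      (φ-regular : ∀ a {z y} → φ * z ≈ π ^ a * y → ∃ λ y′ → z ≈ π ^ a * y′)
      (I-prime : ∀ {γ η} → I (γ * η) → I γ ⊎ I η)
      where

      φ^-regular : ∀ a q {z y} → φ ^ q * z ≈ π ^ a * y → ∃ λ y′ → z ≈ π ^ a * y′
      φ^-regular a zero {z} h = _ , trans (sym (*-identityˡ z)) h
      φ^-regular a (suc q) {z} h =
        let y′ , h′ = φ-regular a (trans (sym (*-assoc φ (φ ^ q) z)) h) in φ^-regular a q h′

      -- Regularity of `φ` modulo `π ^ suc a` removes `φ ^ q`. What remains shows `φ * X` to be
      -- divisible by `π ^ a`, hence so is `X`, and then `π ^ a` cancels.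
      monomial∈⇒I : ∀ a q {γ Y X} → φ ^ q * (π ^ a * γ) ≈ π ^ suc a * Y + φ ^ suc q * X → I γ
      monomial∈⇒I a q {γ} {Y} {X} h = Z , X′ , cancel-π a (begin
        π ^ a * γ                              ≈⟨ add-sub (π ^ a * γ) (minus1 * (φ * X)) ⟨
        π ^ a * γ + minus1 * (φ * X) + minus1 * (minus1 * (φ * X)) ≈⟨ +-cong Z-eq (minus1-involutive (φ * X)) ⟩
        π * π ^ a * Z + φ * X                  ≈⟨ +-congˡ (*-congˡ X-eq) ⟩
        π * π ^ a * Z + φ * (π ^ a * X′)       ≈⟨ solve 5 (λ p pa z f x → p :* pa :* z :+ f :* (pa :* x) := pa :* (p :* z :+ f :* x)) refl π (π ^ a) Z φ X′ ⟩
        π ^ a * (π * Z + φ * X′)               ∎)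
        where
        step₁ : φ ^ q * (π ^ a * γ + minus1 * (φ * X)) ≈ π ^ suc a * Y
        step₁ = trans (solve 6 (λ fq pa g n f x → fq :* (pa :* g :+ n :* (f :* x)) := fq :* (pa :* g) :+ n :* (f :* fq :* x)) refl (φ ^ q) (π ^ a) γ minus1 φ X) (sub h)
        Z = proj₁ (φ^-regular (suc a) q step₁)
        Z-eq : π ^ a * γ + minus1 * (φ * X) ≈ π * π ^ a * Z
        Z-eq = proj₂ (φ^-regular (suc a) q step₁)
        step₂ : φ * X ≈ π ^ a * (γ + minus1 * (π * Z))
        step₂ = begin
          φ * X ≈⟨ sub (begin
            π ^ a * γ                                   ≈⟨ add-sub _ (minus1 * (φ * X)) ⟨
            π ^ a * γ + minus1 * (φ * X) + minus1 * (minus1 * (φ * X)) ≈⟨ +-cong Z-eq (minus1-involutive (φ * X)) ⟩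
            π * π ^ a * Z + φ * X                       ≈⟨ +-comm _ _ ⟩
            φ * X + π * π ^ a * Z ∎) ⟨
          π ^ a * γ + minus1 * (π * π ^ a * Z)   ≈⟨ solve 5 (λ pa g n p z → pa :* g :+ n :* (p :* pa :* z) := pa :* (g :+ n :* (p :* z))) refl (π ^ a) γ minus1 π Z ⟩
          π ^ a * (γ + minus1 * (π * Z))         ∎
        X′ = proj₁ (φ-regular a step₂)
        X-eq : X ≈ π ^ a * X′
        X-eq = proj₂ (φ-regular a step₂)

      eval : List Carrier → Carrier
      eval []       = 0#
      eval (g ∷ gs) = g + φ * eval gs

      -- The `π`-adic valuation of `g` truncated at `B`, so that a zero digit needs no separate
      -- treatment. The unit part is required to lie outside `I`, not merely to be prime to `π`; for
      -- digits of degree less than that of `φ` the two agree by `reduced`.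
      Digit : Carrier → Set (c ⊔ ℓ)
      Digit g = ∀ B → (∃ λ h → g ≈ π ^ B * h) ⊎ (∃₂ λ a γ → a < B × g ≈ π ^ a * γ × ¬ I γ)

      -- The top digit, at `φ ^ n`, has valuation zero, so it bounds the minimal weight of the whole
      -- expansion by `n` times the weight of `φ`.
      data Digits : ℕ → List Carrier → Set (c ⊔ ℓ) where
        last : ∀ {g} → ¬ I g → Digits 0 (g ∷ [])
        cons : ∀ {n g gs} → Digit g → Digits n gs → Digits (suc n) (g ∷ gs)

      -- The valuation giving weight K to π and L to φ.
      module Weights (K L : ℕ) (1≤K : 1 ≤ K) where

        weight : ℕ → ℕ → ℕ
        weight a b = K ℕ.* a ℕ.+ L ℕ.* b

        -- The ideal generated by the monomials of weight at least `s`. Membership is a lower bound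
        -- for the valuation; the opposite bound comes from a `LeadingForm`.
        data W (s : ℕ) : Carrier → Set (c ⊔ ℓ) where
          monomial : ∀ a b r → s ≤ weight a b → W s (π ^ a * (φ ^ b * r))
          plus     : ∀ {x y} → W s x → W s y → W s (x + y)
          resp     : ∀ {x y} → x ≈ y → W s x → W s y

        W-≤ : ∀ {s t x} → s ≤ t → W t x → W s x
        W-≤ s≤t (monomial a b r t≤) = monomial a b r (ℕ.≤-trans s≤t t≤)
        W-≤ s≤t (plus x y)          = plus (W-≤ s≤t x) (W-≤ s≤t y)
        W-≤ s≤t (resp e x)          = resp e (W-≤ s≤t x)

        W-* : ∀ {s t x y} → W s x → W t y → W (s ℕ.+ t) (x * y)
        W-* {s} {t} (monomial a b r s≤) (monomial a′ b′ r′ t≤) =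
          resp (begin
            π ^ (a ℕ.+ a′) * (φ ^ (b ℕ.+ b′) * (r * r′))             ≈⟨ *-cong (^-homo-* π a a′) (*-congʳ (^-homo-* φ b b′)) ⟩
            π ^ a * π ^ a′ * (φ ^ b * φ ^ b′ * (r * r′))             ≈⟨ solve 6 (λ x y z u v w → x :* y :* (z :* u :* (v :* w)) := x :* (z :* v) :* (y :* (u :* w))) refl (π ^ a) (π ^ a′) (φ ^ b) (φ ^ b′) r r′ ⟩
            π ^ a * (φ ^ b * r) * (π ^ a′ * (φ ^ b′ * r′))           ∎)
            (monomial (a ℕ.+ a′) (b ℕ.+ b′) (r * r′) (ℕ.≤-trans (ℕ.+-mono-≤ s≤ t≤) (ℕ.≤-reflexive (eq K L a b a′ b′))))
          where
          eq : ∀ K L a b a′ b′ → K ℕ.* a ℕ.+ L ℕ.* b ℕ.+ (K ℕ.* a′ ℕ.+ L ℕ.* b′) ≡ K ℕ.* (a ℕ.+ a′) ℕ.+ L ℕ.* (b ℕ.+ b′)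
          eq = solve-∀
        W-* x (plus y y′) = resp (sym (distribˡ _ _ _)) (plus (W-* x y) (W-* x y′))
        W-* x (resp e y) = resp (*-congˡ e) (W-* x y)
        W-* (plus x x′) y@(monomial _ _ _ _) = resp (sym (distribʳ _ _ _)) (plus (W-* x y) (W-* x′ y))
        W-* (resp e x) y@(monomial _ _ _ _) = resp (*-congʳ e) (W-* x y)

        W-const : ∀ r → W 0 r
        W-const r = resp (trans (*-identityˡ _) (*-identityˡ r)) (monomial 0 0 r z≤n)

        W-scale : ∀ {s x} r → W s x → W s (r * x)
        W-scale r x = W-* (W-const r) x

        W-π^ : ∀ {s} a r → s ≤ K ℕ.* a → W s (π ^ a * r)
        W-π^ a r s≤ = resp (*-congˡ (*-identityˡ r)) (monomial a 0 r (ℕ.≤-trans s≤ (ℕ.m≤m+n _ _)))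

        W-term : ∀ {s} a b r {x} → x ≈ r * (π ^ a * φ ^ b) → s ≤ weight a b → W s x
        W-term a b r x≈ s≤ = resp (trans (solve 3 (λ x y r → x :* (y :* r) := r :* (x :* y)) refl (π ^ a) (φ ^ b) r) (sym x≈)) (monomial a b r s≤)

        W-0 : ∀ {s} → W s 0#
        W-0 {s} = resp (zeroʳ _) (W-π^ s 0# (ℕ.≤-trans (ℕ.≤-reflexive (≡.sym (ℕ.*-identityˡ s))) (ℕ.*-monoˡ-≤ s 1≤K)))

        W-φ* : ∀ {s x} → W s x → W (s ℕ.+ L) (φ * x)
        W-φ* {s} {x} w = ≡.subst (λ t → W t (φ * x)) (ℕ.+-comm L s)
          (W-* (resp (trans (*-identityˡ _) (trans (*-identityʳ _) (*-identityʳ φ))) (monomial 0 1 1# (ℕ.≤-reflexive (≡.sym (≡.trans (≡.cong (ℕ._+ L ℕ.* 1) (ℕ.*-zeroʳ K)) (ℕ.*-identityʳ L)))))) w)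

        W⇒ : ∀ {s x} A B → (∀ a b → s ≤ weight a b → A ≤ a ⊎ B ≤ b) → W s x → ∃₂ λ Y X → x ≈ π ^ A * Y + φ ^ B * X
        W⇒ A B split (monomial a b r s≤) with split a b s≤
        ... | inj₁ A≤a = π ^ (a ℕ.∸ A) * (φ ^ b * r) , 0# , (begin
          π ^ a * (φ ^ b * r)                            ≈⟨ *-congʳ (trans (reflexive (≡.cong (π ^_) (≡.sym (ℕ.m+[n∸m]≡n A≤a)))) (^-homo-* π A (a ℕ.∸ A))) ⟩
          π ^ A * π ^ (a ℕ.∸ A) * (φ ^ b * r)            ≈⟨ *-assoc _ _ _ ⟩
          π ^ A * (π ^ (a ℕ.∸ A) * (φ ^ b * r))          ≈⟨ +-identityʳ _ ⟨
          π ^ A * (π ^ (a ℕ.∸ A) * (φ ^ b * r)) + 0#     ≈⟨ +-congˡ (zeroʳ _) ⟨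
          π ^ A * (π ^ (a ℕ.∸ A) * (φ ^ b * r)) + φ ^ B * 0# ∎)
        ... | inj₂ B≤b = 0# , φ ^ (b ℕ.∸ B) * (π ^ a * r) , (begin
          π ^ a * (φ ^ b * r)                            ≈⟨ *-congˡ (*-congʳ (trans (reflexive (≡.cong (φ ^_) (≡.sym (ℕ.m+[n∸m]≡n B≤b)))) (^-homo-* φ B (b ℕ.∸ B)))) ⟩
          π ^ a * (φ ^ B * φ ^ (b ℕ.∸ B) * r)            ≈⟨ solve 4 (λ x y z r → x :* (y :* z :* r) := y :* (z :* (x :* r))) refl _ _ _ _ ⟩
          φ ^ B * (φ ^ (b ℕ.∸ B) * (π ^ a * r))          ≈⟨ +-identityˡ _ ⟨
          0# + φ ^ B * (φ ^ (b ℕ.∸ B) * (π ^ a * r))     ≈⟨ +-congʳ (zeroʳ _) ⟨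
          π ^ A * 0# + φ ^ B * (φ ^ (b ℕ.∸ B) * (π ^ a * r)) ∎)
        W⇒ A B split (plus x y) =
          let Y , X , e = W⇒ A B split x ; Y′ , X′ , e′ = W⇒ A B split y in
          Y + Y′ , X + X′ , trans (+-cong e e′) (solve 6 (λ p f a b c d → p :* a :+ f :* b :+ (p :* c :+ f :* d) := p :* (a :+ c) :+ f :* (b :+ d)) refl _ _ Y X Y′ X′)
        W⇒ A B split (resp e x) = let Y , X , e′ = W⇒ A B split x in Y , X , trans (sym e) e′

        -- The leading monomial is π^a φ^i: minimal weight, and then minimal i.
        record LeadingForm (n : ℕ) (g₀ x : Carrier) : Set (c ⊔ ℓ) where
          field
            s i a   : ℕ
            γ X X′  : Carrier
            s≡      : s ≡ weight a i
            X∈W     : W (suc s) X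
            x≈      : x ≈ X + φ ^ i * (π ^ a * γ + φ * X′)
            γ∉I     : ¬ I γ
            x∈W     : W s x
            s≤      : s ≤ L ℕ.* n
            c₀      : ℕ
            h₀      : Carrier
            g₀≈     : g₀ ≈ π ^ c₀ * h₀
            s≤Kc₀   : s ≤ K ℕ.* c₀

        -- Horner's scheme: multiplication by `φ` raises the minimal weight of the remaining digits
        -- to `T`. The new digit takes over the lead if its weight is at most `T`, ties favouring
        -- the smaller index; otherwise it joins the part `X` of larger weight. Knowing its
        -- valuation up to `suc T` suffices because `1 ≤ K`.
        leadingForm : ∀ {n g gs} → Digits n (g ∷ gs) → LeadingForm n g (eval (g ∷ gs))
        leadingForm {g = g} (last g∉I) = record
          { s = 0 ; i = 0 ; a = 0 ; γ = g ; X = 0# ; X′ = 0# ; s≡ = ≡.sym (≡.cong₂ ℕ._+_ (ℕ.*-zeroʳ K) (ℕ.*-zeroʳ L))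
          ; X∈W = W-0 ; x≈ = sym (trans (+-identityˡ _) (trans (*-identityˡ _) (+-congʳ (*-identityˡ g))))
          ; γ∉I = g∉I ; x∈W = W-const _ ; s≤ = z≤n ; c₀ = 0 ; h₀ = g ; g₀≈ = sym (*-identityˡ g) ; s≤Kc₀ = z≤n }
        leadingForm {suc n} {g} {gs@(g₁ ∷ _)} (cons digit digits) with leadingForm digits
        ... | lf = choose (digit (suc T))
          where
          open LeadingForm lf
          T = s ℕ.+ L
          T≤ : T ≤ L ℕ.* suc n
          T≤ = ℕ.≤-trans (ℕ.+-monoˡ-≤ L s≤) (ℕ.≤-reflexive (≡.trans (ℕ.+-comm (L ℕ.* n) L) (≡.sym (ℕ.*-suc L n))))
          shifted : ∀ c h → g ≈ π ^ c * h → T < K ℕ.* c → LeadingForm (suc n) g (eval (g ∷ gs))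
          shifted c h g≈ T<Kc = record
            { s = T ; i = suc i ; a = a ; γ = γ ; X = g + φ * X ; X′ = X′
            ; s≡ = ≡.trans (≡.cong (ℕ._+ L) s≡) (≡.trans (ℕ.+-assoc (K ℕ.* a) (L ℕ.* i) L) (≡.cong (K ℕ.* a ℕ.+_) (≡.trans (ℕ.+-comm (L ℕ.* i) L) (≡.sym (ℕ.*-suc L i)))))
            ; X∈W = plus g∈W (W-φ* X∈W)
            ; x≈ = trans (+-congˡ (*-congˡ x≈)) (solve 5 (λ g f x fi y → g :+ f :* (x :+ fi :* y) := (g :+ f :* x) :+ f :* fi :* y) refl g φ X (φ ^ i) _)
            ; γ∉I = γ∉I ; x∈W = plus (W-≤ (ℕ.n≤1+n T) g∈W) (W-φ* x∈W) ; s≤ = T≤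
            ; c₀ = c ; h₀ = h ; g₀≈ = g≈ ; s≤Kc₀ = ℕ.<⇒≤ T<Kc }
            where
            g∈W : W (suc T) g
            g∈W = resp (sym g≈) (W-π^ c h T<Kc)
          choose : (∃ λ h → g ≈ π ^ suc T * h) ⊎ (∃₂ λ a γ → a < suc T × g ≈ π ^ a * γ × ¬ I γ) → LeadingForm (suc n) g (eval (g ∷ gs))
          choose (inj₁ (h , g≈)) = shifted (suc T) h g≈ (ℕ.≤-trans (ℕ.≤-reflexive (≡.sym (ℕ.*-identityˡ (suc T)))) (ℕ.*-monoˡ-≤ (suc T) 1≤K))
          choose (inj₂ (a , γ , _ , g≈ , γ∉I)) with ℕ.≤-<-connex (K ℕ.* a) T
          ... | inj₂ T<Ka = shifted a γ g≈ T<Ka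
          ... | inj₁ Ka≤T = record
            { s = K ℕ.* a ; i = 0 ; a = a ; γ = γ ; X = 0# ; X′ = eval gs
            ; s≡ = ≡.sym (≡.trans (≡.cong (K ℕ.* a ℕ.+_) (ℕ.*-zeroʳ L)) (ℕ.+-identityʳ _))
            ; X∈W = W-0 ; x≈ = sym (trans (+-identityˡ _) (trans (*-identityˡ _) (+-congʳ (sym g≈))))
            ; γ∉I = γ∉I ; x∈W = plus (resp (sym g≈) (W-π^ a γ ℕ.≤-refl)) (W-≤ Ka≤T (W-φ* x∈W))
            ; s≤ = ℕ.≤-trans Ka≤T T≤ ; c₀ = a ; h₀ = γ ; g₀≈ = g≈ ; s≤Kc₀ = ℕ.≤-refl }

        -- If the product had larger weight than the leading monomials together, their product
        -- `φ ^ q * (π ^ e * (γ * η))` would lie in the ideal of `π ^ suc e` and `φ ^ suc q`: a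
        -- monomial of weight above that of `π ^ e * φ ^ q` has a larger exponent of `π` or of `φ`.
        -- Then `γ * η` would be in the prime ideal `I`, although neither factor is.
        weight-product : ∀ {n n′ g₀ h₀ x y F T} (lf : LeadingForm n g₀ x) (lf′ : LeadingForm n′ h₀ y) →
                         W T F → F ≈ x * y → T ≤ LeadingForm.s lf ℕ.+ LeadingForm.s lf′
        weight-product {x = x} {y} {F} {T} lf lf′ F∈W F≈ = ℕ.≮⇒≥ λ s+t<T → [ A.γ∉I , B.γ∉I ]′ (I-prime (γη∈I s+t<T))
          where
          module A = LeadingForm lf
          module B = LeadingForm lf′
          q = A.i ℕ.+ B.i
          e = A.a ℕ.+ B.a
          U = φ ^ A.i * (π ^ A.a * A.γ + φ * A.X′)
          V = φ ^ B.i * (π ^ B.a * B.γ + φ * B.X′)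
          U∈W : W A.s U
          U∈W = resp (trans (+-congʳ (trans A.x≈ (+-comm _ _))) (add-sub U A.X)) (plus A.x∈W (W-scale minus1 (W-≤ (ℕ.n≤1+n _) A.X∈W)))
          rest = π ^ A.a * A.γ * B.X′ + A.X′ * (π ^ B.a * B.γ) + φ * A.X′ * B.X′
          γη∈I : A.s ℕ.+ B.s < T → I (A.γ * B.γ)
          γη∈I s+t<T = monomial∈⇒I e q (begin
            φ ^ q * (π ^ e * (A.γ * B.γ))   ≈⟨ sub (begin
              D                               ≈⟨ sub (sub (trans F≈ (trans (*-cong A.x≈ B.x≈) (begin
                (A.X + U) * (B.X + V)             ≈⟨ solve 4 (λ x u z v → (x :+ u) :* (z :+ v) := u :* v :+ u :* z :+ x :* (z :+ v)) refl A.X U B.X V ⟩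
                U * V + U * B.X + A.X * (B.X + V) ≈⟨ +-congˡ (*-congˡ B.x≈) ⟨
                U * V + U * B.X + A.X * y         ∎)))) ⟩
              U * V                           ≈⟨ solve 10 (λ fi fj pa pb g h f x z dummy → fi :* (pa :* g :+ f :* x) :* (fj :* (pb :* h :+ f :* z)) := fi :* fj :* (pa :* pb :* (g :* h)) :+ f :* (fi :* fj) :* (pa :* g :* z :+ x :* (pb :* h) :+ f :* x :* z)) refl (φ ^ A.i) (φ ^ B.i) (π ^ A.a) (π ^ B.a) A.γ B.γ φ A.X′ B.X′ 0# ⟩
              φ ^ A.i * φ ^ B.i * (π ^ A.a * π ^ B.a * (A.γ * B.γ)) + φ * (φ ^ A.i * φ ^ B.i) * rest
                ≈⟨ +-cong (*-cong (^-homo-* φ A.i B.i) (*-congʳ (^-homo-* π A.a B.a))) (*-congʳ (*-congˡ (^-homo-* φ A.i B.i))) ⟨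
              φ ^ q * (π ^ e * (A.γ * B.γ)) + φ * φ ^ q * rest ∎) ⟨
            D + minus1 * (φ ^ suc q * rest)      ≈⟨ +-congʳ D≈ ⟩
            π ^ suc e * Y + φ ^ suc q * Z + minus1 * (φ ^ suc q * rest) ≈⟨ solve 6 (λ p y f z n r → p :* y :+ f :* z :+ n :* (f :* r) := p :* y :+ f :* (z :+ n :* r)) refl (π ^ suc e) Y (φ ^ suc q) Z minus1 rest ⟩
            π ^ suc e * Y + φ ^ suc q * (Z + minus1 * rest) ∎)
            where
            D = F + minus1 * (A.X * y) + minus1 * (U * B.X)
            D∈W : W (suc (A.s ℕ.+ B.s)) D
            D∈W = plus (plus (W-≤ s+t<T F∈W) (W-scale minus1 (W-* A.X∈W B.x∈W))) (W-scale minus1 (≡.subst (λ k → W k (U * B.X)) (ℕ.+-suc A.s B.s) (W-* U∈W B.X∈W)))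
            split : ∀ a b → suc (A.s ℕ.+ B.s) ≤ weight a b → suc e ≤ a ⊎ suc q ≤ b
            split a b h with ℕ.≤-<-connex a e | ℕ.≤-<-connex b q
            ... | inj₂ e<a | _ = inj₁ e<a
            ... | _ | inj₂ q<b = inj₂ q<b
            ... | inj₁ a≤e | inj₁ b≤q = contradiction (ℕ.≤-trans (ℕ.+-mono-≤ (ℕ.*-monoʳ-≤ K a≤e) (ℕ.*-monoʳ-≤ L b≤q)) (ℕ.≤-reflexive (≡.sym (≡.trans (≡.cong₂ ℕ._+_ A.s≡ B.s≡) (eq K L A.a A.i B.a B.i))))) (ℕ.<⇒≱ h)
              where
              eq : ∀ K L a b a′ b′ → K ℕ.* a ℕ.+ L ℕ.* b ℕ.+ (K ℕ.* a′ ℕ.+ L ℕ.* b′) ≡ K ℕ.* (a ℕ.+ a′) ℕ.+ L ℕ.* (b ℕ.+ b′)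
              eq = solve-∀
            Y = proj₁ (W⇒ (suc e) (suc q) split D∈W)
            Z = proj₁ (proj₂ (W⇒ (suc e) (suc q) split D∈W))
            D≈ : D ≈ π ^ suc e * Y + φ ^ suc q * Z
            D≈ = proj₂ (proj₂ (W⇒ (suc e) (suc q) split D∈W))

-- Integer polynomials: Gauss's lemma and division by monic polynomials

module IntegerPolynomials where

  open import Data.Integer.Base as ℤ using (ℤ; +_; 0ℤ; 1ℤ)
  import Data.Integer.Properties as ℤ
  open import Data.Integer.Divisibility.Signed using (_∣_; divides; ∣ᵤ⇒∣; ∣⇒∣ᵤ; ∣m∣n⇒∣m+n; ∣m+n∣m⇒∣n; ∣m⇒∣m*n; _∣?_)
  open import Data.Integer.Tactic.RingSolver using (solve-∀)
  open import Data.List.Base using (List; []; _∷_; map)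
  open import Data.Nat.Base as ℕ using (ℕ; zero; suc; _≤_; _<_; s≤s; z≤n)
  open import Data.Nat.Primality using (Prime; euclidsLemma)
  open import Data.Nat.Divisibility using () renaming (_∣_ to _ℕ∣_)
  import Data.Nat.Properties as ℕ
  open import Data.Product.Base using (∃; ∃₂; _×_; _,_)
  open import Data.Sum.Base as Sum using (_⊎_; inj₁; inj₂; [_,_]′)
  open import Relation.Binary.PropositionalEquality
  open import Relation.Nullary using (¬_; Dec; yes; no; contradiction)

  open PolynomialRing ℤ.+-*-commutativeRing public

  _∣0 : ∀ k → k ∣ 0ℤ
  k ∣0 = divides 0ℤ refl

  infix 4 _∣ₚ_
  _∣ₚ_ : ℤ → Poly → Set
  k ∣ₚ f = ∀ i → k ∣ coeff f i

  ∣ₚ-resp : ∀ {k f g} → f ≋ g → k ∣ₚ f → k ∣ₚ g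
  ∣ₚ-resp {k} f≋g k∣f i = subst (k ∣_) (at f≋g i) (k∣f i)

  ∣ₚ-quotient : ∀ {k} f → k ∣ₚ f → ∃ λ h → f ≋ k · h
  ∣ₚ-quotient []      _   = [] , ≋-refl
  ∣ₚ-quotient {k} (a ∷ f) k∣f with k∣f 0 | ∣ₚ-quotient f (λ i → k∣f (suc i))
  ... | divides q a≡qk | h , f≋ = q ∷ h , ∷-cong (trans a≡qk (ℤ.*-comm q k)) f≋

  ∣ₚ-· : ∀ k f → k ∣ₚ k · f
  ∣ₚ-· k f i = divides (coeff f i) (trans (coeff-· k f i) (ℤ.*-comm k (coeff f i)))

  ∣ₚ-+ : ∀ {k} f g → k ∣ₚ f → k ∣ₚ g → k ∣ₚ f +ₚ g
  ∣ₚ-+ {k} f g k∣f k∣g i = subst (k ∣_) (sym (coeff-+ f g i)) (∣m∣n⇒∣m+n (k∣f i) (k∣g i))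

  ∣ₚ-+-cancelˡ : ∀ {k} f g → k ∣ₚ f +ₚ g → k ∣ₚ f → k ∣ₚ g
  ∣ₚ-+-cancelˡ {k} f g k∣fg k∣f i = ∣m+n∣m⇒∣n (subst (k ∣_) (coeff-+ f g i) (k∣fg i)) (k∣f i)

  ∣ₚ-*ˡ : ∀ {k} g f → k ∣ₚ f → k ∣ₚ f *ₚ g
  ∣ₚ-*ˡ {k} g f k∣f = let h , f≋ = ∣ₚ-quotient f k∣f in
    ∣ₚ-resp (≋-sym (≋-trans (*ₚ-cong f≋ ≋-refl) (·-*ₚ k h g))) (∣ₚ-· k (h *ₚ g))

  ∣ₚ? : ∀ k f → Dec (k ∣ₚ f)
  ∣ₚ? k [] = yes λ _ → k ∣0
  ∣ₚ? k (a ∷ f) with k ∣? a | ∣ₚ? k f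
  ... | yes k∣a | yes k∣f = yes λ { zero → k∣a ; (suc i) → k∣f i }
  ... | no k∤a  | _       = no λ h → k∤a (h 0)
  ... | _       | no k∤f  = no λ h → k∤f λ i → h (suc i)

  euclid : ∀ {p} → Prime p → ∀ a b → + p ∣ a ℤ.* b → + p ∣ a ⊎ + p ∣ b
  euclid {p} pp a b p∣ab = Sum.map ∣ᵤ⇒∣ ∣ᵤ⇒∣ (euclidsLemma ℤ.∣ a ∣ ℤ.∣ b ∣ pp (subst (p ℕ∣_) (ℤ.abs-* a b) (∣⇒∣ᵤ p∣ab)))

  module _ {p : ℕ} (pp : Prime p) where

    -- Gauss's lemma read from the constant end: since `a` is prime to `p`, the constant coefficient
    -- of `g` is divisible by `p` and can be split off. `gauss` reduces to this case by stripping
    -- coefficients divisible by `p` from `f`.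
    gauss-unit : ∀ a f g → ¬ + p ∣ a → + p ∣ₚ (a ∷ f) *ₚ g → + p ∣ₚ g
    gauss-unit a f [] _ _ _ = (+ p) ∣0
    gauss-unit a f (b ∷ g) p∤a p∣ = λ { zero → p∣b ; (suc i) → gauss-unit a f g p∤a p∣fg i }
      where
      p∣′ : + p ∣ₚ (b · (a ∷ f)) +ₚ (0ℤ ∷ ((a ∷ f) *ₚ g))
      p∣′ = ∣ₚ-resp (*ₚ-∷ (a ∷ f) b g) p∣
      p∣b : + p ∣ b
      p∣b = [ (λ p∣a → contradiction p∣a p∤a) , (λ p∣b → p∣b) ]′ (euclid pp a b (subst (+ p ∣_) (trans (ℤ.+-identityʳ (b ℤ.* a)) (ℤ.*-comm b a)) (p∣′ 0)))
      p∣fg : + p ∣ₚ (a ∷ f) *ₚ g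
      p∣fg i = ∣ₚ-+-cancelˡ (b · (a ∷ f)) (0ℤ ∷ ((a ∷ f) *ₚ g)) p∣′ (λ j → subst (+ p ∣_) (sym (coeff-· b (a ∷ f) j)) (∣m⇒∣m*n (coeff (a ∷ f) j) p∣b)) (suc i)

    gauss : ∀ f g → + p ∣ₚ f *ₚ g → + p ∣ₚ f ⊎ + p ∣ₚ g
    gauss [] g _ = inj₁ λ _ → (+ p) ∣0
    gauss (a ∷ f) g p∣ with + p ∣? a
    ... | no p∤a = inj₂ (gauss-unit a f g p∤a p∣)
    ... | yes p∣a = Sum.map₁ (λ p∣f → λ { zero → p∣a ; (suc i) → p∣f i })
      (gauss f g λ i → ∣ₚ-+-cancelˡ (a · g) (0ℤ ∷ (f *ₚ g)) p∣ (λ j → subst (+ p ∣_) (sym (coeff-· a g j)) (∣m⇒∣m*n (coeff g j) p∣a)) (suc i))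

  DegLt : ℕ → Poly → Set
  DegLt n f = ∀ i → n ≤ i → coeff f i ≡ 0ℤ

  DegLt-resp : ∀ {n f g} → f ≋ g → DegLt n f → DegLt n g
  DegLt-resp f≋g f<n i n≤i = trans (sym (at f≋g i)) (f<n i n≤i)

  DegLt-≤ : ∀ {m n f} → m ≤ n → DegLt m f → DegLt n f
  DegLt-≤ m≤n f<m i n≤i = f<m i (ℕ.≤-trans m≤n n≤i)

  DegLt-+ : ∀ {n} f g → DegLt n f → DegLt n g → DegLt n (f +ₚ g)
  DegLt-+ f g f<n g<n i n≤i = trans (coeff-+ f g i) (cong₂ ℤ._+_ (f<n i n≤i) (g<n i n≤i))

  DegLt-· : ∀ {n} a f → DegLt n f → DegLt n (a · f)
  DegLt-· a f f<n i n≤i = trans (coeff-· a f i) (trans (cong (a ℤ.*_) (f<n i n≤i)) (ℤ.*-zeroʳ a))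

  ≋[] : ∀ {f} → DegLt 0 f → f ≋ []
  ≋[] f<0 = mk λ i → f<0 i z≤n

  degree-* : ∀ {a b} f g → DegLt (suc a) f → DegLt (suc b) g →
             DegLt (suc (a ℕ.+ b)) (f *ₚ g) × coeff (f *ₚ g) (a ℕ.+ b) ≡ coeff f a ℤ.* coeff g b
  degree-* {b = b} [] g _ _ = (λ _ _ → refl) , sym (ℤ.*-zeroˡ (coeff g b))
  degree-* {zero} {b} (c ∷ f) g f<1 g<b = DegLt-resp (≋-sym cg) (DegLt-· c g g<b) , trans (at cg b) (coeff-· c g b)
    where
    cg : (c ∷ f) *ₚ g ≋ c · g
    cg = ≋-trans (+ₚ-cong {c · g} ≋-refl (0∷[]≈[] (≋-trans (*ₚ-cong {f} {[]} {g} {g} (≋[] {f} λ i _ → f<1 (suc i) (s≤s z≤n)) ≋-refl) ≋-refl))) (+ₚ-identityʳ (c · g))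
  degree-* {suc a} {b} (c ∷ f) g f<a g<b with degree-* {a} {b} f g (λ i a<i → f<a (suc i) (s≤s a<i)) g<b
  ... | fg< , fg-top = bound , top
    where
    bound : DegLt (suc (suc a ℕ.+ b)) ((c ∷ f) *ₚ g)
    bound (suc i) (s≤s a+b<i) = trans (coeff-+ (c · g) (0ℤ ∷ (f *ₚ g)) (suc i)) (cong₂ ℤ._+_ (DegLt-· c g g<b (suc i) (s≤s (ℕ.≤-trans (ℕ.m≤n+m b (suc a)) a+b<i))) (fg< i a+b<i))
    top : coeff ((c ∷ f) *ₚ g) (suc a ℕ.+ b) ≡ coeff f a ℤ.* coeff g b
    top = trans (coeff-+ (c · g) (0ℤ ∷ (f *ₚ g)) (suc a ℕ.+ b)) (trans (cong₂ ℤ._+_ (DegLt-· c g g<b (suc a ℕ.+ b) (s≤s (ℕ.m≤n+m b a))) fg-top) (ℤ.+-identityˡ _))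

  scale-cancel : ∀ k .{{_ : ℕ.NonZero k}} f g → + k · f ≋ + k · g → f ≋ g
  scale-cancel k f g kf≋kg .at i = ℤ.*-cancelˡ-≡ (+ k) (coeff f i) (coeff g i) (trans (sym (coeff-· (+ k) f i)) (trans (at kf≋kg i) (coeff-· (+ k) g i)))

  record MonicOfDegree (d : ℕ) (M : Poly) : Set where
    field
      leading : coeff M d ≡ 1ℤ
      bounded : DegLt (suc d) M
  open MonicOfDegree public

  divMod : ∀ {d M} → MonicOfDegree d M → ∀ A → ∃₂ λ q r → A ≋ q *ₚ M +ₚ r × DegLt d r
  divMod monic [] = [] , [] , ≋-refl , λ _ _ → refl
  divMod {d} {M} monic (a ∷ A) with divMod monic A
  ... | q , r , A≋ , r<d = c ∷ q , s , mk eq , s<d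
    where
    -- Prepending `a` to `A` turns the remainder `r` into `a ∷ r`, whose only possibly nonzero
    -- coefficient from degree `d` on is `c`; subtracting `c · M` removes it.
    c = coeff (a ∷ r) d
    s = (a ∷ r) +ₚ (ℤ.- c) · M
    s-coeff : ∀ i → coeff s i ≡ coeff (a ∷ r) i ℤ.+ ℤ.- c ℤ.* coeff M i
    s-coeff i = trans (coeff-+ (a ∷ r) ((ℤ.- c) · M) i) (cong (ℤ._+_ (coeff (a ∷ r) i)) (coeff-· (ℤ.- c) M i))
    eq : ∀ i → coeff (a ∷ A) i ≡ coeff ((c ∷ q) *ₚ M +ₚ s) i
    eq i = sym (begin
      coeff ((c ∷ q) *ₚ M +ₚ s) i   ≡⟨ coeff-+ ((c ∷ q) *ₚ M) s i ⟩
      coeff ((c ∷ q) *ₚ M) i ℤ.+ coeff s i ≡⟨ cong₂ ℤ._+_ (trans (coeff-+ (c · M) (0ℤ ∷ (q *ₚ M)) i) (cong (ℤ._+ coeff (0ℤ ∷ (q *ₚ M)) i) (coeff-· c M i))) (s-coeff i) ⟩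
      c ℤ.* coeff M i ℤ.+ coeff (0ℤ ∷ (q *ₚ M)) i ℤ.+ (coeff (a ∷ r) i ℤ.+ ℤ.- c ℤ.* coeff M i) ≡⟨ ident c (coeff M i) (coeff (0ℤ ∷ (q *ₚ M)) i) (coeff (a ∷ r) i) ⟩
      coeff (0ℤ ∷ (q *ₚ M)) i ℤ.+ coeff (a ∷ r) i ≡⟨ shifted i ⟩
      coeff (a ∷ A) i ∎)
      where
      open ≡-Reasoning
      ident : ∀ c m x y → c ℤ.* m ℤ.+ x ℤ.+ (y ℤ.+ ℤ.- c ℤ.* m) ≡ x ℤ.+ y
      ident = solve-∀
      shifted : ∀ i → coeff (0ℤ ∷ (q *ₚ M)) i ℤ.+ coeff (a ∷ r) i ≡ coeff (a ∷ A) i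
      shifted zero    = ℤ.+-identityˡ a
      shifted (suc i) = trans (sym (coeff-+ (q *ₚ M) r i)) (sym (at A≋ i))
    s<d : DegLt d s
    s<d i d≤i with ℕ.m≤n⇒m<n∨m≡n d≤i
    ... | inj₂ refl = trans (s-coeff d) (trans (cong (λ x → c ℤ.+ ℤ.- c ℤ.* x) (leading monic)) (trans (cong (ℤ._+_ c) (ℤ.*-identityʳ (ℤ.- c))) (ℤ.+-inverseʳ c)))
    ... | inj₁ d<i = trans (s-coeff i) (cong₂ ℤ._+_ (above i d<i) (trans (cong (ℤ.- c ℤ.*_) (bounded monic i d<i)) (ℤ.*-zeroʳ (ℤ.- c))))
      where
      above : ∀ i → d < i → coeff (a ∷ r) i ≡ 0ℤ
      above (suc i) (s≤s d≤i) = r<d i d≤i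

  -- With k = 0 this is the uniqueness of division with remainder.
  ∣-cofactor : ∀ {d M} → MonicOfDegree d M → ∀ k N q r → DegLt d r →
               (∀ i → N ℕ.+ d ≤ i → k ∣ coeff (q *ₚ M +ₚ r) i) → ∀ i → N ≤ i → k ∣ coeff q i
  ∣-cofactor monic k N [] r r<d k∣ i N≤i = k ∣0
  ∣-cofactor {d} {M} monic k N (c ∷ q) r r<d k∣ = result N k∣
    where
    tail : Poly → Poly
    tail []      = []
    tail (_ ∷ f) = f
    coeff-tail : ∀ f i → coeff (tail f) i ≡ coeff f (suc i)
    coeff-tail []      i = refl
    coeff-tail (_ ∷ f) i = refl
    r′ = tail (c · M +ₚ r)
    r′<d : DegLt d r′
    r′<d i d≤i = trans (coeff-tail (c · M +ₚ r) i) (DegLt-+ (c · M) r (DegLt-· c M (bounded monic)) (DegLt-≤ {f = r} (ℕ.n≤1+n d) r<d) (suc i) (s≤s d≤i))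
    split : ∀ i → coeff ((c ∷ q) *ₚ M +ₚ r) i ≡ coeff (0ℤ ∷ (q *ₚ M)) i ℤ.+ coeff (c · M +ₚ r) i
    split i = begin
      coeff ((c ∷ q) *ₚ M +ₚ r) i ≡⟨ coeff-+ ((c ∷ q) *ₚ M) r i ⟩
      coeff ((c ∷ q) *ₚ M) i ℤ.+ coeff r i ≡⟨ cong (ℤ._+ coeff r i) (coeff-+ (c · M) (0ℤ ∷ (q *ₚ M)) i) ⟩
      coeff (c · M) i ℤ.+ coeff (0ℤ ∷ (q *ₚ M)) i ℤ.+ coeff r i ≡⟨ ident (coeff (c · M) i) (coeff (0ℤ ∷ (q *ₚ M)) i) (coeff r i) ⟩
      coeff (0ℤ ∷ (q *ₚ M)) i ℤ.+ (coeff (c · M) i ℤ.+ coeff r i) ≡⟨ cong (ℤ._+_ (coeff (0ℤ ∷ (q *ₚ M)) i)) (coeff-+ (c · M) r i) ⟨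
      coeff (0ℤ ∷ (q *ₚ M)) i ℤ.+ coeff (c · M +ₚ r) i ∎
      where
      open ≡-Reasoning
      ident : ∀ x y z → x ℤ.+ y ℤ.+ z ≡ y ℤ.+ (x ℤ.+ z)
      ident = solve-∀
    split-suc : ∀ i → coeff ((c ∷ q) *ₚ M +ₚ r) (suc i) ≡ coeff (q *ₚ M +ₚ r′) i
    split-suc i = trans (split (suc i)) (trans (cong (ℤ._+_ (coeff (q *ₚ M) i)) (sym (coeff-tail (c · M +ₚ r) i))) (sym (coeff-+ (q *ₚ M) r′ i)))
    k∣q : (∀ i → d ≤ i → k ∣ coeff ((c ∷ q) *ₚ M +ₚ r) i) → ∀ i → k ∣ coeff q i
    k∣q k∣ i = ∣-cofactor monic k 0 q r′ r′<d (λ j d≤j → subst (k ∣_) (split-suc j) (k∣ (suc j) (ℕ.m≤n⇒m≤1+n d≤j))) i z≤n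
    result : ∀ N → (∀ i → N ℕ.+ d ≤ i → k ∣ coeff ((c ∷ q) *ₚ M +ₚ r) i) → ∀ i → N ≤ i → k ∣ coeff (c ∷ q) i
    result (suc N) k∣ (suc i) (s≤s N≤i) = ∣-cofactor monic k N q r′ r′<d (λ j N+d≤j → subst (k ∣_) (split-suc j) (k∣ (suc j) (s≤s N+d≤j))) i N≤i
    result zero k∣ (suc i) _ = k∣q k∣ i
    -- The higher coefficients of the quotient are already divisible by `k`, so modulo `k` only
    -- `c · M +ₚ r` contributes, and its coefficient in degree `d` is `c`.
    result zero k∣ zero _ = subst (k ∣_) c≡ (∣m+n∣m⇒∣n (subst (k ∣_) (split d) (k∣ d ℕ.≤-refl)) (k∣qM d))
      where
      k∣qM : ∀ i → k ∣ coeff (0ℤ ∷ (q *ₚ M)) i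
      k∣qM zero = k ∣0
      k∣qM (suc i) = ∣ₚ-*ˡ M q (k∣q k∣) i
      c≡ : coeff (c · M +ₚ r) d ≡ c
      c≡ = trans (coeff-+ (c · M) r d) (trans (cong₂ ℤ._+_ (trans (coeff-· c M d) (trans (cong (c ℤ.*_) (leading monic)) (ℤ.*-identityʳ c))) (r<d d ℕ.≤-refl)) (ℤ.+-identityʳ c))

  ∣-cofactor⁻¹ : ∀ {d M} → MonicOfDegree d M → ∀ k N q → (∀ i → N ≤ i → k ∣ coeff q i) → ∀ i → N ℕ.+ d ≤ i → k ∣ coeff (q *ₚ M) i
  ∣-cofactor⁻¹ {M = M} monic k zero q k∣q i _ = ∣ₚ-*ˡ M q (λ j → k∣q j z≤n) i
  ∣-cofactor⁻¹ monic k (suc N) [] k∣q i _ = k ∣0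
  ∣-cofactor⁻¹ {d} {M} monic k (suc N) (c ∷ q) k∣q (suc i) (s≤s N+d≤i) = subst (k ∣_) (sym (coeff-+ (c · M) (0ℤ ∷ (q *ₚ M)) (suc i)))
    (∣m∣n⇒∣m+n (subst (k ∣_) (sym (DegLt-· c M (bounded monic) (suc i) (s≤s (ℕ.≤-trans (ℕ.m≤n+m d N) N+d≤i)))) (k ∣0))
               (∣-cofactor⁻¹ monic k N q (λ j N≤j → k∣q (suc j) (s≤s N≤j)) i N+d≤i))

-- The key polynomial modulo a prime

module ModuloPrime where

  open import Defs using (IrreducibleMod; module ℤ/ℤ[x])
  open import Algebra.Bundles using (CommutativeRing)
  open import Data.Integer.Base as ℤ using (ℤ; +_; -[1+_]; 0ℤ; 1ℤ)
  import Data.Integer.Properties as ℤ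
  open import Data.Integer.Divisibility.Signed using (_∣_; divides; ∣ᵤ⇒∣; ∣⇒∣ᵤ; _∣?_; 0∣⇒≡0)
  open import Data.Integer.Tactic.RingSolver using (solve-∀)
  open import Data.List.Base using (List; []; _∷_; map)
  open import Data.Nat.Base as ℕ using (ℕ; zero; suc; _≤_; _<_; s≤s; z≤n)
  open import Data.Nat.Coprimality using (Coprime; coprime-Bézout)
  open import Data.Nat.GCD using (module Bézout)
  open import Data.Nat.Primality using (Prime; prime⇒irreducible; ¬prime[1]; prime⇒nonZero)
  open import Data.Nat.Divisibility using () renaming (_∣_ to _ℕ∣_; ∣1⇒≡1 to ℕ∣1⇒≡1)
  import Data.Nat.Properties as ℕ
  open import Data.Product.Base using (∃; ∃₂; _×_; _,_)
  open import Data.Sum.Base as Sum using (_⊎_; inj₁; inj₂; [_,_]′)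
  open import Relation.Binary.PropositionalEquality as ≡ using (_≡_; cong; cong₂; subst)
  open import Relation.Nullary using (¬_; Dec; yes; no; contradiction)
  import Algebra.Definitions.RawSemiring as SemiringDefs
  open IntegerPolynomials hiding (_^_)
  open NewtonPolygon

  -- The operations of (ℤ/pℤ)[x] are those of ℤ[x].
  module Reduction (p : ℕ) where

    module F = ℤ/ℤ[x] p

    coeff≡ : ∀ f i → F.coeff f i ≡ coeff f i
    coeff≡ []      i       = ≡.refl
    coeff≡ (a ∷ f) zero    = ≡.refl
    coeff≡ (a ∷ f) (suc i) = coeff≡ f i

    +≡ : ∀ f g → f F.+ₚ g ≡ f +ₚ g
    +≡ []      g       = ≡.refl
    +≡ (a ∷ f) []      = ≡.refl
    +≡ (a ∷ f) (b ∷ g) = cong (a ℤ.+ b ∷_) (+≡ f g)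

    *≡ : ∀ f g → f F.*ₚ g ≡ f *ₚ g
    *≡ []      g = ≡.refl
    *≡ (a ∷ f) g = ≡.trans (+≡ (a · g) (0ℤ ∷ (f F.*ₚ g))) (cong (λ h → (a · g) +ₚ (0ℤ ∷ h)) (*≡ f g))

  bezout : ∀ {p} → Prime p → ∀ c → ¬ + p ∣ c → ∃₂ λ c′ t → c′ ℤ.* c ≡ 1ℤ ℤ.+ + p ℤ.* t
  bezout {p} pp c p∤c = signed c p∤c
    where
    coprime : ∀ n → ¬ p ℕ∣ n → Coprime p n
    coprime n p∤n (d∣p , d∣n) with prime⇒irreducible pp d∣p
    ... | inj₁ d≡1 = d≡1
    ... | inj₂ ≡.refl = contradiction d∣n p∤n
    natural : ∀ n → ¬ p ℕ∣ n → ∃₂ λ c′ t → c′ ℤ.* + n ≡ 1ℤ ℤ.+ + p ℤ.* t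
    natural n p∤n with coprime-Bézout (coprime n p∤n)
    ... | Bézout.+- x y eq = ℤ.- + y , ℤ.- + x , (begin
      ℤ.- + y ℤ.* + n                          ≡⟨ ident (+ y) (+ n) ⟩
      1ℤ ℤ.+ ℤ.- (1ℤ ℤ.+ + y ℤ.* + n)          ≡⟨ cong (λ z → 1ℤ ℤ.+ ℤ.- (1ℤ ℤ.+ z)) (ℤ.pos-* y n) ⟨
      1ℤ ℤ.+ ℤ.- (+ (1 ℕ.+ y ℕ.* n))           ≡⟨ cong (λ z → 1ℤ ℤ.+ ℤ.- (+ z)) eq ⟩
      1ℤ ℤ.+ ℤ.- (+ (x ℕ.* p))                 ≡⟨ cong (λ z → 1ℤ ℤ.+ ℤ.- z) (ℤ.pos-* x p) ⟩
      1ℤ ℤ.+ ℤ.- (+ x ℤ.* + p)                 ≡⟨ ident′ (+ x) (+ p) ⟩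
      1ℤ ℤ.+ + p ℤ.* ℤ.- + x                   ∎)
      where
      open ≡.≡-Reasoning
      ident : ∀ y n → ℤ.- y ℤ.* n ≡ 1ℤ ℤ.+ ℤ.- (1ℤ ℤ.+ y ℤ.* n)
      ident = solve-∀
      ident′ : ∀ x p → 1ℤ ℤ.+ ℤ.- (x ℤ.* p) ≡ 1ℤ ℤ.+ p ℤ.* ℤ.- x
      ident′ = solve-∀
    ... | Bézout.-+ x y eq = + y , + x , ≡.sym (≡.trans (cong (ℤ._+_ 1ℤ) (≡.trans (≡.sym (ℤ.pos-* p x)) (cong +_ (ℕ.*-comm p x)))) (≡.trans (cong +_ eq) (ℤ.pos-* y n)))
    signed : ∀ c → ¬ + p ∣ c → ∃₂ λ c′ t → c′ ℤ.* c ≡ 1ℤ ℤ.+ + p ℤ.* t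
    signed (+ n) p∤c = natural n (λ p∣n → p∤c (∣ᵤ⇒∣ p∣n))
    signed -[1+ n ] p∤c = let c′ , t , eq = natural (suc n) (λ p∣n → p∤c (∣ᵤ⇒∣ p∣n)) in
      ℤ.- c′ , t , ≡.trans (ident c′ (+ suc n)) eq
      where
      ident : ∀ c n → ℤ.- c ℤ.* ℤ.- n ≡ c ℤ.* n
      ident = solve-∀

  X^ : ℕ → Poly
  X^ zero    = 1ℤ ∷ []
  X^ (suc δ) = 0ℤ ∷ X^ δ

  coeff-X^ : ∀ δ → coeff (X^ δ) δ ≡ 1ℤ
  coeff-X^ zero    = ≡.refl
  coeff-X^ (suc δ) = coeff-X^ δ

  X^< : ∀ δ → DegLt (suc δ) (X^ δ)
  X^< zero    (suc i) _          = ≡.refl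
  X^< (suc δ) (suc i) (s≤s δ<i) = X^< δ i δ<i

  module KeyPolynomial (p : ℕ) (pp : Prime p) (d : ℕ) (φ : Poly) (monic : MonicOfDegree d φ) (irr : IrreducibleMod p φ) where

    -- Abstract, so that products with π do not unfold.
    abstract
      π : Poly
      π = + p ∷ []

      π* : ∀ f → π *ₚ f ≋ + p · f
      π* = const-* (+ p)

    open Newton polyCommutativeRing π φ public
    open CommutativeRing polyCommutativeRing using (_≈_; _+_; _*_; 1#; setoid; refl; sym; trans; +-congˡ; *-congˡ; *-assoc; +-comm; *-comm; zeroʳ; +-identityʳ; *-identityʳ; *-identityˡ)
    open import Relation.Binary.Reasoning.Setoid setoid

    instance
      p≢0 : ℕ.NonZero p
      p≢0 = prime⇒nonZero pp

    p∤1 : ¬ + p ∣ 1ℤ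
    p∤1 p∣1 = ¬prime[1] (subst Prime (ℕ∣1⇒≡1 (∣⇒∣ᵤ p∣1)) pp)

    π∣ₚ : ∀ f → + p ∣ₚ π * f
    π∣ₚ f = ∣ₚ-resp (sym (π* f)) (∣ₚ-· (+ p) f)

    ∣ₚ⇒π : ∀ {f} → + p ∣ₚ f → ∃ λ h → f ≈ π * h
    ∣ₚ⇒π {f} p∣f = let h , f≈ = ∣ₚ-quotient f p∣f in h , trans f≈ (sym (π* h))

    π^* : ∀ a f → π ^ a * f ≈ (+ (p ℕ.^ a)) · f
    π^* zero f = const-* 1ℤ f
    π^* (suc a) f = begin
      π * π ^ a * f               ≈⟨ *-assoc π (π ^ a) f ⟩
      π * (π ^ a * f)             ≈⟨ *-congˡ {π} {π ^ a * f} {+ (p ℕ.^ a) · f} (π^* a f) ⟩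
      π * (+ (p ℕ.^ a) · f)       ≈⟨ π* (+ (p ℕ.^ a) · f) ⟩
      + p · (+ (p ℕ.^ a) · f)     ≈⟨ mk (λ i → ≡.trans (coeff-· (+ p) (+ (p ℕ.^ a) · f) i) (≡.trans (cong (ℤ._*_ (+ p)) (coeff-· (+ (p ℕ.^ a)) f i)) (≡.trans (≡.sym (ℤ.*-assoc (+ p) (+ (p ℕ.^ a)) (coeff f i))) (≡.trans (cong (ℤ._* coeff f i) (≡.sym (ℤ.pos-* p (p ℕ.^ a)))) (≡.sym (coeff-· (+ (p ℕ.* p ℕ.^ a)) f i)))))) ⟩
      + (p ℕ.* p ℕ.^ a) · f       ∎

    cancel-π : ∀ a {x y} → π ^ a * x ≈ π ^ a * y → x ≈ y
    cancel-π a {x} {y} h = scale-cancel (p ℕ.^ a) {{ℕ.m^n≢0 p a}} x y (trans (sym (π^* a x)) (trans h (π^* a y)))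

    φ-regular : ∀ a {z y} → φ * z ≈ π ^ a * y → ∃ λ y′ → z ≈ π ^ a * y′
    φ-regular a {z} {y} h =
      let y′ , z≈ = ∣ₚ-quotient z (λ i → ∣-cofactor monic (+ (p ℕ.^ a)) 0 z [] (λ _ _ → ≡.refl)
            (λ j _ → ∣ₚ-resp (trans (sym (trans (+-identityʳ (z * φ)) (trans (*-comm z φ) (trans h (π^* a y))))) refl) (∣ₚ-· (+ (p ℕ.^ a)) y) j) i z≤n)
      in y′ , trans z≈ (sym (π^* a y′))

    ∣ₚ⇒I : ∀ {f} → + p ∣ₚ f → I f
    ∣ₚ⇒I p∣f = let h , f≈ = ∣ₚ⇒π p∣f in I-resp (sym f≈) (I-π h)

    DegLt-minus1 : ∀ {n} f → DegLt n f → DegLt n (minus1 * f)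
    DegLt-minus1 f f<n = DegLt-resp (sym (const-* (ℤ.- 1ℤ) f)) (DegLt-· (ℤ.- 1ℤ) f f<n)

    -- Modulo `p`, membership in `I` makes `γ` a multiple of the monic `φ`, which has larger degree;
    -- the cofactor `X` must then vanish modulo `p`.
    reduced : ∀ {γ} → DegLt d γ → I γ → + p ∣ₚ γ
    reduced {γ} γ<d (Y , X , γ≈) = ∣ₚ-resp (sym γ≈) (∣ₚ-+ (π * Y) (φ * X) (π∣ₚ Y) (∣ₚ-resp (*-comm X φ) (∣ₚ-*ˡ φ X p∣X)))
      where
      p∣X : + p ∣ₚ X
      p∣X i = ∣-cofactor monic (+ p) 0 X (minus1 * γ) (DegLt-minus1 γ γ<d) (λ j _ → ∣ₚ-resp (sym (I-cofactor γ≈)) (π∣ₚ (minus1 * Y)) j) i z≤n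

    split-irreducible : ∀ x y r → φ ≈ x * y + r → + p ∣ₚ r → UnitMod x ⊎ UnitMod y
    split-irreducible x y r φ≈ p∣r = Sum.map unit unit (SemiringDefs.Irreducible.split-∣1 irr {x} {y} φ≈xy)
      where
      open Reduction p
      φ≈xy : φ F.≈ₚ x F.*ₚ y
      φ≈xy i = ∣⇒∣ᵤ (subst (+ p ∣_) (≡.sym (begin′ i)) (p∣r i))
        where
        begin′ : ∀ i → F.coeff φ i ℤ.- F.coeff (x F.*ₚ y) i ≡ coeff r i
        begin′ i = ≡.trans (cong₂ ℤ._-_ (≡.trans (coeff≡ φ i) (≡.trans (at φ≈ i) (coeff-+ (x *ₚ y) r i))) (≡.trans (coeff≡ (x F.*ₚ y) i) (cong (λ h → coeff h i) (*≡ x y)))) (ident (coeff (x *ₚ y) i) (coeff r i))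
          where
          ident : ∀ a b → a ℤ.+ b ℤ.- a ≡ b
          ident = solve-∀
      unit : ∀ {x} → SemiringDefs._∣_ F.polyRawSemiring x (1ℤ ∷ []) → UnitMod x
      unit {x} (record { quotient = μ ; equality = μx≈1 }) = let w , eq = ∣ₚ⇒π {diff} p∣ in μ , w , trans (sym (1+sub (μ * x))) (+-congˡ {1#} {diff} {π * w} eq)
        where
        diff = μ * x + minus1 * 1#
        p∣ : + p ∣ₚ diff
        p∣ i = subst (+ p ∣_) (≡.sym (eq i)) (∣ᵤ⇒∣ (μx≈1 i))
          where
          eq : ∀ i → coeff diff i ≡ F.coeff (μ F.*ₚ x) i ℤ.- F.coeff (1ℤ ∷ []) i
          eq i = ≡.trans (coeff-+ (μ * x) (minus1 * 1#) i) (cong₂ ℤ._+_ (≡.sym (≡.trans (coeff≡ (μ F.*ₚ x) i) (cong (λ h → coeff h i) (*≡ μ x))))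
            (≡.trans (at (const-* (ℤ.- 1ℤ) (1ℤ ∷ [])) i) (≡.trans (coeff-· (ℤ.- 1ℤ) (1ℤ ∷ []) i) (≡.trans (ℤ.-1*i≡-i (coeff (1ℤ ∷ []) i)) (cong ℤ.-_ (≡.sym (coeff≡ (1ℤ ∷ []) i)))))))

    dropTop : ℕ → Poly → Poly
    dropTop δ γ = γ +ₚ (ℤ.- coeff γ δ) · X^ δ

    coeff-dropTop : ∀ δ γ i → coeff (dropTop δ γ) i ≡ coeff γ i ℤ.+ ℤ.- coeff γ δ ℤ.* coeff (X^ δ) i
    coeff-dropTop δ γ i = ≡.trans (coeff-+ γ ((ℤ.- coeff γ δ) · X^ δ) i) (cong (ℤ._+_ (coeff γ i)) (coeff-· (ℤ.- coeff γ δ) (X^ δ) i))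

    dropTop< : ∀ δ γ → DegLt (suc δ) γ → DegLt δ (dropTop δ γ)
    dropTop< δ γ γ<δ+1 i δ≤i with ℕ.m≤n⇒m<n∨m≡n δ≤i
    ... | inj₁ δ<i = ≡.trans (coeff-dropTop δ γ i) (cong₂ ℤ._+_ (γ<δ+1 i δ<i) (≡.trans (cong (ℤ._*_ (ℤ.- coeff γ δ)) (X^< δ i δ<i)) (ℤ.*-zeroʳ (ℤ.- coeff γ δ))))
    ... | inj₂ ≡.refl = ≡.trans (coeff-dropTop δ γ δ) (≡.trans (cong (λ x → coeff γ δ ℤ.+ ℤ.- coeff γ δ ℤ.* x) (coeff-X^ δ)) (≡.trans (cong (ℤ._+_ (coeff γ δ)) (ℤ.*-identityʳ (ℤ.- coeff γ δ))) (ℤ.+-inverseʳ (coeff γ δ))))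

    dropTop≈ : ∀ δ γ q → coeff γ δ ≡ q ℤ.* + p → γ ≈ dropTop δ γ + π * (q · X^ δ)
    dropTop≈ δ γ q c≡qp .at i = ≡.sym (≡.trans (coeff-+ (dropTop δ γ) (π * (q · X^ δ)) i)
      (≡.trans (cong₂ ℤ._+_ (coeff-dropTop δ γ i) (≡.trans (at (π* (q · X^ δ)) i) (≡.trans (coeff-· (+ p) (q · X^ δ) i) (cong (ℤ._*_ (+ p)) (coeff-· q (X^ δ) i)))))
        (≡.trans (cong (λ c → coeff γ i ℤ.+ ℤ.- c ℤ.* coeff (X^ δ) i ℤ.+ + p ℤ.* (q ℤ.* coeff (X^ δ) i)) c≡qp) (ident (coeff γ i) q (+ p) (coeff (X^ δ) i)))))
      where
      ident : ∀ g q p x → g ℤ.+ ℤ.- (q ℤ.* p) ℤ.* x ℤ.+ p ℤ.* (q ℤ.* x) ≡ g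
      ident = solve-∀

    -- Scaling by an inverse of the leading coefficient modulo `p` makes the leading coefficient 1
    -- only up to a multiple of `p`; the second summand corrects this, so that division by the
    -- result is possible over the integers.
    monicMultiple : ∀ δ γ → DegLt (suc δ) γ → ∀ c′ t → c′ ℤ.* coeff γ δ ≡ 1ℤ ℤ.+ + p ℤ.* t →
                    MonicOfDegree δ ((c′ ∷ []) * γ + π * ((ℤ.- t) · X^ δ))
    monicMultiple δ γ γ<δ+1 c′ t c′c≡ = record { leading = top ; bounded = above }
      where
      w = (ℤ.- t) · X^ δ
      coeff-M : ∀ i → coeff ((c′ ∷ []) * γ + π * w) i ≡ c′ ℤ.* coeff γ i ℤ.+ + p ℤ.* (ℤ.- t ℤ.* coeff (X^ δ) i)
      coeff-M i = ≡.trans (coeff-+ ((c′ ∷ []) * γ) (π * w) i) (cong₂ ℤ._+_ (≡.trans (at (const-* c′ γ) i) (coeff-· c′ γ i)) (≡.trans (at (π* w) i) (≡.trans (coeff-· (+ p) w i) (cong (ℤ._*_ (+ p)) (coeff-· (ℤ.- t) (X^ δ) i)))))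
      top : coeff ((c′ ∷ []) * γ + π * w) δ ≡ 1ℤ
      top = ≡.trans (coeff-M δ) (≡.trans (cong₂ (λ a b → a ℤ.+ + p ℤ.* (ℤ.- t ℤ.* b)) c′c≡ (coeff-X^ δ)) (ident (+ p) t))
        where
        ident : ∀ p t → 1ℤ ℤ.+ p ℤ.* t ℤ.+ p ℤ.* (ℤ.- t ℤ.* 1ℤ) ≡ 1ℤ
        ident = solve-∀
      above : DegLt (suc δ) ((c′ ∷ []) * γ + π * w)
      above i δ<i = ≡.trans (coeff-M i) (≡.trans (cong₂ (λ a b → c′ ℤ.* a ℤ.+ + p ℤ.* (ℤ.- t ℤ.* b)) (γ<δ+1 i δ<i) (X^< δ i δ<i)) (ident c′ (+ p) t))
        where
        ident : ∀ c p t → c ℤ.* 0ℤ ℤ.+ p ℤ.* (ℤ.- t ℤ.* 0ℤ) ≡ 0ℤ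
        ident = solve-∀

    -- If `p` divides the remainder, then `φ` is `q * M` modulo `p`, and irreducibility makes one
    -- factor a unit. It cannot be `q`, for then `M` would lie in `I`, being monic of degree less
    -- than `d`.
    euclidStep : ∀ {δ M q r} → δ < d → MonicOfDegree δ M → φ ≈ q * M + r → + p ∣ₚ r ⊎ Invertible r → Invertible M
    euclidStep {δ} {M} {q} {r} _ _ φ≈ (inj₂ r-inv) = invertible-remainder {q} {M} {r} φ≈ r-inv
    euclidStep {δ} {M} {q} {r} δ<d M-monic φ≈ (inj₁ p∣r) =
      [ (λ q-unit → contradiction (unitMod-cofactor {q} {M} {r} φ≈ (∣ₚ⇒I {r} p∣r) q-unit) M∉I) , unitMod⇒invertible {M} ]′ (split-irreducible q M r φ≈ p∣r)
      where
      M∉I : ¬ I M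
      M∉I M∈I = p∤1 (subst (+ p ∣_) (leading M-monic) (reduced {M} (DegLt-≤ {f = M} δ<d (bounded M-monic)) M∈I δ))

    -- Euclid's algorithm for φ and γ over ℤ/pℤ.
    invert : ∀ δ → δ ≤ d → ∀ γ → DegLt δ γ → + p ∣ₚ γ ⊎ Invertible γ
    invert zero _ γ γ<0 = inj₁ λ i → subst (+ p ∣_) (≡.sym (γ<0 i z≤n)) ((+ p) ∣0)
    invert (suc δ) δ<d γ γ<δ+1 = leadingCase (+ p ∣? coeff γ δ)
      where
      leadingCase : Dec (+ p ∣ coeff γ δ) → + p ∣ₚ γ ⊎ Invertible γ
      leadingCase (yes (divides q c≡qp)) = Sum.map
        (λ p∣γ′ → ∣ₚ-resp (sym γ≈) (∣ₚ-+ γ′ (π * (q · X^ δ)) p∣γ′ (π∣ₚ (q · X^ δ))))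
        (invertible-shift {γ} {γ′} (π * (q · X^ δ)) (I-π (q · X^ δ)) γ≈)
        (invert δ (ℕ.<⇒≤ δ<d) γ′ (dropTop< δ γ γ<δ+1))
        where
        γ′ = dropTop δ γ
        γ≈ : γ ≈ γ′ + π * (q · X^ δ)
        γ≈ = dropTop≈ δ γ q c≡qp
      leadingCase (no p∤c) = inj₂ (divide (bezout pp (coeff γ δ) p∤c))
        where
        divide : (∃₂ λ c′ t → c′ ℤ.* coeff γ δ ≡ 1ℤ ℤ.+ + p ℤ.* t) → Invertible γ
        divide (c′ , t , c′c≡) = invertible-factor {γ} {M} (c′ ∷ []) w (I-π ((ℤ.- t) · X^ δ)) refl (remainder (divMod M-monic φ))
          where
          w = π * ((ℤ.- t) · X^ δ)
          M = (c′ ∷ []) * γ + w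
          M-monic : MonicOfDegree δ M
          M-monic = monicMultiple δ γ γ<δ+1 c′ t c′c≡
          remainder : (∃₂ λ q r → φ ≋ q *ₚ M +ₚ r × DegLt δ r) → Invertible M
          remainder (q , r , φ≈ , r<δ) = euclidStep {δ} {M} {q} {r} δ<d M-monic φ≈ (invert δ (ℕ.<⇒≤ δ<d) r r<δ)

    -- So the quotient by `I` is a field: division by `φ` leaves a remainder of degree less than
    -- `d`, which `invert` handles.
    I⊎Invertible : ∀ γ → I γ ⊎ Invertible γ
    I⊎Invertible γ = remainder (divMod monic γ)
      where
      remainder : (∃₂ λ q r → γ ≋ q *ₚ φ +ₚ r × DegLt d r) → I γ ⊎ Invertible γ
      remainder (q , r , γ≈ , r<d) = Sum.map
        (λ p∣r → I-resp {r + φ * q} {γ} (sym γ≈′) (I-+ {r} {φ * q} (∣ₚ⇒I {r} p∣r) (I-φ q)))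
        (invertible-shift {γ} {r} (φ * q) (I-φ q) γ≈′) (invert d ℕ.≤-refl r r<d)
        where
        γ≈′ : γ ≈ r + φ * q
        γ≈′ = trans γ≈ (trans (+-comm (q * φ) r) (+-congˡ {r} {q * φ} {φ * q} (*-comm q φ)))

    I-prime : ∀ {γ η} → I (γ * η) → I γ ⊎ I η
    I-prime {γ} {η} γη∈I = Sum.map₂ (λ γ-inv → invertible-cancel {γ} {η} γ-inv γη∈I) (I⊎Invertible γ)

    open Valuation cancel-π φ-regular I-prime public

    digit : ∀ g → DegLt d g → Digit g
    digit g g<d zero = inj₁ (g , sym (*-identityˡ g))
    digit g g<d (suc B) = step (digit g g<d B)
      where
      instance _ = ℕ.m^n≢0 p B
      Dichotomy : ℕ → Set
      Dichotomy B = (∃ λ h → g ≈ π ^ B * h) ⊎ (∃₂ λ a γ → a < B × g ≈ π ^ a * γ × ¬ I γ)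
      quotient< : ∀ h → g ≈ π ^ B * h → DegLt d h
      quotient< h g≈ i d≤i = ℤ.*-cancelˡ-≡ (+ (p ℕ.^ B)) (coeff h i) 0ℤ
        (≡.trans (≡.sym (coeff-· (+ (p ℕ.^ B)) h i)) (≡.trans (≡.sym (at (trans g≈ (π^* B h)) i)) (≡.trans (g<d i d≤i) (≡.sym (ℤ.*-zeroʳ (+ (p ℕ.^ B)))))))
      exact : ∀ h → g ≈ π ^ B * h → Dec (+ p ∣ₚ h) → Dichotomy (suc B)
      exact h g≈ (yes p∣h) = let h′ , h≈ = ∣ₚ⇒π {h} p∣h in inj₁ (h′ , π^-suc {g} B h′ {h} g≈ h≈)
      exact h g≈ (no p∤h)  = inj₂ (B , h , ℕ.n<1+n B , g≈ , λ h∈I → p∤h (reduced {h} (quotient< h g≈) h∈I))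
      step : Dichotomy B → Dichotomy (suc B)
      step (inj₁ (h , g≈)) = exact h g≈ (∣ₚ? (+ p) h)
      step (inj₂ (a , γ , a<B , g≈ , γ∉I)) = inj₂ (a , γ , ℕ.m<n⇒m<1+n a<B , g≈ , γ∉I)

    lastDigit : ∀ g → DegLt d g → ¬ + p ∣ₚ g → ¬ I g
    lastDigit g g<d p∤g g∈I = p∤g (reduced {g} g<d g∈I)

    -- The second hypothesis says that `G` does not fall below degree `n * d` modulo `p`. It passes
    -- to the quotient by `φ` through `∣-cofactor⁻¹` and finally states that the top digit is not
    -- divisible by `p`.
    expand : ∀ n G → DegLt (suc n ℕ.* d) G → ¬ (∀ i → n ℕ.* d ≤ i → + p ∣ coeff G i) →
             ∃₂ λ g gs → Digits n (g ∷ gs) × G ≈ eval (g ∷ gs) × DegLt d g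
    expand zero G G< p∤G = G , [] , last (lastDigit G G<d (λ p∣G → p∤G λ i _ → p∣G i)) ,
      sym (trans (+-congˡ {G} {φ * []} {[]} (zeroʳ φ)) (+-identityʳ G)) , G<d
      where
      G<d : DegLt d G
      G<d = subst (λ k → DegLt k G) (ℕ.+-identityʳ d) G<
    expand (suc n) G G< p∤G = divided (divMod monic G)
      where
      Expansion : ℕ → Poly → Set
      Expansion n G = ∃₂ λ g gs → Digits n (g ∷ gs) × G ≈ eval (g ∷ gs) × DegLt d g
      divided : (∃₂ λ q r → G ≋ q *ₚ φ +ₚ r × DegLt d r) → Expansion (suc n) G
      divided (q , r , G≈ , r<d) = prepend (expand n q q< p∤q)
        where
        q< : DegLt (suc n ℕ.* d) q
        q< i n≤i = 0∣⇒≡0 (∣-cofactor monic 0ℤ (suc n ℕ.* d) q r r<d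
          (λ j h → subst (0ℤ ∣_) (≡.trans (≡.sym (G< j (ℕ.≤-trans (ℕ.≤-reflexive (ℕ.+-comm d (suc n ℕ.* d))) h))) (at G≈ j)) (0ℤ ∣0)) i n≤i)
        p∤q : ¬ (∀ i → n ℕ.* d ≤ i → + p ∣ coeff q i)
        p∤q p∣q = p∤G λ i h → subst (+ p ∣_)
          (≡.sym (≡.trans (at G≈ i) (≡.trans (coeff-+ (q * φ) r i) (≡.trans (cong (ℤ._+_ (coeff (q * φ) i)) (r<d i (ℕ.≤-trans (ℕ.m≤m+n d _) h))) (ℤ.+-identityʳ (coeff (q * φ) i))))))
          (∣-cofactor⁻¹ monic (+ p) (n ℕ.* d) q p∣q i (ℕ.≤-trans (ℕ.≤-reflexive (ℕ.+-comm (n ℕ.* d) d)) h))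
        prepend : Expansion n q → Expansion (suc n) G
        prepend (g , gs , digits , q≈ , _) = r , g ∷ gs , cons (digit r r<d) digits ,
          trans G≈ (trans (+-comm (q * φ) r) (+-congˡ {r} {q * φ} {φ * eval (g ∷ gs)} (trans (*-comm q φ) (*-congˡ {φ} {q} {eval (g ∷ gs)} q≈)))) , r<d

-- Excluding factorisations over the integers

module IntegerFactorisation where

  open import Defs using (IrreducibleMod)
  open import Algebra.Bundles using (CommutativeRing)
  open import Data.Empty using (⊥)
  open import Data.Fin.Base as Fin using (Fin; toℕ; zero; suc)
  open import Data.Fin.Properties using (toℕ<n)
  open import Data.Integer.Base as ℤ using (ℤ; +_; 1ℤ)
  import Data.Integer.Properties as ℤ
  open import Data.Integer.Divisibility.Signed using (_∣_; divides; ∣ᵤ⇒∣; ∣⇒∣ᵤ; ∣m⇒∣m*n; ∣n⇒∣m*n; *-cancelˡ-∣; ∣-trans)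
  open import Data.List.Base using (List; []; _∷_)
  open import Data.Nat.Base as ℕ using (ℕ; zero; suc; _≤_; _<_; s≤s; z≤n)
  import Data.Nat.Properties as ℕ
  import Data.Nat.Divisibility as ℕ
  import Data.Nat.DivMod as ℕ
  open import Data.Nat.Primality using (Prime; prime⇒nonZero; euclidsLemma)
  open import Data.Product.Base using (∃; ∃₂; _×_; _,_; proj₁; proj₂)
  open import Data.Sum.Base as Sum using (_⊎_; inj₁; inj₂; [_,_]′)
  open import Function.Base using (_∘_)
  open import Relation.Binary.PropositionalEquality as ≡ using (_≡_; cong; cong₂; subst)
  open import Relation.Nullary using (¬_; contradiction)
  open OddPrimes using (∏; OddPrime; p^e∣m*n⇒p^e∣n; 1<p; ∏-split; oddProduct; oddProduct-valuation; primeNearTop)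
  open IntegerPolynomials
  open ModuloPrime

  -- The integer `u (2 * n) / u (2 * j)`, for `j ≤ n`.
  cofactor : ℕ → ℕ → ℕ
  cofactor n j = ∏ (λ i → 1 ℕ.+ 2 ℕ.* (j ℕ.+ i)) (n ℕ.∸ j)

  cofactor-* : ∀ n j → j ≤ n → oddProduct n ≡ oddProduct j ℕ.* cofactor n j
  cofactor-* n j j≤n = ≡.trans (cong oddProduct (≡.sym (ℕ.m+[n∸m]≡n j≤n))) (∏-split (λ i → 1 ℕ.+ 2 ℕ.* i) j (n ℕ.∸ j))

  ∣∏ : ∀ f n i → i < n → f i ℕ.∣ ∏ f n
  ∣∏ f (suc n) i i<n with ℕ.m≤n⇒m<n∨m≡n (ℕ.s≤s⁻¹ i<n)
  ... | inj₁ i<n′ = ℕ.∣-trans (∣∏ f n i i<n′) (ℕ.m∣m*n (f n))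
  ... | inj₂ ≡.refl = ℕ.n∣m*n (∏ f n)

  odd∣cofactor : ∀ n j τ → j ≤ τ → τ < n → 1 ℕ.+ 2 ℕ.* τ ℕ.∣ cofactor n j
  odd∣cofactor n j τ j≤τ τ<n = subst (λ t → 1 ℕ.+ 2 ℕ.* t ℕ.∣ cofactor n j) (ℕ.m+[n∸m]≡n j≤τ)
    (∣∏ (λ i → 1 ℕ.+ 2 ℕ.* (j ℕ.+ i)) (n ℕ.∸ j) (τ ℕ.∸ j) (ℕ.∸-monoˡ-< τ<n j≤τ))

  sum-closed : ∀ {P : Poly → Set} → P [] → (∀ {f g} → P f → P g → P (f +ₚ g)) →
               ∀ {n} (f : Fin n → Poly) → (∀ j → P (f j)) → P (sum f)
  sum-closed P0 P+ {zero}  f Pf = P0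
  sum-closed {P} P0 P+ {suc n} f Pf = P+ {f zero} {sum (f ∘ suc)} (Pf zero) (sum-closed {P} P0 P+ (f ∘ suc) (Pf ∘ suc))

  ^-monic : ∀ {d φ} → MonicOfDegree d φ → ∀ k → MonicOfDegree (k ℕ.* d) (φ ^ k)
  ^-monic monic zero = record { leading = ≡.refl ; bounded = λ { (suc i) _ → ≡.refl } }
  ^-monic {d} {φ} monic (suc k) = record
    { leading = ≡.trans (proj₂ top) (cong₂ ℤ._*_ (leading monic) (leading (^-monic monic k)))
    ; bounded = proj₁ top }
    where top = degree-* {d} {k ℕ.* d} φ (φ ^ k) (bounded monic) (bounded (^-monic monic k))

  module Factorisation
    (n-1 : ℕ) (2≤n : 2 ≤ suc n-1) (aₙ : ℤ) (d : ℕ) (φ : Poly) (1≤d : 1 ≤ d)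
    (monic : MonicOfDegree d φ)
    (irr : ∀ p → Prime p → p < 2 ℕ.* suc n-1 → IrreducibleMod p φ)
    (a : Fin (suc n-1) → Poly) (a<d : ∀ j → DegLt d (a j))
    (p∤aₙ : ∀ p → Prime p → p < 2 ℕ.* suc n-1 → ¬ + p ∣ aₙ)
    (p∤a₀ : ∀ p → Prime p → p < 2 ℕ.* suc n-1 → ¬ + p ∣ₚ a zero)
    where

    private
      n : ℕ
      n = suc n-1

    summand : Fin n → Poly
    summand j = a j *ₚ ((+ cofactor n (toℕ j)) · φ ^ (2 ℕ.* toℕ j))

    F : Poly
    F = aₙ · φ ^ (2 ℕ.* n) +ₚ sum summand

    summand< : ∀ j → DegLt (2 ℕ.* n ℕ.* d) (summand j)
    summand< j = DegLt-≤ {f = summand j} bound (proj₁ (degree-* {ℕ.pred d} {2 ℕ.* toℕ j ℕ.* d} (a j) ((+ cofactor n (toℕ j)) · φ ^ (2 ℕ.* toℕ j)) (subst (λ k → DegLt k (a j)) (≡.sym (ℕ.suc-pred d)) (a<d j)) (DegLt-· (+ cofactor n (toℕ j)) (φ ^ (2 ℕ.* toℕ j)) (bounded (^-monic monic (2 ℕ.* toℕ j))))))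
      where
      instance _ = ℕ.>-nonZero 1≤d
      bound : suc (ℕ.pred d ℕ.+ 2 ℕ.* toℕ j ℕ.* d) ≤ 2 ℕ.* n ℕ.* d
      bound = ℕ.≤-trans (ℕ.≤-reflexive (cong (ℕ._+ 2 ℕ.* toℕ j ℕ.* d) (ℕ.suc-pred d)))
        (ℕ.*-monoˡ-≤ d {suc (2 ℕ.* toℕ j)} (ℕ.*-monoʳ-< 2 (toℕ<n j)))

    F-top : coeff F (2 ℕ.* n ℕ.* d) ≡ aₙ
    F-top = ≡.trans (coeff-+ (aₙ · φ ^ (2 ℕ.* n)) (sum summand) (2 ℕ.* n ℕ.* d)) (≡.trans (cong₂ ℤ._+_
      (≡.trans (coeff-· aₙ (φ ^ (2 ℕ.* n)) (2 ℕ.* n ℕ.* d)) (≡.trans (cong (ℤ._*_ aₙ) (leading (^-monic monic (2 ℕ.* n)))) (ℤ.*-identityʳ aₙ)))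
      (sum-closed {DegLt (2 ℕ.* n ℕ.* d)} (λ _ _ → ≡.refl) (λ {f} {g} → DegLt-+ f g) summand summand< (2 ℕ.* n ℕ.* d) ℕ.≤-refl)) (ℤ.+-identityʳ aₙ))

    F< : DegLt (suc (2 ℕ.* n ℕ.* d)) F
    F< = DegLt-+ (aₙ · φ ^ (2 ℕ.* n)) (sum summand) (DegLt-· aₙ (φ ^ (2 ℕ.* n)) (bounded (^-monic monic (2 ℕ.* n))))
      (DegLt-≤ {f = sum summand} (ℕ.n≤1+n _) (sum-closed {DegLt (2 ℕ.* n ℕ.* d)} (λ _ _ → ≡.refl) (λ {f} {g} → DegLt-+ f g) summand summand<))

    module AtPrime (p : ℕ) (op : OddPrime p) (p<2n : p < 2 ℕ.* n) where

      pp : Prime p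
      pp = proj₁ op

      module K = KeyPolynomial p pp d φ monic (irr p pp p<2n)
      open K using (π; π^*; I)
      open CommutativeRing polyCommutativeRing using (_≈_; _+_; _*_; refl; sym; trans; +-comm; *-comm; *-assoc; distribˡ; +-assoc; zeroʳ; *-identityʳ)

      power≈ : ∀ k → φ ^ k ≈ φ K.^ k
      power≈ zero    = refl
      power≈ (suc k) = *ₚ-congˡ φ (power≈ k)

      ·-* : ∀ c f g → f * (c · g) ≈ (c · f) * g
      ·-* c f g = trans (*-comm f (c · g)) (trans (·-*ₚ c g f) (trans (·-cong {c} {c} {g * f} {f * g} ≡.refl (*-comm g f)) (sym (·-*ₚ c f g))))

      module Weighted (k L : ℕ) (1≤k : 1 ≤ k) where
        open K.Weights k L 1≤k

        -- The two bounds for the minimal weight `s` of a factor that the argument needs: the top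
        -- digit, at `φ ^ I` and prime to `p`, gives `L * I`; the constant digit `g`, divisible by
        -- the `c`-th power of `p`, gives `k * c`.
        Leading : ℕ → Poly → ℕ → Set
        Leading I g s = s ≤ L ℕ.* I × ∃₂ λ c x → g ≈ π K.^ c * x × s ≤ k ℕ.* c

        F∈W : ∀ {T} → T ≤ L ℕ.* (2 ℕ.* n) → (∀ j → j < n → ∃ λ e → p ℕ.^ e ℕ.∣ cofactor n j × T ≤ weight e (2 ℕ.* j)) → W T F
        F∈W {T} T≤ terms = plus
          (W-term 0 (2 ℕ.* n) (aₙ ∷ []) (trans (sym (const-* aₙ (φ ^ (2 ℕ.* n)))) (*ₚ-congˡ (aₙ ∷ []) (trans (power≈ (2 ℕ.* n)) (sym (*ₚ-identityˡ (φ K.^ (2 ℕ.* n))))))) (ℕ.≤-trans T≤ (ℕ.m≤n+m _ (k ℕ.* 0))))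
          (sum-closed {W T} W-0 plus summand (λ j → term∈W j (terms (toℕ j) (toℕ<n j))))
          where
          term∈W : ∀ j → (∃ λ e → p ℕ.^ e ℕ.∣ cofactor n (toℕ j) × T ≤ weight e (2 ℕ.* toℕ j)) → W T (summand j)
          term∈W j (e , ℕ.divides q c≡ , T≤) = W-term e (2 ℕ.* toℕ j) (+ q · a j) (trans (*ₚ-congˡ (a j) eq) (·-* (+ q) (a j) (π K.^ e * φ K.^ (2 ℕ.* toℕ j)))) T≤
            where
            eq : (+ cofactor n (toℕ j)) · φ ^ (2 ℕ.* toℕ j) ≈ + q · (π K.^ e * φ K.^ (2 ℕ.* toℕ j))
            eq = trans (·-cong (≡.trans (cong +_ c≡) (ℤ.pos-* q (p ℕ.^ e))) (power≈ (2 ℕ.* toℕ j)))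
              (trans (·-assoc (+ q) (+ (p ℕ.^ e)) (φ K.^ (2 ℕ.* toℕ j))) (·-cong {+ q} ≡.refl (sym (π^* e (φ K.^ (2 ℕ.* toℕ j))))))

        weightBound : ∀ {I J g gs h hs T} → K.Digits I (g ∷ gs) → K.Digits J (h ∷ hs) → F ≈ K.eval (g ∷ gs) * K.eval (h ∷ hs) →
          T ≤ L ℕ.* (2 ℕ.* n) → (∀ j → j < n → ∃ λ e → p ℕ.^ e ℕ.∣ cofactor n j × T ≤ k ℕ.* e ℕ.+ L ℕ.* (2 ℕ.* j)) →
          ∃₂ λ s t → T ≤ s ℕ.+ t × Leading I g s × Leading J h t
        weightBound {I} {J} {g} {gs} {h} {hs} digits-g digits-h F≈ T≤ terms =
          A.s , B.s , weight-product {F = F} lfA lfB (F∈W T≤ terms) F≈ ,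
          (A.s≤ , A.c₀ , A.h₀ , A.g₀≈ , A.s≤Kc₀) , (B.s≤ , B.c₀ , B.h₀ , B.g₀≈ , B.s≤Kc₀)
          where
          lfA : LeadingForm I g (K.eval (g ∷ gs))
          lfA = leadingForm digits-g
          lfB : LeadingForm J h (K.eval (h ∷ hs))
          lfB = leadingForm digits-h
          module A = LeadingForm lfA
          module B = LeadingForm lfB

      F-modφ : ∃ λ X → F ≈ (+ oddProduct n) · a zero + φ * X
      F-modφ = proj₁ rest , trans (+ₚ-cong {aₙ · φ ^ (2 ℕ.* n)} {_} {sum summand} refl (+ₚ-cong {summand zero} {(+ oddProduct n) · a zero} {sum (summand ∘ suc)} head refl))
        (trans (swap (aₙ · φ ^ (2 ℕ.* n)) ((+ oddProduct n) · a zero) (sum (summand ∘ suc))) (+ₚ-cong {(+ oddProduct n) · a zero} refl (proj₂ rest)))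
        where
        φ∣ : Poly → Set
        φ∣ x = ∃ λ X → x ≈ φ * X
        φ∣+ : ∀ {x y} → φ∣ x → φ∣ y → φ∣ (x + y)
        φ∣+ (X , x≈) (Y , y≈) = X + Y , trans (+ₚ-cong x≈ y≈) (sym (distribˡ φ X Y))
        swap : ∀ x y z → x + (y + z) ≈ y + (x + z)
        swap x y z = trans (sym (+-assoc x y z)) (trans (+ₚ-cong (+-comm x y) refl) (+-assoc y x z))
        head : summand zero ≈ (+ oddProduct n) · a zero
        head = trans (·-* (+ oddProduct n) (a zero) (1ℤ ∷ [])) (*-identityʳ ((+ oddProduct n) · a zero))
        power : ∀ c k → φ∣ (c · φ ^ suc k)
        power c k = c · φ ^ k , trans (·-cong {c} ≡.refl (*-comm φ (φ ^ k))) (trans (sym (·-*ₚ c (φ ^ k) φ)) (*-comm (c · φ ^ k) φ))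
        φ∣* : ∀ f {x} → φ∣ x → φ∣ (f * x)
        φ∣* f (X , x≈) = f * X , trans (*ₚ-congˡ f x≈) (K.φ-swap f X)
        rest : φ∣ (aₙ · φ ^ (2 ℕ.* n) + sum (summand ∘ suc))
        rest = φ∣+ {aₙ · φ ^ (2 ℕ.* n)} {sum (summand ∘ suc)} (power aₙ (n-1 ℕ.+ (n ℕ.+ 0)))
          (sum-closed {φ∣} ([] , sym (zeroʳ φ)) (λ {f} {g} → φ∣+ {f} {g}) (summand ∘ suc) (λ j → φ∣* (a (suc j)) (power (+ cofactor n (toℕ (suc j))) (toℕ j ℕ.+ (suc (toℕ j) ℕ.+ 0)))))

      -- Modulo `φ` the product `g * h` equals `u (2 * n)` times `a zero`, which is already reduced,
      -- so any power of `p` dividing `g * h` divides it by uniqueness of remainders. Since `a zero`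
      -- is prime to `p`, that power divides `u (2 * n)`.
      constantTerm : ∀ {G H g h} gs hs → F ≈ G * H → G ≈ K.eval (g ∷ gs) → H ≈ K.eval (h ∷ hs) →
        ∀ V w → oddProduct n ≡ p ℕ.^ V ℕ.* w → p ℕ.∤ w → ∀ c c′ {x y} → g ≈ π K.^ c * x → h ≈ π K.^ c′ * y → c ℕ.+ c′ ≤ V
      constantTerm {G} {H} {g} {h} gs hs F≈ G≈ H≈ V w u≡ p∤w c c′ {x} {y} g≈ h≈ = ℕ.≮⇒≥ λ V<c → p∤a₀ p pp p<2n λ i → divisible i V<c
        where
        k = p ℕ.^ (c ℕ.+ c′)
        r = (+ oddProduct n) · a zero
        r<d : DegLt d r
        r<d = DegLt-· (+ oddProduct n) (a zero) (a<d zero)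
        Zφ+r = K.modφ-product {F} {g} {K.eval gs} {h} {K.eval hs} {r} {proj₁ F-modφ} (trans F≈ (*ₚ-cong {G} {K.eval (g ∷ gs)} {H} {K.eval (h ∷ hs)} G≈ H≈)) (proj₂ F-modφ)
        Z = proj₁ Zφ+r
        k∣Zφ+r : + k ∣ₚ Z *ₚ φ +ₚ r
        k∣Zφ+r = ∣ₚ-resp (sym (trans (proj₂ Zφ+r) (trans (K.π^-* c c′ {g} {h} {x} {y} g≈ h≈) (π^* (c ℕ.+ c′) (x * y))))) (∣ₚ-· (+ k) (x * y))
        k∣r : + k ∣ₚ r
        k∣r = ∣ₚ-+-cancelˡ (Z *ₚ φ) r k∣Zφ+r (∣ₚ-*ˡ φ Z λ i → ∣-cofactor monic (+ k) 0 Z r r<d (λ j _ → k∣Zφ+r j) i z≤n)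
        divisible : ∀ i → V < c ℕ.+ c′ → + p ∣ coeff (a zero) i
        divisible i V<c = ∣ᵤ⇒∣ ([ (λ p∣w → contradiction p∣w p∤w) , (λ p∣a → p∣a) ]′ (euclidsLemma w A pp (ℕ.*-cancelˡ-∣ (p ℕ.^ V) {{ℕ.m^n≢0 p V {{prime⇒nonZero pp}}}} pV)))
          where
          A = ℤ.∣ coeff (a zero) i ∣
          k∣ : k ℕ.∣ p ℕ.^ V ℕ.* (w ℕ.* A)
          k∣ = subst (k ℕ.∣_) (≡.trans (cong ℤ.∣_∣ (coeff-· (+ oddProduct n) (a zero) i)) (≡.trans (ℤ.abs-* (+ oddProduct n) (coeff (a zero) i)) (≡.trans (cong (ℕ._* A) u≡) (ℕ.*-assoc (p ℕ.^ V) w A)))) (∣⇒∣ᵤ (k∣r i))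
          pV : p ℕ.^ V ℕ.* p ℕ.∣ p ℕ.^ V ℕ.* (w ℕ.* A)
          pV = ℕ.∣-trans (subst (ℕ._∣ k) (ℕ.*-comm p (p ℕ.^ V)) (ℕ.divides (p ℕ.^ (c ℕ.+ c′ ℕ.∸ suc V)) (≡.trans (cong (p ℕ.^_) (≡.sym (ℕ.m∸n+n≡m V<c))) (ℕ.^-distribˡ-+-* p (c ℕ.+ c′ ℕ.∸ suc V) (suc V))))) k∣

      incompatible : (∀ j → ∃₂ λ v w → oddProduct j ≡ p ℕ.^ v ℕ.* w × p ℕ.∤ w × p ℕ.* v ≤ 2 ℕ.* j ℕ.∸ 1) →
        ∀ τ → τ < n → p ℕ.∣ 1 ℕ.+ 2 ℕ.* τ → ∀ {G H I J g gs h hs} → F ≈ G * H → I ≤ p → J ≤ 1 ℕ.+ 2 ℕ.* τ →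
        K.Digits I (g ∷ gs) → G ≈ K.eval (g ∷ gs) → K.Digits J (h ∷ hs) → H ≈ K.eval (h ∷ hs) → ⊥
      incompatible valuation τ τ<n p∣τ {G} {H} {I} {J} {g} {gs} {h} {hs} F≈ I≤p J≤ digits-g G≈ digits-h H≈ =
        shallow (Weighted.weightBound (2 ℕ.+ 2 ℕ.* τ) 1 (s≤s z≤n) digits-g digits-h F≈eval
          (ℕ.≤-trans 2τ+2≤2n (ℕ.≤-reflexive (≡.sym (ℕ.*-identityˡ (2 ℕ.* n))))) terms₂)
        where
        2τ+2≤2n : 2 ℕ.+ 2 ℕ.* τ ≤ 2 ℕ.* n
        2τ+2≤2n = ℕ.≤-trans (ℕ.≤-reflexive (≡.sym (ℕ.*-suc 2 τ))) (ℕ.*-monoʳ-≤ 2 τ<n)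
        V = proj₁ (valuation n)
        w = proj₁ (proj₂ (valuation n))
        u≡ = proj₁ (proj₂ (proj₂ (valuation n)))
        p∤w = proj₁ (proj₂ (proj₂ (proj₂ (valuation n))))
        c+c′≤V : ∀ c c′ {x y} → g ≈ π K.^ c * x → h ≈ π K.^ c′ * y → c ℕ.+ c′ ≤ V
        c+c′≤V c c′ {x} {y} = constantTerm {G} {H} {g} {h} gs hs F≈ G≈ H≈ V w u≡ p∤w c c′ {x} {y}
        F≈eval : F ≈ K.eval (g ∷ gs) * K.eval (h ∷ hs)
        F≈eval = ≋-trans F≈ (*ₚ-cong {G} {K.eval (g ∷ gs)} {H} {K.eval (h ∷ hs)} G≈ H≈)

        -- L₁ / K₁ is slightly smaller than 1 / p, but not smaller than v_p(u_2j) / 2j.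
        L₁ K₁ : ℕ
        L₁ = 2 ℕ.* n
        K₁ = suc (L₁ ℕ.* p)
        -- `K₁ * v` is `v + L₁ * (p * v)`, with `v ≤ 2 * n = L₁` and `p * v ≤ 2 * j ∸ 1`: the
        -- additional 1 in `K₁` is paid for by the strictness of the valuation bound.
        slope : ∀ j v → j ≤ n → p ℕ.* v ≤ 2 ℕ.* j ℕ.∸ 1 → K₁ ℕ.* v ≤ L₁ ℕ.* (2 ℕ.* j)
        slope j zero _ _ = ℕ.≤-trans (ℕ.≤-reflexive (ℕ.*-zeroʳ K₁)) z≤n
        slope zero v@(suc _) _ pv≤ = contradiction (ℕ.≤-trans (ℕ.*-mono-≤ (ℕ.<⇒≤ (1<p pp)) (s≤s z≤n)) pv≤) λ ()
        slope j@(suc _) v@(suc _) j≤n pv≤ = ℕ.≤-trans (ℕ.≤-reflexive (≡.cong (v ℕ.+_) (ℕ.*-assoc L₁ p v)))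
          (ℕ.≤-trans (ℕ.+-monoˡ-≤ (L₁ ℕ.* (p ℕ.* v)) (ℕ.≤-trans (ℕ.m≤n*m v p {{prime⇒nonZero pp}}) (ℕ.≤-trans (ℕ.<⇒≤ pv<2j) (ℕ.*-monoʳ-≤ 2 j≤n))))
            (ℕ.≤-trans (ℕ.≤-reflexive (≡.sym (ℕ.*-suc L₁ (p ℕ.* v)))) (ℕ.*-monoʳ-≤ L₁ pv<2j)))
          where
          pv<2j : p ℕ.* v < 2 ℕ.* j
          pv<2j = s≤s pv≤
        terms₁ : ∀ j → j < n → ∃ λ e → p ℕ.^ e ℕ.∣ cofactor n j × K₁ ℕ.* V ≤ K₁ ℕ.* e ℕ.+ L₁ ℕ.* (2 ℕ.* j)
        terms₁ j j<n = V ℕ.∸ v , divides-cofactor (ℕ.≤-total V v) , (begin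
          K₁ ℕ.* V                              ≤⟨ ℕ.*-monoʳ-≤ K₁ (ℕ.m≤n+m∸n V v) ⟩
          K₁ ℕ.* (v ℕ.+ (V ℕ.∸ v))              ≡⟨ ℕ.*-distribˡ-+ K₁ v (V ℕ.∸ v) ⟩
          K₁ ℕ.* v ℕ.+ K₁ ℕ.* (V ℕ.∸ v)         ≤⟨ ℕ.+-monoˡ-≤ _ (slope j v (ℕ.<⇒≤ j<n) (proj₂ (proj₂ (proj₂ (proj₂ (valuation j)))))) ⟩
          L₁ ℕ.* (2 ℕ.* j) ℕ.+ K₁ ℕ.* (V ℕ.∸ v) ≡⟨ ℕ.+-comm (L₁ ℕ.* (2 ℕ.* j)) _ ⟩
          K₁ ℕ.* (V ℕ.∸ v) ℕ.+ L₁ ℕ.* (2 ℕ.* j) ∎)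
          where
          open ℕ.≤-Reasoning
          v = proj₁ (valuation j)
          w′ = proj₁ (proj₂ (valuation j))
          u′≡ = proj₁ (proj₂ (proj₂ (valuation j)))
          p∤w′ = proj₁ (proj₂ (proj₂ (proj₂ (valuation j))))
          divides-cofactor : V ≤ v ⊎ v ≤ V → p ℕ.^ (V ℕ.∸ v) ℕ.∣ cofactor n j
          divides-cofactor (inj₁ V≤v) = subst (λ e → p ℕ.^ e ℕ.∣ cofactor n j) (≡.sym (ℕ.m≤n⇒m∸n≡0 V≤v)) (ℕ.1∣ _)
          divides-cofactor (inj₂ v≤V) = p^e∣m*n⇒p^e∣n pp w′ p∤w′ (V ℕ.∸ v) (cofactor n j)
            (subst (p ℕ.^ (V ℕ.∸ v) ℕ.∣_) (ℕ.*-cancelˡ-≡ _ _ (p ℕ.^ v) {{ℕ.m^n≢0 p v {{prime⇒nonZero pp}}}} (≡.trans (≡.sym (ℕ.*-assoc (p ℕ.^ v) (p ℕ.^ (V ℕ.∸ v)) w))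
              (≡.trans (cong (ℕ._* w) (≡.trans (≡.sym (ℕ.^-distribˡ-+-* p v (V ℕ.∸ v))) (cong (p ℕ.^_) (ℕ.m+[n∸m]≡n v≤V))))
                (≡.trans (≡.sym u≡) (≡.trans (cofactor-* n j (ℕ.<⇒≤ j<n)) (≡.trans (cong (ℕ._* cofactor n j) u′≡) (ℕ.*-assoc (p ℕ.^ v) w′ (cofactor n j)))))))) (ℕ.m∣m*n w))
        -- From `K₁ * V ≤ s + t` and `c₀ + c₀′ ≤ V` follows `K₁ * c₀ ≤ s ≤ L₁ * p < K₁`, so `c₀` and
        -- `s` vanish. The constant digit of `H` then carries all `V` factors `p`, and none is left
        -- for that of `G`.
        steep : (∃₂ λ s t → K₁ ℕ.* V ≤ s ℕ.+ t × Weighted.Leading K₁ L₁ (s≤s z≤n) I g s × Weighted.Leading K₁ L₁ (s≤s z≤n) J h t) →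
          ∀ c {x} → ¬ g ≈ π K.^ suc c * x
        steep (s , t , T≤ , (s≤ , c₀ , x₀ , g≈ , s≤Kc₀) , (_ , c₀′ , y₀ , h≈ , t≤Kc₀′)) c {x} g≈′ =
          ℕ.<⇒≱ (s≤s (ℕ.≤-trans V≤c′ (ℕ.m≤n+m c₀′ c))) (c+c′≤V (suc c) c₀′ {x} {y₀} g≈′ h≈)
          where
          Kc≤s : K₁ ℕ.* c₀ ≤ s
          Kc≤s = ℕ.+-cancelʳ-≤ (K₁ ℕ.* c₀′) _ _ (begin
            K₁ ℕ.* c₀ ℕ.+ K₁ ℕ.* c₀′   ≡⟨ ℕ.*-distribˡ-+ K₁ c₀ c₀′ ⟨
            K₁ ℕ.* (c₀ ℕ.+ c₀′)        ≤⟨ ℕ.*-monoʳ-≤ K₁ (c+c′≤V c₀ c₀′ {x₀} {y₀} g≈ h≈) ⟩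
            K₁ ℕ.* V                   ≤⟨ T≤ ⟩
            s ℕ.+ t                    ≤⟨ ℕ.+-monoʳ-≤ s t≤Kc₀′ ⟩
            s ℕ.+ K₁ ℕ.* c₀′           ∎)
            where open ℕ.≤-Reasoning
          c≡0 : c₀ ≡ 0
          c≡0 = ℕ.n<1⇒n≡0 (ℕ.*-cancelˡ-< K₁ c₀ 1 (ℕ.≤-<-trans Kc≤s (ℕ.≤-trans (s≤s (ℕ.≤-trans s≤ (ℕ.*-monoʳ-≤ L₁ I≤p))) (ℕ.≤-reflexive (≡.sym (ℕ.*-identityʳ K₁))))))
          s≤0 : s ≤ 0
          s≤0 = ℕ.≤-trans s≤Kc₀ (ℕ.≤-reflexive (≡.trans (cong (K₁ ℕ.*_) c≡0) (ℕ.*-zeroʳ K₁)))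
          V≤c′ : V ≤ c₀′
          V≤c′ = ℕ.*-cancelˡ-≤ K₁ (ℕ.≤-trans T≤ (ℕ.+-mono-≤ s≤0 t≤Kc₀′))
        p∤g : ∀ c {x} → ¬ g ≈ π K.^ suc c * x
        p∤g = steep (Weighted.weightBound K₁ L₁ (s≤s z≤n) digits-g digits-h F≈eval (slope n V ℕ.≤-refl (proj₂ (proj₂ (proj₂ (proj₂ (valuation n)))))) terms₁)

        -- With these weights F has weight 2 + 2 τ because p divides the coefficient of φ^2j for j ≤ τ.
        terms₂ : ∀ j → j < n → ∃ λ e → p ℕ.^ e ℕ.∣ cofactor n j × 2 ℕ.+ 2 ℕ.* τ ≤ (2 ℕ.+ 2 ℕ.* τ) ℕ.* e ℕ.+ 1 ℕ.* (2 ℕ.* j)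
        terms₂ j j<n = [ low , high ]′ (ℕ.≤-<-connex j τ)
          where
          low : j ≤ τ → ∃ λ e → p ℕ.^ e ℕ.∣ cofactor n j × 2 ℕ.+ 2 ℕ.* τ ≤ (2 ℕ.+ 2 ℕ.* τ) ℕ.* e ℕ.+ 1 ℕ.* (2 ℕ.* j)
          low j≤τ = 1 , subst (ℕ._∣ cofactor n j) (≡.sym (ℕ.*-identityʳ p)) (ℕ.∣-trans p∣τ (odd∣cofactor n j τ j≤τ τ<n)) ,
            ℕ.≤-trans (ℕ.≤-reflexive (≡.sym (ℕ.*-identityʳ (2 ℕ.+ 2 ℕ.* τ)))) (ℕ.m≤m+n ((2 ℕ.+ 2 ℕ.* τ) ℕ.* 1) (1 ℕ.* (2 ℕ.* j)))
          high : τ < j → ∃ λ e → p ℕ.^ e ℕ.∣ cofactor n j × 2 ℕ.+ 2 ℕ.* τ ≤ (2 ℕ.+ 2 ℕ.* τ) ℕ.* e ℕ.+ 1 ℕ.* (2 ℕ.* j)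
          high τ<j = 0 , ℕ.1∣ (cofactor n j) , ℕ.≤-trans (ℕ.≤-trans (ℕ.≤-reflexive (≡.sym (ℕ.*-suc 2 τ))) (ℕ.≤-trans (ℕ.*-monoʳ-≤ 2 τ<j) (ℕ.≤-reflexive (≡.sym (ℕ.*-identityˡ (2 ℕ.* j))))))
            (ℕ.m≤n+m (1 ℕ.* (2 ℕ.* j)) ((2 ℕ.+ 2 ℕ.* τ) ℕ.* 0))
        shallow : (∃₂ λ s t → 2 ℕ.+ 2 ℕ.* τ ≤ s ℕ.+ t × Weighted.Leading (2 ℕ.+ 2 ℕ.* τ) 1 (s≤s z≤n) I g s × Weighted.Leading (2 ℕ.+ 2 ℕ.* τ) 1 (s≤s z≤n) J h t) → ⊥
        shallow (s , t , T≤ , (_ , suc c , x , g≈ , _) , _) = p∤g c {x} g≈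
        -- Now `G` has weight 0, so `H` would need weight `2 + 2 * τ`; its top digit allows at most
        -- `J ≤ 1 + 2 * τ`.
        shallow (s , t , T≤ , (_ , zero , _ , _ , s≤0) , (t≤J , _)) = ℕ.<⇒≱ (s≤s J≤)
          (ℕ.≤-trans T≤ (ℕ.+-mono-≤ (ℕ.≤-trans s≤0 (ℕ.≤-reflexive (ℕ.*-zeroʳ (2 ℕ.+ 2 ℕ.* τ)))) (ℕ.≤-trans t≤J (ℕ.≤-reflexive (ℕ.*-identityˡ J)))))

    noFactorisation : ∀ G H eG eH → F ≋ G *ₚ H → DegLt (suc eG) G → DegLt (suc eH) H →
      coeff G eG ℤ.* coeff H eH ≡ aₙ → eG ℕ.+ eH ≡ 2 ℕ.* n ℕ.* d → 1 ≤ eG → eG ≤ eH → ⊥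
    noFactorisation G H eG eH F≈ G< H< top e≡ 1≤eG eG≤eH = contradict (primeNearTop n J 2≤n n≤J J<2n)
      where
      instance _ = ℕ.>-nonZero 1≤d
      I J : ℕ
      I = eG ℕ./ d
      J = eH ℕ./ d
      n≤J : n ≤ J
      n≤J = subst (_≤ J) (ℕ.m*n/n≡m n d) (ℕ./-monoˡ-≤ d (ℕ.*-cancelˡ-≤ 2 (ℕ.≤-trans (ℕ.≤-reflexive (≡.trans (≡.sym (ℕ.*-assoc 2 n d)) (≡.sym e≡)))
        (ℕ.≤-trans (ℕ.+-monoˡ-≤ eH eG≤eH) (ℕ.≤-reflexive (cong (eH ℕ.+_) (≡.sym (ℕ.+-identityʳ eH))))))))
      -- The only use of the positive degree of `G`: a constant `G` would allow `J = 2 * n`.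
      J<2n : J < 2 ℕ.* n
      J<2n = ℕ.m<n*o⇒m/o<n (ℕ.<-≤-trans (ℕ.m<n+m eH 1≤eG) (ℕ.≤-reflexive e≡))
      I+J≤2n : I ℕ.+ J ≤ 2 ℕ.* n
      I+J≤2n = ℕ.*-cancelʳ-≤ _ _ d (ℕ.≤-trans (ℕ.≤-reflexive (ℕ.*-distribʳ-+ d I J)) (ℕ.≤-trans (ℕ.+-mono-≤ (ℕ.m/n*n≤m eG d) (ℕ.m/n*n≤m eH d)) (ℕ.≤-reflexive e≡)))
      above : ∀ e → e < suc (e ℕ./ d) ℕ.* d
      above e = ℕ.≤-trans (ℕ.≤-reflexive (cong suc (ℕ.m≡m%n+[m/n]*n e d))) (ℕ.+-monoˡ-≤ (e ℕ./ d ℕ.* d) (ℕ.m%n<n e d))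
      contradict : (∃₂ λ p τ → OddPrime p × 2 ℕ.* n ≤ p ℕ.+ J × J ≤ 1 ℕ.+ 2 ℕ.* τ × τ < n × p ℕ.∣ 1 ℕ.+ 2 ℕ.* τ) → ⊥
      contradict (p , τ , op@(pp , 2<p) , 2n≤p+J , J≤ , τ<n , p∣τ) = finish
        (AtPrime.K.expand p op p<2n I G (DegLt-≤ {f = G} (above eG) G<) (λ h → p∤top (∣m⇒∣m*n (coeff H eH) (h eG (ℕ.m/n*n≤m eG d)))))
        (AtPrime.K.expand p op p<2n J H (DegLt-≤ {f = H} (above eH) H<) (λ h → p∤top (∣n⇒∣m*n (coeff G eG) (h eH (ℕ.m/n*n≤m eH d)))))
        where
        p<2n : p < 2 ℕ.* n
        p<2n = ℕ.≤-<-trans (ℕ.∣⇒≤ p∣τ) (ℕ.≤-trans (ℕ.≤-reflexive (≡.sym (ℕ.*-suc 2 τ))) (ℕ.*-monoʳ-≤ 2 τ<n))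
        -- The leading coefficients multiply to `aₙ`, so neither is divisible by `p`; this makes the
        -- top digits of both expansions prime to `p`.
        p∤top : ¬ + p ∣ coeff G eG ℤ.* coeff H eH
        p∤top p∣ = p∤aₙ p pp p<2n (subst (+ p ∣_) top p∣)
        finish : (∃₂ λ g gs → AtPrime.K.Digits p op p<2n I (g ∷ gs) × G ≋ AtPrime.K.eval p op p<2n (g ∷ gs) × DegLt d g) →
                 (∃₂ λ h hs → AtPrime.K.Digits p op p<2n J (h ∷ hs) × H ≋ AtPrime.K.eval p op p<2n (h ∷ hs) × DegLt d h) → ⊥
        finish (g , gs , digits-g , G≈ , _) (h , hs , digits-h , H≈ , _) =
          AtPrime.incompatible p op p<2n (oddProduct-valuation op) τ τ<n p∣τ {G} {H} {I} {J} {g} {gs} {h} {hs} F≈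
            (ℕ.+-cancelʳ-≤ J I p (ℕ.≤-trans I+J≤2n 2n≤p+J)) J≤ digits-g G≈ digits-h H≈

-- From rational to integral factorisations

module RationalPolynomials where

  open import Defs
  open import Algebra.Bundles using (CommutativeRing)
  import Algebra.Definitions.RawSemiring as SemiringDefs
  open import Data.Empty using (⊥; ⊥-elim)
  open import Data.Fin.Base as Fin using (Fin; toℕ; zero; suc; fromℕ<)
  open import Data.Fin.Properties using (toℕ<n)
  open import Data.Integer.Base as ℤ using (ℤ; +_; 0ℤ; 1ℤ)
  import Data.Integer.Properties as ℤ
  import Data.Integer.GCD as ℤ
  import Data.Integer.Divisibility
  open import Data.Integer.Divisibility.Signed using (_∣_; divides; ∣⇒∣ᵤ; ∣m⇒∣m*n; ∣n⇒∣m*n)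
  open import Data.List.Base using (List; []; _∷_; map)
  open import Data.List.Relation.Unary.All using (All; []; _∷_)
  open import Data.Nat.Base as ℕ using (ℕ; zero; suc; _≤_; _<_; s≤s; z≤n)
  import Data.Nat.Properties as ℕ
  import Data.Nat.Divisibility as ℕ
  open import Data.Nat.ListAction using (product)
  open import Data.Nat.Primality using (Prime; prime⇒nonZero; prime[2])
  open import Data.Nat.Primality.Factorisation using (factorise; module PrimeFactorisation)
  open import Data.Product.Base using (∃; ∃₂; _×_; _,_; proj₁; proj₂)
  open import Data.Rational.Base as ℚ using (ℚ; 0ℚ; 1ℚ; toℚᵘ)
  import Data.Rational.Properties as ℚ
  open import Data.Rational.Unnormalised.Base as ℚᵘ using (ℚᵘ; mkℚᵘ; *≡*)
  import Data.Rational.Unnormalised.Properties as ℚᵘ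
  open import Data.Sum.Base as Sum using (_⊎_; inj₁; inj₂; [_,_]′)
  open import Function.Base using (_∘_)
  open import Relation.Binary.PropositionalEquality as ≡ using (_≡_; _≢_; cong; cong₂; subst)
  open import Relation.Nullary using (¬_; yes; no; contradiction)
  open import Relation.Nullary.Construct.Add.Infimum using (⊥₋; [_])
  open import Relation.Binary.Construct.Add.Infimum.Strict ℕ._<_ using (_<₋_; ⊥₋<[_]; [_])
  open OddPrimes using (u≡oddProduct)
  open IntegerPolynomials
  open ModuloPrime using (module Reduction)
  open IntegerFactorisation

  module Q = PolynomialRing ℚ.+-*-commutativeRing

  ι : ℤ → ℚ
  ι = ℚ._/ 1

  toℚᵘ-ι : ∀ z → toℚᵘ (ι z) ℚᵘ.≃ mkℚᵘ z 0
  toℚᵘ-ι z = ℚ.toℚᵘ-fromℚᵘ (mkℚᵘ z 0)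

  ι-+ : ∀ a b → ι (a ℤ.+ b) ≡ ι a ℚ.+ ι b
  ι-+ a b = ℚ.toℚᵘ-injective (begin
    toℚᵘ (ι (a ℤ.+ b))            ≈⟨ toℚᵘ-ι (a ℤ.+ b) ⟩
    mkℚᵘ (a ℤ.+ b) 0              ≈⟨ *≡* (cong (ℤ._* 1ℤ) (≡.sym (cong₂ ℤ._+_ (ℤ.*-identityʳ a) (ℤ.*-identityʳ b)))) ⟩
    mkℚᵘ a 0 ℚᵘ.+ mkℚᵘ b 0        ≈⟨ ℚᵘ.+-cong (toℚᵘ-ι a) (toℚᵘ-ι b) ⟨
    toℚᵘ (ι a) ℚᵘ.+ toℚᵘ (ι b)    ≈⟨ ℚ.toℚᵘ-homo-+ (ι a) (ι b) ⟨
    toℚᵘ (ι a ℚ.+ ι b)            ∎)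
    where open ℚᵘ.≃-Reasoning

  ι-* : ∀ a b → ι (a ℤ.* b) ≡ ι a ℚ.* ι b
  ι-* a b = ℚ.toℚᵘ-injective (begin
    toℚᵘ (ι (a ℤ.* b))            ≈⟨ toℚᵘ-ι (a ℤ.* b) ⟩
    mkℚᵘ a 0 ℚᵘ.* mkℚᵘ b 0        ≈⟨ ℚᵘ.*-cong (toℚᵘ-ι a) (toℚᵘ-ι b) ⟨
    toℚᵘ (ι a) ℚᵘ.* toℚᵘ (ι b)    ≈⟨ ℚ.toℚᵘ-homo-* (ι a) (ι b) ⟨
    toℚᵘ (ι a ℚ.* ι b)            ∎)
    where open ℚᵘ.≃-Reasoning

  ι-injective : ∀ {a b} → ι a ≡ ι b → a ≡ b
  ι-injective {a} {b} ιa≡ιb with ℚᵘ.≃-trans (ℚᵘ.≃-sym (toℚᵘ-ι a)) (ℚᵘ.≃-trans (ℚᵘ.≃-reflexive (cong toℚᵘ ιa≡ιb)) (toℚᵘ-ι b))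
  ... | *≡* eq = ≡.trans (≡.sym (ℤ.*-identityʳ a)) (≡.trans eq (ℤ.*-identityʳ b))

  ι*/ : ∀ u .{{_ : ℕ.NonZero u}} b → ι (+ u) ℚ.* (b ℚ./ u) ≡ ι b
  ι*/ u@(suc u-1) b = ℚ.toℚᵘ-injective (begin
    toℚᵘ (ι (+ u) ℚ.* (b ℚ./ u))               ≈⟨ ℚ.toℚᵘ-homo-* (ι (+ u)) (b ℚ./ u) ⟩
    toℚᵘ (ι (+ u)) ℚᵘ.* toℚᵘ (b ℚ./ u)         ≈⟨ ℚᵘ.*-cong (toℚᵘ-ι (+ u)) (ℚ.toℚᵘ-fromℚᵘ (mkℚᵘ b u-1)) ⟩
    mkℚᵘ (+ u) 0 ℚᵘ.* mkℚᵘ b u-1               ≈⟨ *≡* (≡.trans (ℤ.*-identityʳ _) (≡.trans (ℤ.*-comm (+ u) b) (cong (λ x → b ℤ.* + x) (≡.sym (ℕ.*-identityˡ u))))) ⟩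
    mkℚᵘ b 0                                   ≈⟨ toℚᵘ-ι b ⟨
    toℚᵘ (ι b)                                 ∎)
    where open ℚᵘ.≃-Reasoning

  toℚ-+ : ∀ f g → map ι (f +ₚ g) ≡ map ι f Q.+ₚ map ι g
  toℚ-+ []      g       = ≡.refl
  toℚ-+ (a ∷ f) []      = ≡.refl
  toℚ-+ (a ∷ f) (b ∷ g) = cong₂ _∷_ (ι-+ a b) (toℚ-+ f g)

  toℚ-· : ∀ a f → map ι (a · f) ≡ ι a Q.· map ι f
  toℚ-· a []      = ≡.refl
  toℚ-· a (b ∷ f) = cong₂ _∷_ (ι-* a b) (toℚ-· a f)

  toℚ-* : ∀ f g → map ι (f *ₚ g) ≡ map ι f Q.*ₚ map ι g
  toℚ-* []      g = ≡.refl
  toℚ-* (a ∷ f) g = ≡.trans (toℚ-+ (a · g) (0ℤ ∷ (f *ₚ g))) (cong₂ Q._+ₚ_ (toℚ-· a g) (cong (0ℚ ∷_) (toℚ-* f g)))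

  toℚ-^ : ∀ f k → map ι (f ^ k) ≡ map ι f Q.^ k
  toℚ-^ f zero    = ≡.refl
  toℚ-^ f (suc k) = ≡.trans (toℚ-* f (f ^ k)) (cong (map ι f Q.*ₚ_) (toℚ-^ f k))

  coeff-toℚ : ∀ f i → Q.coeff (map ι f) i ≡ ι (coeff f i)
  coeff-toℚ []      i       = ≡.refl
  coeff-toℚ (a ∷ f) zero    = ≡.refl
  coeff-toℚ (a ∷ f) (suc i) = coeff-toℚ f i

  toℚ-injective : ∀ {f g} → map ι f Q.≋ map ι g → f ≋ g
  toℚ-injective {f} {g} eq .at i = ι-injective (≡.trans (≡.sym (coeff-toℚ f i)) (≡.trans (Q.at eq i) (coeff-toℚ g i)))

  ↧* : ∀ q → ι (+ ℚ.denominatorℕ q) ℚ.* q ≡ ι (ℚ.↥ q)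
  ↧* q = ≡.trans (cong (ι (+ ℚ.denominatorℕ q) ℚ.*_) (≡.sym (ℚ.↥p/↧p≡p q))) (ι*/ (ℚ.denominatorℕ q) (ℚ.↥ q))

  clearDenominators : ∀ g → ∃₂ λ D G → ℕ.NonZero D × map ι G Q.≋ ι (+ D) Q.· g
  clearDenominators [] = 1 , [] , _ , Q.≋-refl
  clearDenominators (q ∷ g) = let D , G , D≢0 , eq = clearDenominators g in
    k ℕ.* D , (ℚ.↥ q ℤ.* + D) ∷ (+ k · G) , ℕ.m*n≢0 k D {{_}} {{D≢0}} , Q.∷-cong (constant D) (higher D G eq)
    where
    k = ℚ.denominatorℕ q
    ι-kD : ∀ D → ι (+ (k ℕ.* D)) ≡ ι (+ k) ℚ.* ι (+ D)
    ι-kD D = ≡.trans (cong ι (ℤ.pos-* k D)) (ι-* (+ k) (+ D))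
    constant : ∀ D → ι (ℚ.↥ q ℤ.* + D) ≡ ι (+ (k ℕ.* D)) ℚ.* q
    constant D = begin
      ι (ℚ.↥ q ℤ.* + D)              ≡⟨ ι-* (ℚ.↥ q) (+ D) ⟩
      ι (ℚ.↥ q) ℚ.* ι (+ D)          ≡⟨ cong (ℚ._* ι (+ D)) (↧* q) ⟨
      ι (+ k) ℚ.* q ℚ.* ι (+ D)      ≡⟨ ℚ.*-assoc (ι (+ k)) q (ι (+ D)) ⟩
      ι (+ k) ℚ.* (q ℚ.* ι (+ D))    ≡⟨ cong (ι (+ k) ℚ.*_) (ℚ.*-comm q (ι (+ D))) ⟩
      ι (+ k) ℚ.* (ι (+ D) ℚ.* q)    ≡⟨ ℚ.*-assoc (ι (+ k)) (ι (+ D)) q ⟨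
      ι (+ k) ℚ.* ι (+ D) ℚ.* q      ≡⟨ cong (ℚ._* q) (ι-kD D) ⟨
      ι (+ (k ℕ.* D)) ℚ.* q          ∎
      where open ≡.≡-Reasoning
    higher : ∀ D G → map ι G Q.≋ ι (+ D) Q.· g → map ι (+ k · G) Q.≋ ι (+ (k ℕ.* D)) Q.· g
    higher D G eq = subst (Q._≋ ι (+ (k ℕ.* D)) Q.· g) (≡.sym (toℚ-· (+ k) G))
      (Q.≋-trans (Q.·-cong {ι (+ k)} ≡.refl eq) (Q.≋-trans (Q.≋-sym (Q.·-assoc (ι (+ k)) (ι (+ D)) g)) (Q.·-cong {f = g} {g} (≡.sym (ι-kD D)) Q.≋-refl)))

  degreeOf : ∀ f → f ≋ [] ⊎ ∃ λ e → DegLt (suc e) f × coeff f e ≢ 0ℤ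
  degreeOf [] = inj₁ ≋-refl
  degreeOf (a ∷ f) with degreeOf f
  ... | inj₂ (e , f< , top) = inj₂ (suc e , (λ { (suc i) (s≤s e<i) → f< i e<i }) , top)
  ... | inj₁ f≋[] with a ℤ.≟ 0ℤ
  ...   | yes a≡0 = inj₁ (mk λ { zero → a≡0 ; (suc i) → at f≋[] i })
  ...   | no a≢0 = inj₂ (0 , (λ { (suc i) _ → at f≋[] i }) , a≢0)

  IsMultiple : Poly → Poly → Set
  IsMultiple G′ G = ∃ λ k → ℕ.NonZero k × G ≋ + k · G′

  multiple-∘ : ∀ p .{{_ : ℕ.NonZero p}} {G G₁ G′} → G ≋ + p · G₁ → IsMultiple G′ G₁ → IsMultiple G′ G
  multiple-∘ p {{p≢0}} {G} {G₁} {G′} G≋ (k , k≢0 , G₁≋) = p ℕ.* k , ℕ.m*n≢0 p k {{p≢0}} {{k≢0}} ,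
    ≋-trans G≋ (≋-trans (·-cong {+ p} ≡.refl G₁≋) (≋-trans (≋-sym (·-assoc (+ p) (+ k) G′)) (·-cong {f = G′} {G′} (≡.sym (ℤ.pos-* p k)) ≋-refl)))

  -- By Gauss's lemma each prime of the constant divides `G` or `H` and is cancelled there. The new
  -- factors differ from the old ones by nonzero integers, so a constant factor found in the end
  -- still gives a unit over the rationals.
  primitiveFactors : ∀ {ps} → All Prime ps → ∀ F G H → G *ₚ H ≋ + product ps · F →
    ∃₂ λ G′ H′ → IsMultiple G′ G × IsMultiple H′ H × G′ *ₚ H′ ≋ F
  primitiveFactors [] F G H GH≋ = G , H , (1 , _ , ≋-sym (one G)) , (1 , _ , ≋-sym (one H)) , ≋-trans GH≋ (one F)
    where
    one : ∀ f → + 1 · f ≋ f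
    one f = ≋-trans (≋-sym (const-* 1ℤ f)) (*ₚ-identityˡ f)
  primitiveFactors {p ∷ ps} (pp ∷ pps) F G H GH≋ = [ inG , inH ]′ (gauss pp G H (∣ₚ-resp (≋-sym GH≋p) (∣ₚ-· (+ p) (+ product ps · F))))
    where
    instance _ = prime⇒nonZero pp
    Result : Set
    Result = ∃₂ λ G′ H′ → IsMultiple G′ G × IsMultiple H′ H × G′ *ₚ H′ ≋ F
    GH≋p : G *ₚ H ≋ + p · (+ product ps · F)
    GH≋p = ≋-trans GH≋ (≋-trans (·-cong {f = F} {F} (ℤ.pos-* p (product ps)) ≋-refl) (·-assoc (+ p) (+ product ps) F))
    inG : + p ∣ₚ G → Result
    inG p∣G =
      let G₁ , G≋ = ∣ₚ-quotient G p∣G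
          G′ , H′ , mG , mH , eq = primitiveFactors pps F G₁ H (scale-cancel p (G₁ *ₚ H) (+ product ps · F)
            (≋-trans (≋-sym (≋-trans (*ₚ-cong {G} {+ p · G₁} {H} G≋ ≋-refl) (·-*ₚ (+ p) G₁ H))) GH≋p))
      in G′ , H′ , multiple-∘ p G≋ mG , mH , eq
    inH : + p ∣ₚ H → Result
    inH p∣H =
      let H₁ , H≋ = ∣ₚ-quotient H p∣H
          G′ , H′ , mG , mH , eq = primitiveFactors pps F G H₁ (scale-cancel p (G *ₚ H₁) (+ product ps · F)
            (≋-trans (≋-sym (≋-trans (*ₚ-congˡ G H≋) (*ₚ-· G (+ p) H₁))) GH≋p))
      in G′ , H′ , mG , multiple-∘ p H≋ mH , eq

  integralFactors : ∀ c .{{_ : ℕ.NonZero c}} F G H → G *ₚ H ≋ + c · F →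
    ∃₂ λ G′ H′ → IsMultiple G′ G × IsMultiple H′ H × G′ *ₚ H′ ≋ F
  integralFactors c F G H GH≋ = primitiveFactors factorsPrime F G H (subst (λ c → G *ₚ H ≋ + c · F) isFactorisation GH≋)
    where open PrimeFactorisation (factorise c)

  deg-⊥ : ∀ f → deg f ≡ ⊥₋ → DegLt 0 f
  deg-⊥ [] _ i _ = ≡.refl
  deg-⊥ (a ∷ f) eq i _ with deg f in deg-f
  deg-⊥ (a ∷ f) () i _ | [ _ ]
  deg-⊥ (a ∷ f) eq i _ | ⊥₋ with a ℤ.≟ 0ℤ
  deg-⊥ (a ∷ f) eq zero    _ | ⊥₋ | yes a≡0 = a≡0
  deg-⊥ (a ∷ f) eq (suc i) _ | ⊥₋ | yes _   = deg-⊥ f deg-f i z≤n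
  deg-⊥ (a ∷ f) () i       _ | ⊥₋ | no _

  deg-[] : ∀ f d → deg f ≡ [ d ] → DegLt (suc d) f
  deg-[] (a ∷ f) d eq i d<i with deg f in deg-f
  deg-[] (a ∷ f) .(suc e) ≡.refl (suc i) (s≤s e<i) | [ e ] = deg-[] f e deg-f i e<i
  deg-[] (a ∷ f) d eq (suc i) d<i | ⊥₋ = deg-⊥ f deg-f i z≤n

  <deg⇒DegLt : ∀ f φ d → deg φ ≡ [ d ] → f <deg φ → DegLt d f
  <deg⇒DegLt f φ d deg-φ f<φ = go (deg f) ≡.refl (subst (deg f <₋_) deg-φ f<φ)
    where
    go : ∀ x → deg f ≡ x → x <₋ [ d ] → DegLt d f
    go .⊥₋ deg-f ⊥₋<[ _ ] = DegLt-≤ {f = f} z≤n (deg-⊥ f deg-f)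
    go .([ _ ]) deg-f ([_] {k} k<d) = DegLt-≤ {f = f} k<d (deg-[] f k deg-f)

  ∣content : ∀ p f → + p ∣ₚ f → Data.Integer.Divisibility._∣_ (+ p) (content f)
  ∣content p [] _ = ℕ._∣0 p
  ∣content p (a ∷ f) p∣ = ℤ.gcd-greatest {a} {content f} {+ p} (∣⇒∣ᵤ (p∣ 0)) (∣content p f (λ i → p∣ (suc i)))

  ι-inverse : ∀ z → z ≢ 0ℤ → ∃ λ r → r ℚ.* ι z ≡ 1ℚ
  ι-inverse (+ zero)        z≢0 = contradiction ≡.refl z≢0
  ι-inverse (+ m@(suc _))   _   = 1ℤ ℚ./ m , ≡.trans (ℚ.*-comm _ (ι (+ m))) (ι*/ m 1ℤ)
  ι-inverse (ℤ.-[1+ m-1 ])  _   = ι ℤ.-1ℤ ℚ.* (1ℤ ℚ./ m) , (begin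
    ι ℤ.-1ℤ ℚ.* r ℚ.* ι (ℤ.- + m)               ≡⟨ cong (λ x → ι ℤ.-1ℤ ℚ.* r ℚ.* ι x) (ℤ.-1*i≡-i (+ m)) ⟨
    ι ℤ.-1ℤ ℚ.* r ℚ.* ι (ℤ.-1ℤ ℤ.* + m)         ≡⟨ cong (ι ℤ.-1ℤ ℚ.* r ℚ.*_) (≡.trans (cong ι (ℤ.*-comm ℤ.-1ℤ (+ m))) (ι-* (+ m) ℤ.-1ℤ)) ⟩
    ι ℤ.-1ℤ ℚ.* r ℚ.* (ι (+ m) ℚ.* ι ℤ.-1ℤ)     ≡⟨ ℚ.*-assoc (ι ℤ.-1ℤ) r _ ⟩
    ι ℤ.-1ℤ ℚ.* (r ℚ.* (ι (+ m) ℚ.* ι ℤ.-1ℤ))   ≡⟨ cong (ι ℤ.-1ℤ ℚ.*_) (≡.trans (≡.sym (ℚ.*-assoc r (ι (+ m)) (ι ℤ.-1ℤ))) (≡.trans (cong (ℚ._* ι ℤ.-1ℤ) (≡.trans (ℚ.*-comm r (ι (+ m))) (ι*/ m 1ℤ))) (ℚ.*-identityˡ (ι ℤ.-1ℤ)))) ⟩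
    ι ℤ.-1ℤ ℚ.* ι ℤ.-1ℤ                         ≡⟨⟩
    1ℚ                                          ∎)
    where
    open ≡.≡-Reasoning
    m = suc m-1
    r = 1ℤ ℚ./ m

  constant⇒unit : ∀ {g G G′ D} → map ι G Q.≋ ι (+ D) Q.· g → IsMultiple G′ G → DegLt 1 G′ → coeff G′ 0 ≢ 0ℤ →
                  ∃ λ q → q Q.*ₚ g Q.≋ (1ℚ ∷ [])
  constant⇒unit {g} {G} {G′} {D} G≋ (k , k≢0 , G≋kG′) G′< G′≢0 = ((r ℚ.* ι (+ D)) ∷ []) ,
    Q.≋-trans (Q.const-* (r ℚ.* ι (+ D)) g) (Q.≋-trans (Q.·-assoc r (ι (+ D)) g) (Q.≋-trans (Q.·-cong {r} ≡.refl (Q.≋-sym G≋)) (Q.mk coeffs)))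
    where
    instance _ = k≢0
    G-coeff : ∀ i → coeff G i ≡ + k ℤ.* coeff G′ i
    G-coeff i = ≡.trans (at G≋kG′ i) (coeff-· (+ k) G′ i)
    G₀≢0 : coeff G 0 ≢ 0ℤ
    G₀≢0 G₀≡0 = G′≢0 (ℤ.*-cancelˡ-≡ (+ k) (coeff G′ 0) 0ℤ (≡.trans (≡.sym (G-coeff 0)) (≡.trans G₀≡0 (≡.sym (ℤ.*-zeroʳ (+ k))))))
    r = proj₁ (ι-inverse (coeff G 0) G₀≢0)
    coeffs : ∀ i → Q.coeff (r Q.· map ι G) i ≡ Q.coeff (1ℚ ∷ []) i
    coeffs zero    = ≡.trans (Q.coeff-· r (map ι G) 0) (≡.trans (cong (r ℚ.*_) (coeff-toℚ G 0)) (proj₂ (ι-inverse (coeff G 0) G₀≢0)))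
    coeffs (suc i) = ≡.trans (Q.coeff-· r (map ι G) (suc i)) (≡.trans (cong (r ℚ.*_) (≡.trans (coeff-toℚ G (suc i)) (cong ι (≡.trans (G-coeff (suc i)) (≡.trans (cong (ℤ._*_ (+ k)) (G′< (suc i) (s≤s z≤n))) (ℤ.*-zeroʳ (+ k))))))) (ℚ.*-zeroʳ r))

  module _ (n-1 : ℕ) (2≤n : 2 ≤ suc n-1) (aₙ : ℤ) (d : ℕ) (φ : Poly) (1≤d : 1 ≤ d)
    (monic : MonicOfDegree d φ)
    (irr : ∀ p → Prime p → p < 2 ℕ.* suc n-1 → IrreducibleMod p φ)
    (a : Fin (suc n-1) → Poly) (a<d : ∀ j → DegLt d (a j))
    (p∤aₙ : ∀ p → Prime p → p < 2 ℕ.* suc n-1 → ¬ + p ∣ aₙ)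
    (p∤a₀ : ∀ p → Prime p → p < 2 ℕ.* suc n-1 → ¬ + p ∣ₚ a zero)
    where

    open Factorisation n-1 2≤n aₙ d φ 1≤d monic irr a a<d p∤aₙ p∤a₀

    private
      n U N : ℕ
      n = suc n-1
      U = u (2 ℕ.* n)
      N = 2 ℕ.* n ℕ.* d
      f : Q.Poly
      f = f₁ n aₙ φ a
      instance
        U≢0 : ℕ.NonZero U
        U≢0 = u-nonZero (2 ℕ.* n)

    aₙ≢0 : aₙ ≢ 0ℤ
    aₙ≢0 aₙ≡0 = p∤aₙ 2 prime[2] (ℕ.≤-trans (ℕ.n≤1+n 3) (ℕ.*-monoʳ-≤ 2 2≤n)) (divides 0ℤ aₙ≡0)

    ι-cofactor : ∀ j → j ≤ n → ι (+ U) ℚ.* (1ℤ /u (2 ℕ.* j)) ≡ ι (+ cofactor n j)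
    ι-cofactor j j≤n = begin
      ι (+ U) ℚ.* r                          ≡⟨ cong (λ x → ι x ℚ.* r) (≡.trans (cong +_ U≡) (ℤ.pos-* (cofactor n j) uⱼ)) ⟩
      ι (+ cofactor n j ℤ.* + uⱼ) ℚ.* r      ≡⟨ cong (ℚ._* r) (ι-* (+ cofactor n j) (+ uⱼ)) ⟩
      ι (+ cofactor n j) ℚ.* ι (+ uⱼ) ℚ.* r  ≡⟨ ℚ.*-assoc (ι (+ cofactor n j)) (ι (+ uⱼ)) r ⟩
      ι (+ cofactor n j) ℚ.* (ι (+ uⱼ) ℚ.* r) ≡⟨ cong (ι (+ cofactor n j) ℚ.*_) (ι*/ uⱼ {{u-nonZero (2 ℕ.* j)}} 1ℤ) ⟩
      ι (+ cofactor n j) ℚ.* 1ℚ              ≡⟨ ℚ.*-identityʳ _ ⟩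
      ι (+ cofactor n j)                     ∎
      where
      open ≡.≡-Reasoning
      uⱼ = u (2 ℕ.* j)
      r = 1ℤ /u (2 ℕ.* j)
      U≡ : U ≡ cofactor n j ℕ.* uⱼ
      U≡ = ≡.trans (u≡oddProduct n) (≡.trans (cofactor-* n j j≤n) (≡.trans (cong (ℕ._* cofactor n j) (≡.sym (u≡oddProduct j))) (ℕ.*-comm uⱼ (cofactor n j))))

    sum-scale : ∀ {k} (s : Fin k → Poly) (t : Fin k → Q.Poly) → (∀ j → ι (+ U) Q.· t j Q.≋ map ι (s j)) → ι (+ U) Q.· Q.sum t Q.≋ map ι (sum s)
    sum-scale {zero}  s t eq = Q.≋-refl
    sum-scale {suc k} s t eq = Q.≋-trans (Q.·-distribˡ (ι (+ U)) (t zero) (Q.sum (t ∘ suc)))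
      (subst (ι (+ U) Q.· t zero Q.+ₚ ι (+ U) Q.· Q.sum (t ∘ suc) Q.≋_) (≡.sym (toℚ-+ (s zero) (sum (s ∘ suc))))
        (Q.+ₚ-cong (eq zero) (sum-scale (s ∘ suc) (t ∘ suc) (eq ∘ suc))))

    U·f≋F : ι (+ U) Q.· f Q.≋ map ι F
    U·f≋F = Q.≋-trans (Q.·-distribˡ (ι (+ U)) top (Q.sum terms))
      (subst (ι (+ U) Q.· top Q.+ₚ ι (+ U) Q.· Q.sum terms Q.≋_) (≡.sym (toℚ-+ (aₙ · φ ^ (2 ℕ.* n)) (sum summand)))
        (Q.+ₚ-cong leadingTerm (sum-scale summand terms term)))
      where
      Φ : ℕ → Q.Poly
      Φ k = map ι φ Q.^ k
      top : Q.Poly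
      top = (aₙ /u (2 ℕ.* n)) Q.· Φ (2 ℕ.* n)
      terms : Fin n → Q.Poly
      terms j = map ι (a j) Q.*ₚ ((1ℤ /u (2 ℕ.* toℕ j)) Q.· Φ (2 ℕ.* toℕ j))
      scaled : ∀ c b z k → c ℚ.* b ≡ ι z → c Q.· (b Q.· Φ k) Q.≋ map ι (z · φ ^ k)
      scaled c b z k eq = Q.≋-trans (Q.≋-sym (Q.·-assoc c b (Φ k))) (subst ((c ℚ.* b) Q.· Φ k Q.≋_) (≡.sym (≡.trans (toℚ-· z (φ ^ k)) (cong (ι z Q.·_) (toℚ-^ φ k))))
        (Q.·-cong {f = Φ k} {Φ k} eq Q.≋-refl))
      leadingTerm : ι (+ U) Q.· ((aₙ /u (2 ℕ.* n)) Q.· Φ (2 ℕ.* n)) Q.≋ map ι (aₙ · φ ^ (2 ℕ.* n))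
      leadingTerm = scaled (ι (+ U)) (aₙ /u (2 ℕ.* n)) aₙ (2 ℕ.* n) (ι*/ U aₙ)
      term : ∀ j → ι (+ U) Q.· (map ι (a j) Q.*ₚ ((1ℤ /u (2 ℕ.* toℕ j)) Q.· Φ (2 ℕ.* toℕ j))) Q.≋ map ι (summand j)
      term j = Q.≋-trans (Q.≋-sym (Q.*ₚ-· (map ι (a j)) (ι (+ U)) r))
        (subst (map ι (a j) Q.*ₚ (ι (+ U) Q.· r) Q.≋_) (≡.sym (toℚ-* (a j) ((+ cofactor n (toℕ j)) · φ ^ (2 ℕ.* toℕ j))))
          (Q.*ₚ-congˡ (map ι (a j)) (scaled (ι (+ U)) (1ℤ /u (2 ℕ.* toℕ j)) (+ cofactor n (toℕ j)) (2 ℕ.* toℕ j) (ι-cofactor (toℕ j) (ℕ.<⇒≤ (toℕ<n j))))))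
        where r = (1ℤ /u (2 ℕ.* toℕ j)) Q.· Φ (2 ℕ.* toℕ j)

    -- Needed for `x = f` with `X = F`, and for `x = 1` with the constant `U`. The factor `U` is put
    -- on `G` so that both sides are integral.
    clearProduct : ∀ {g h x} X → map ι X Q.≋ ι (+ U) Q.· x → g Q.*ₚ h Q.≋ x →
      ∀ {D D′ G H} → map ι G Q.≋ ι (+ D) Q.· g → map ι H Q.≋ ι (+ D′) Q.· h →
      (+ U · G) *ₚ H ≋ + (D ℕ.* D′) · X
    clearProduct {g} {h} {x} X X≋ gh≋x {D} {D′} {G} {H} G≋ H≋ = toℚ-injective (begin
      map ι ((+ U · G) *ₚ H)                            ≡⟨ ≡.trans (toℚ-* (+ U · G) H) (cong (Q._*ₚ map ι H) (toℚ-· (+ U) G)) ⟩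
      (c Q.· map ι G) Q.*ₚ map ι H                      ≈⟨ Q.·-*ₚ c (map ι G) (map ι H) ⟩
      c Q.· (map ι G Q.*ₚ map ι H)                      ≈⟨ Q.·-cong {c} ≡.refl (Q.*ₚ-cong G≋ H≋) ⟩
      c Q.· ((ι (+ D) Q.· g) Q.*ₚ (ι (+ D′) Q.· h))     ≈⟨ Q.·-cong {c} ≡.refl (Q.·-*ₚ (ι (+ D)) g (ι (+ D′) Q.· h)) ⟩
      c Q.· (ι (+ D) Q.· (g Q.*ₚ (ι (+ D′) Q.· h)))     ≈⟨ Q.·-cong {c} ≡.refl (Q.·-cong {ι (+ D)} ≡.refl (Q.*ₚ-· g (ι (+ D′)) h)) ⟩
      c Q.· (ι (+ D) Q.· (ι (+ D′) Q.· (g Q.*ₚ h)))     ≈⟨ Q.·-cong {c} ≡.refl (Q.·-assoc (ι (+ D)) (ι (+ D′)) (g Q.*ₚ h)) ⟨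
      c Q.· ((ι (+ D) ℚ.* ι (+ D′)) Q.· (g Q.*ₚ h))     ≈⟨ Q.·-assoc c (ι (+ D) ℚ.* ι (+ D′)) (g Q.*ₚ h) ⟨
      (c ℚ.* (ι (+ D) ℚ.* ι (+ D′))) Q.· (g Q.*ₚ h)     ≈⟨ Q.·-cong (≡.trans (ℚ.*-comm c _) (cong (ℚ._* c) (≡.sym (≡.trans (cong ι (ℤ.pos-* D D′)) (ι-* (+ D) (+ D′)))))) gh≋x ⟩
      (ι (+ (D ℕ.* D′)) ℚ.* c) Q.· x                    ≈⟨ Q.·-assoc (ι (+ (D ℕ.* D′))) c x ⟩
      ι (+ (D ℕ.* D′)) Q.· (c Q.· x)                    ≈⟨ Q.·-cong {ι (+ (D ℕ.* D′))} ≡.refl X≋ ⟨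
      ι (+ (D ℕ.* D′)) Q.· map ι X                      ≡⟨ toℚ-· (+ (D ℕ.* D′)) X ⟨
      map ι (+ (D ℕ.* D′) · X)                          ∎)
      where
      c = ι (+ U)
      open import Relation.Binary.Reasoning.Setoid (CommutativeRing.setoid Q.polyCommutativeRing)

    degree-sum : ∀ {G H eG eH} → G *ₚ H ≋ F → DegLt (suc eG) G → coeff G eG ≢ 0ℤ → DegLt (suc eH) H → coeff H eH ≢ 0ℤ →
      eG ℕ.+ eH ≡ N × coeff G eG ℤ.* coeff H eH ≡ aₙ
    degree-sum {G} {H} {eG} {eH} GH≋F G< G≢0 H< H≢0 = compare (ℕ.<-cmp (eG ℕ.+ eH) N)
      where
      open import Relation.Binary.Definitions using (Tri; tri<; tri≈; tri>)
      GH = degree-* {eG} {eH} G H G< H<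
      compare : Tri (eG ℕ.+ eH < N) (eG ℕ.+ eH ≡ N) (N < eG ℕ.+ eH) → eG ℕ.+ eH ≡ N × coeff G eG ℤ.* coeff H eH ≡ aₙ
      compare (tri< e<N _ _) = contradiction (≡.trans (≡.sym F-top) (≡.trans (≡.sym (at GH≋F N)) (proj₁ GH N e<N))) aₙ≢0
      compare (tri> _ _ N<e) = contradiction (≡.trans (≡.sym (proj₂ GH)) (≡.trans (at GH≋F (eG ℕ.+ eH)) (F< (eG ℕ.+ eH) N<e)))
        λ prod≡0 → [ G≢0 , H≢0 ]′ (ℤ.i*j≡0⇒i≡0∨j≡0 (coeff G eG) prod≡0)
      compare (tri≈ _ e≡N _) = e≡N , ≡.trans (≡.sym (proj₂ GH)) (≡.trans (at GH≋F (eG ℕ.+ eH)) (≡.trans (cong (coeff F) e≡N) F-top))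

    constantFactor : ∀ G H → G *ₚ H ≋ F → (DegLt 1 G × coeff G 0 ≢ 0ℤ) ⊎ (DegLt 1 H × coeff H 0 ≢ 0ℤ)
    constantFactor G H GH≋F = factors (degreeOf G) (degreeOf H)
      where
      F≢0 : ¬ F ≋ []
      F≢0 F≋[] = aₙ≢0 (≡.trans (≡.sym F-top) (at F≋[] N))
      factors : G ≋ [] ⊎ (∃ λ e → DegLt (suc e) G × coeff G e ≢ 0ℤ) → H ≋ [] ⊎ (∃ λ e → DegLt (suc e) H × coeff H e ≢ 0ℤ) →
        (DegLt 1 G × coeff G 0 ≢ 0ℤ) ⊎ (DegLt 1 H × coeff H 0 ≢ 0ℤ)
      factors (inj₁ G≋[]) _ = contradiction (≋-trans (≋-sym GH≋F) (*ₚ-cong {G} {[]} {H} {H} G≋[] ≋-refl)) F≢0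
      factors (inj₂ _) (inj₁ H≋[]) = contradiction (≋-trans (≋-sym GH≋F) (≋-trans (*ₚ-congˡ G H≋[]) (*ₚ-zeroʳ G))) F≢0
      factors (inj₂ (zero , G< , G≢0)) (inj₂ _) = inj₁ (G< , G≢0)
      factors (inj₂ (suc _ , _)) (inj₂ (zero , H< , H≢0)) = inj₂ (H< , H≢0)
      factors (inj₂ (eG@(suc _) , G< , G≢0)) (inj₂ (eH@(suc _) , H< , H≢0)) = ⊥-elim (split (ℕ.≤-total eG eH))
        where
        e≡ = proj₁ (degree-sum {G} {H} {eG} {eH} GH≋F G< G≢0 H< H≢0)
        top≡ = proj₂ (degree-sum {G} {H} {eG} {eH} GH≋F G< G≢0 H< H≢0)
        split : eG ≤ eH ⊎ eH ≤ eG → ⊥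
        split (inj₁ G≤H) = noFactorisation G H eG eH (≋-sym GH≋F) G< H< top≡ e≡ (s≤s z≤n) G≤H
        split (inj₂ H≤G) = noFactorisation H G eH eG (≋-trans (≋-sym GH≋F) (*ₚ-comm G H)) H< G<
          (≡.trans (ℤ.*-comm (coeff H eH) (coeff G eG)) top≡) (≡.trans (ℕ.+-comm eH eG) e≡) (s≤s z≤n) H≤G

    irreducible : ℚ[x].Irreducible f
    irreducible = SemiringDefs.mkIrred not-unit (λ {x} {y} f≈xy → split x y f≈xy)
      where
      -- If `f` had an inverse, clearing denominators would make a nonzero integral multiple of `F`
      -- constant, although `F` has degree `N ≥ 1`.
      not-unit : ¬ SemiringDefs._∣_ ℚ[x].polyRawSemiring f (1ℚ ∷ [])
      not-unit (record { quotient = q ; equality = qf≈1 }) = degrees (degreeOf G)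
        where
        instance
          D≢0 : ℕ.NonZero (proj₁ (clearDenominators q))
          D≢0 = proj₁ (proj₂ (proj₂ (clearDenominators q)))
        D = proj₁ (clearDenominators q)
        G = proj₁ (proj₂ (clearDenominators q))
        G≋ : map ι G Q.≋ ι (+ D) Q.· q
        G≋ = proj₂ (proj₂ (proj₂ (clearDenominators q)))
        const : map ι (+ U ∷ []) Q.≋ ι (+ U) Q.· (1ℚ ∷ [])
        const = Q.mk λ { zero → ≡.sym (ℚ.*-identityʳ (ι (+ U))) ; (suc i) → ≡.refl }
        product≋ : (+ U · G) *ₚ F ≋ + (D ℕ.* U) · (+ U ∷ [])
        product≋ = clearProduct {q} {f} {1ℚ ∷ []} (+ U ∷ []) const (Q.mk qf≈1) {D} {U} {G} {F} G≋ (Q.≋-sym U·f≋F)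
        U·GF : (+ U · G) *ₚ F ≋ + U · (G *ₚ F)
        U·GF = ·-*ₚ (+ U) G F
        degrees : G ≋ [] ⊎ (∃ λ e → DegLt (suc e) G × coeff G e ≢ 0ℤ) → ⊥
        degrees (inj₁ G≋[]) = contradiction (ℤ.+-injective (≡.trans (ℤ.pos-* (D ℕ.* U) U) (≡.trans (≡.sym (at product≋ 0))
          (at (≋-trans (*ₚ-cong {+ U · G} {[]} {F} {F} (·-cong {+ U} {+ U} {G} {[]} ≡.refl G≋[]) ≋-refl) ≋-refl) 0)))) (ℕ.≢-nonZero⁻¹ _ {{ℕ.m*n≢0 (D ℕ.* U) U {{ℕ.m*n≢0 D U}}}})
        degrees (inj₂ (e , G< , G≢0)) = [ G≢0 , aₙ≢0 ]′ (ℤ.i*j≡0⇒i≡0∨j≡0 (coeff G e) (≡.trans (cong (ℤ._*_ (coeff G e)) (≡.sym F-top)) (≡.trans (≡.sym (proj₂ (degree-* {e} {N} G F G< F<))) GF≡0)))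
          where
          1≤e+N : 1 ≤ e ℕ.+ N
          1≤e+N = ℕ.≤-trans (ℕ.≤-trans 1≤d (ℕ.m≤n*m d (2 ℕ.* n))) (ℕ.m≤n+m N e)
          above : ∀ i → 1 ≤ i → coeff (+ (D ℕ.* U) · (+ U ∷ [])) i ≡ 0ℤ
          above (suc i) _ = ≡.refl
          GF≡0 : coeff (G *ₚ F) (e ℕ.+ N) ≡ 0ℤ
          GF≡0 = ℤ.*-cancelˡ-≡ (+ U) (coeff (G *ₚ F) (e ℕ.+ N)) 0ℤ (≡.trans (≡.sym (coeff-· (+ U) (G *ₚ F) (e ℕ.+ N)))
            (≡.trans (≡.sym (at U·GF (e ℕ.+ N))) (≡.trans (at product≋ (e ℕ.+ N)) (≡.trans (above (e ℕ.+ N) 1≤e+N) (≡.sym (ℤ.*-zeroʳ (+ U)))))))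
      split : ∀ x y → f ℚ[x].≈ₚ x ℚ[x].*ₚ y → SemiringDefs._∣_ ℚ[x].polyRawSemiring x (1ℚ ∷ []) ⊎ SemiringDefs._∣_ ℚ[x].polyRawSemiring y (1ℚ ∷ [])
      split x y f≈xy = factors (clearDenominators x) (clearDenominators y)
        where
        divisor : ∀ {g} → (∃ λ q → q Q.*ₚ g Q.≋ (1ℚ ∷ [])) → SemiringDefs._∣_ ℚ[x].polyRawSemiring g (1ℚ ∷ [])
        divisor (q , qg≋1) = record { quotient = q ; equality = Q.at qg≋1 }
        factors : (∃₂ λ D G → ℕ.NonZero D × map ι G Q.≋ ι (+ D) Q.· x) → (∃₂ λ D H → ℕ.NonZero D × map ι H Q.≋ ι (+ D) Q.· y) →
          SemiringDefs._∣_ ℚ[x].polyRawSemiring x (1ℚ ∷ []) ⊎ SemiringDefs._∣_ ℚ[x].polyRawSemiring y (1ℚ ∷ [])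
        factors (D , G , D≢0 , G≋) (D′ , H , D′≢0 , H≋) = conclude (integralFactors (D ℕ.* D′) {{ℕ.m*n≢0 D D′ {{D≢0}} {{D′≢0}}}} F (+ U · G) H
            (clearProduct {x} {y} {f} F (Q.≋-sym U·f≋F) (Q.≋-sym (Q.mk f≈xy)) {D} {D′} {G} {H} G≋ H≋))
          where
          UG≋ : map ι (+ U · G) Q.≋ ι (+ (U ℕ.* D)) Q.· x
          UG≋ = subst (Q._≋ ι (+ (U ℕ.* D)) Q.· x) (≡.sym (toℚ-· (+ U) G))
            (Q.≋-trans (Q.·-cong {ι (+ U)} ≡.refl G≋) (Q.≋-trans (Q.≋-sym (Q.·-assoc (ι (+ U)) (ι (+ D)) x)) (Q.·-cong {f = x} {x} (≡.sym (≡.trans (cong ι (ℤ.pos-* U D)) (ι-* (+ U) (+ D)))) Q.≋-refl)))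
          conclude : (∃₂ λ G′ H′ → IsMultiple G′ (+ U · G) × IsMultiple H′ H × G′ *ₚ H′ ≋ F) →
            SemiringDefs._∣_ ℚ[x].polyRawSemiring x (1ℚ ∷ []) ⊎ SemiringDefs._∣_ ℚ[x].polyRawSemiring y (1ℚ ∷ [])
          conclude (G′ , H′ , mG , mH , G′H′≋F) = Sum.map
            (λ (G′< , G′≢0) → divisor (constant⇒unit {x} {+ U · G} {G′} {U ℕ.* D} UG≋ mG G′< G′≢0))
            (λ (H′< , H′≢0) → divisor (constant⇒unit {y} {H} {H′} {D′} H≋ mH H′< H′≢0))
            (constantFactor G′ H′ G′H′≋F)

  -- In degree 0 the monic `φ` would be 1, a unit modulo 2 and hence not irreducible.
  positiveDegree : ∀ {d φ} → MonicOfDegree d φ → IrreducibleMod 2 φ → 1 ≤ d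
  positiveDegree {suc d} _     _   = s≤s z≤n
  positiveDegree {zero} {φ} monic irr = contradiction (record { quotient = 1ℤ ∷ [] ; equality = φ≈1 }) (SemiringDefs.Irreducible.p∤1 irr)
    where
    open Reduction 2
    φ≋1 : φ ≋ 1ℤ ∷ []
    φ≋1 .at zero    = leading monic
    φ≋1 .at (suc i) = bounded monic (suc i) (s≤s z≤n)
    φ≈1 : (1ℤ ∷ []) F.*ₚ φ F.≈ₚ (1ℤ ∷ [])
    φ≈1 i = subst (Data.Integer.Divisibility._∣_ (+ 2)) (≡.sym (≡.trans (cong₂ ℤ._-_
      (≡.trans (coeff≡ ((1ℤ ∷ []) F.*ₚ φ) i) (≡.trans (cong (λ h → coeff h i) (*≡ (1ℤ ∷ []) φ)) (at (≋-trans (*ₚ-identityˡ φ) φ≋1) i)))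
      (coeff≡ (1ℤ ∷ []) i)) (ℤ.+-inverseʳ (coeff (1ℤ ∷ []) i)))) (2 ℕ.∣0)

  irreducible-f₁ : (n : ℕ) (2≤n : 2 ≤ n) (aₙ : ℤ) (φ : ℤ[x].Poly) →
      Monic φ →
      (∀ p → Prime p → p < 2 ℕ.* n → IrreducibleMod p φ) →
      (a : Fin n → ℤ[x].Poly) →
      (∀ i → a i <deg φ) →
      (∀ p → Prime p → p < 2 ℕ.* n →
      ¬ (Data.Integer.Divisibility._∣_ (+ p) (content (aₙ ℤ[x].· a (fromℕ< (ℕ.m<n⇒0<n 2≤n)))))) →
      ℚ[x].Irreducible (f₁ n aₙ φ a)
  irreducible-f₁ (suc n-1) 2≤n aₙ φ (d , deg-φ , top) irr a a<φ p∤content =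
    irreducible n-1 2≤n aₙ d φ 1≤d monic irr a (λ j → <deg⇒DegLt (a j) φ d deg-φ (a<φ j))
      (λ p pp p<2n p∣aₙ → p∤content p pp p<2n (∣content p (aₙ · a zero) λ i → subst (+ p ∣_) (≡.sym (coeff-· aₙ (a zero) i)) (∣m⇒∣m*n (coeff (a zero) i) p∣aₙ)))
      (λ p pp p<2n p∣a₀ → p∤content p pp p<2n (∣content p (aₙ · a zero) λ i → subst (+ p ∣_) (≡.sym (coeff-· aₙ (a zero) i)) (∣n⇒∣m*n aₙ (p∣a₀ i))))
    where
    monic : MonicOfDegree d φ
    monic = record { leading = top ; bounded = deg-[] φ d deg-φ }
    1≤d : 1 ≤ d
    1≤d = positiveDegree monic (irr 2 prime[2] (ℕ.≤-trans (ℕ.n≤1+n 3) (ℕ.*-monoʳ-≤ 2 2≤n)))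

open import Defs
open import Data.Fin.Base using (Fin; fromℕ<)
open import Data.Integer.Base using (ℤ; +_)
open import Data.Integer.Divisibility using (_∣_)
open import Data.Nat.Base using (ℕ; _*_; _≤_; _<_)
open import Data.Nat.Primality using (Prime)
open import Data.Nat.Properties using (m<n⇒0<n)
open import Relation.Nullary.Negation.Core using (¬_)

theorem1p3 : (n : ℕ) (2≤n : 2 ≤ n) (aₙ : ℤ) (φ : ℤ[x].Poly) →
    Monic φ →
    (∀ p → Prime p → p < 2 * n → IrreducibleMod p φ) →
    (a : Fin n → ℤ[x].Poly) →
    (∀ i → a i <deg φ) →
    (∀ p → Prime p → p < 2 * n →
    ¬ (+ p ∣ content (aₙ ℤ[x].· a (fromℕ< (m<n⇒0<n 2≤n))))) →
    ℚ[x].Irreducible (f₁ n aₙ φ a)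
theorem1p3 = RationalPolynomials.irreducible-f₁
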